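{- For any non-empty indices $\mathbf{k}=(k_1,\dots,k_r)$ and $\mathbf{l}=(l_1,\dots,l_s)$, \[\zeta\bigl(\mu(\mathbf{k},\mathbf{l})\bigr)=\zeta\bigl(\mathbf{k}\circledast\mathbf{l}^\star\bigr).\]
   Context: Let $\mathfrak{H}=\mathbb{Q}\langle e_0,e_1\rangle$ be the noncommutative polynomial algebra over $\mathbb{Q}$ in two indeterminates, $\mathfrak{H}^1=\mathbb{Q}+e_1\mathfrak{H}$ and $\mathfrak{H}^0=\mathbb{Q}+e_1\mathfrak{H}e_0$. For an integer $k\ge 1$ put $e_k=e_1e_0^{k-1}$. An index is a finite (possibly empty) sequence $\mathbf{k}=(k_1,\dots,k_r)$ of positive integers ($r$ = depth, $k_1+\dots+k_r$ = weight); it is admissible if it is empty or $k_r\ge 2$. Indices are identified with the words $e_{k_1}\cdots e_{k_r}$ (the empty index $\varnothing$ with $1$); these form a basis of $\mathfrak{H}^1$, and those of admissible indices a basis of $\mathfrak{H}^0$; maps defined on indices are extended $\mathbb{Q}$-linearly. For admissible $\mathbf{k}$, $\zeta(\mathbf{k})=\sum_{0<m_1<\cdots<m_r}m_1^{ -k_1}\cdots m_r^{ -k_r}$, $\zeta(\varnothing)=1$, extended linearly to $\zeta:\mathfrak{H}^0\to\mathbb{R}$. Harmonic product: the $\mathbb{Q}$-bilinear product $*$ on $\mathfrak{H}^1$ with $1*w=w*1=w$ and $e_kv*e_lw=e_k(v*e_lw)+e_l(e_kv*w)+e_{k+l}(v*w)$ for $k,l\ge1$, $v,w\in\mathfrak{H}^1$.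 Circled harmonic product: the $\mathbb{Q}$-bilinear map $\circledast:e_1\mathfrak{H}\times e_1\mathfrak{H}\to e_1\mathfrak{H}e_0$ with $ve_k\circledast we_l=(v*w)e_{k+l}$ for $v,w\in\mathfrak{H}^1$, $k,l\ge1$. For non-empty $\mathbf{l}=(l_1,\dots,l_s)$, $\mathbf{l}^\star\in\mathfrak{H}^1$ is the sum of the $2^{s-1}$ indices $(l_1\bigcirc l_2\bigcirc\cdots\bigcirc l_s)$ where each $\bigcirc$ is either a comma or a plus sign. (Equivalently, $\zeta(\mathbf{k}\circledast\mathbf{l}^\star)=\sum_{0<m_1<\cdots<m_r=n_s\ge\cdots\ge n_1>0}m_1^{ -k_1}\cdots m_r^{ -k_r}n_1^{ -l_1}\cdots n_s^{ -l_s}$.) A 2-poset is a finite poset $X$ with a label map $\delta_X:X\to\{0,1\}$. Its word $W(X)\in\mathfrak{H}$ is the sum, over all linear extensions of the order (enumerations $x_1,\dots,x_n$ of $X$ such that $x_i<x_j$ in $X$ implies $i<j$), of $e_{\delta_X(x_1)}e_{\delta_X(x_2)}\cdots e_{\delta_X(x_n)}$; $W(\emptyset)=1$. Definition of $\mu(\mathbf{k},\mathbf{l})$: let $K=k_1+\dots+k_r$. Take elements $a_1,\dots,a_K$ and $b_{j,i}$ ($1\le j\le s$, $1\le i\le l_j$), with the partial order generated by $a_1<a_2<\cdots<a_K$, $a_K<b_{s,1}$, $b_{j,1}<b_{j,2}<\cdots<b_{j,l_j}$ for each $j$, and $b_{j-1,1}<b_{j,l_j}$ for $2\le j\le s$.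 Labels: $\delta(a_t)=1$ iff $t\in\{1,k_1+1,k_1+k_2+1,\dots,k_1+\dots+k_{r-1}+1\}$, else $0$; $\delta(b_{s,1})=0$; $\delta(b_{j,1})=1$ for $j<s$; $\delta(b_{j,i})=0$ for $i\ge2$. Then $\mu(\mathbf{k},\mathbf{l})\in\mathfrak{H}^0$ is $W$ of this 2-poset. -}

module Defs where

open import Data.Bool using (Bool; true; false; _∧_; _∨_; not; if_then_else_)
open import Data.Nat as ℕ using (ℕ; zero; suc; _≡ᵇ_)
open import Data.List using (List; []; _∷_; _++_; map; concat; concatMap; filter; foldr; length)
open import Data.Nat.ListAction using (sum)
open import Data.Product using (_×_; _,_)
open import Data.Rational using (ℚ; 0ℚ; 1ℚ; _+_; _*_; _/_)
open import Data.Integer using (+_)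
open import Relation.Nullary.Decidable using (does)
open import Data.Bool.Properties using (T?)

-- A word in 𝔥 = ℚ⟨e₀,e₁⟩ : a list of letters, true = e₁, false = e₀.
Word : Set
Word = List Bool

-- An index (k₁,…,k_r) : a list of natural numbers (positivity is a
-- separate hypothesis where needed).
Index : Set
Index = List ℕ

-- All elements appearing below have coefficient 1, so an element of 𝔥
-- (resp. 𝔥¹) is represented by the (multi)list of its words (resp.
-- indices), i.e. a formal sum with multiplicities.

-- the word e_k = e₁ e₀^{k-1}  →  index conversion for words e_{k₁}⋯e_{k_r}
-- (leading e₀'s, which do not occur for words of 𝔥¹, are ignored)
private
  toIndexAux : ℕ → Word → Index
  toIndexAux c []          = c ∷ []
  toIndexAux c (true ∷ w)  = c ∷ toIndexAux 1 w
  toIndexAux c (false ∷ w) = toIndexAux (suc c) w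

toIndex : Word → Index
toIndex []          = []
toIndex (true ∷ w)  = toIndexAux 1 w
toIndex (false ∷ w) = toIndex w

infixl 7 _⋆_
_⋆_ : Index → Index → List Index
[] ⋆ w = w ∷ []
(k ∷ v) ⋆ w = go w
  where
  go : Index → List Index
  go []       = (k ∷ v) ∷ []
  go (l ∷ w′) = map (k ∷_) (v ⋆ (l ∷ w′))
             ++ map (l ∷_) (go w′)
             ++ map (k ℕ.+ l ∷_) (v ⋆ w′)

unsnoc : Index → List (Index × ℕ)
unsnoc []      = []
unsnoc (k ∷ []) = ([] , k) ∷ []
unsnoc (k ∷ v@(_ ∷ _)) = map (λ { (u , m) → (k ∷ u , m) }) (unsnoc v)

_⊛_ : Index → Index → List Index
a ⊛ b = concatMap (λ { (v , k) → concatMap (λ { (w , l) →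
          map (λ u → u ++ (k ℕ.+ l ∷ [])) (v ⋆ w) }) (unsnoc b) }) (unsnoc a)

_⊛Σ_ : Index → List Index → List Index
a ⊛Σ bs = concatMap (a ⊛_) bs

private
  starAux : ℕ → Index → List Index
  starAux a []       = (a ∷ []) ∷ []
  starAux a (b ∷ bs) = map (a ∷_) (starAux b bs) ++ starAux (a ℕ.+ b) bs

star : Index → List Index
star []       = []
star (a ∷ as) = starAux a as

-- A finite 2-poset: a duplicate-free list of elements, a label map, and a
-- list of generating relations (x , y) meaning x < y; the order is the
-- reflexive-transitive closure of these.
record TwoPoset (E : Set) : Set where
  field
    elems  : List E
    eqᵇ    : E → E → Bool
    label  : E → Bool
    gens   : List (E × E)

insertAll : {E : Set} → E → List E → List (List E)
insertAll x []       = (x ∷ []) ∷ []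
insertAll x (y ∷ ys) = (x ∷ y ∷ ys) ∷ map (y ∷_) (insertAll x ys)

perms : {E : Set} → List E → List (List E)
perms []       = [] ∷ []
perms (x ∷ xs) = concatMap (insertAll x) (perms xs)

module _ {E : Set} (X : TwoPoset E) where
  open TwoPoset X

  before : E → E → List E → Bool
  before x y []       = false
  before x y (z ∷ zs) = if eqᵇ z y then false
                        else (if eqᵇ z x then true else before x y zs)

  -- an enumeration respects the order iff it respects all generating relations
  IsLinExt : List E → Bool
  IsLinExt xs = foldr (λ { (x , y) b → before x y xs ∧ b }) true gens

  linExts : List (List E)
  linExts = filter (λ xs → T? (IsLinExt xs)) (perms elems)

  W : List Word
  W = map (map label) linExts

data Elt : Set where
  a : ℕ → Elt
  b : ℕ → ℕ → Elt

eltEq : Elt → Elt → Bool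
eltEq (a t)   (a t′)    = t ≡ᵇ t′
eltEq (a _)   (b _ _)   = false
eltEq (b _ _) (a _)     = false
eltEq (b j i) (b j′ i′) = (j ≡ᵇ j′) ∧ (i ≡ᵇ i′)

range1 : ℕ → List ℕ
range1 zero    = []
range1 (suc n) = range1 n ++ (suc n ∷ [])

enumerate1 : Index → List (ℕ × ℕ)
enumerate1 = go 1
  where
  go : ℕ → Index → List (ℕ × ℕ)
  go j []       = []
  go j (x ∷ xs) = (j , x) ∷ go (suc j) xs

-- lookup l_j (1-based); 0 if out of range
nth1 : Index → ℕ → ℕ
nth1 []       _             = 0
nth1 (x ∷ xs) zero          = 0
nth1 (x ∷ xs) (suc zero)    = x
nth1 (x ∷ xs) (suc (suc j)) = nth1 xs (suc j)

starts : Index → List ℕ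
starts = go 1
  where
  go : ℕ → Index → List ℕ
  go c []       = []
  go c (k ∷ ks) = c ∷ go (c ℕ.+ k) ks

memᵇ : ℕ → List ℕ → Bool
memᵇ x = foldr (λ y r → (x ≡ᵇ y) ∨ r) false

μPoset : Index → Index → TwoPoset Elt
μPoset ks ls = record
  { elems = map a (range1 K)
            ++ concatMap (λ { (j , lj) → map (b j) (range1 lj) }) (enumerate1 ls)
  ; eqᵇ   = eltEq
  ; label = lab
  ; gens  = map (λ t → (a t , a (suc t))) (range1 (K ℕ.∸ 1))
            ++ ((a K , b s 1) ∷ [])
            ++ concatMap (λ { (j , lj) → map (λ i → (b j i , b j (suc i))) (range1 (lj ℕ.∸ 1)) })
                         (enumerate1 ls)
            ++ map (λ j → (b j 1 , b (suc j) (nth1 ls (suc j)))) (range1 (s ℕ.∸ 1))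
  }
  where
  K = sum ks
  s = length ls
  lab : Elt → Bool
  lab (a t)             = memᵇ t (starts ks)
  lab (b j zero)        = false
  lab (b j (suc zero))  = not (j ≡ᵇ s)
  lab (b j (suc (suc i))) = false

μ : Index → Index → List Word
μ ks ls = W (μPoset ks ls)

powℚ : ℚ → ℕ → ℚ
powℚ q zero    = 1ℚ
powℚ q (suc n) = q * powℚ q n

sumRange : ℕ → ℕ → (ℕ → ℚ) → ℚ
sumRange lo zero    f = 0ℚ
sumRange lo (suc N) f = sumRange lo N f + (if lo ℕ.<ᵇ suc N then f (suc N) else 0ℚ)

ζtrunc : ℕ → ℕ → Index → ℚ
ζtrunc lo N []       = 1ℚ
ζtrunc lo N (k ∷ ks) = sumRange lo N (λ m → powℚ (recip m) k * ζtrunc m N ks)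
  where
  recip : ℕ → ℚ
  recip zero    = 0ℚ
  recip (suc m) = + 1 / suc m

-- ζ_N(k) = Σ_{0 < m₁ < ⋯ < m_r ≤ N} ; ζ(k) = lim_{N→∞} ζ_N(k)
ζN : ℕ → Index → ℚ
ζN N = ζtrunc 0 N

ζNΣ : ℕ → List Index → ℚ
ζNΣ N = foldr (λ k q → ζN N k + q) 0ℚ

ζNW : ℕ → List Word → ℚ
ζNW N ws = ζNΣ N (map toIndex ws)

{-# OPTIONS --safe #-}
-- Write f ⊗ g for the product of power series, and represent a word by the
-- series Li(t) of its iterated integral from 0 to t, so that ζ_N is the sum of
-- the coefficients up to N, and shuffles become products.  The 2-poset of
-- μ(𝐤, 𝐥) is a zigzag of chains.  Splitting "b_{j-1,1} < b_{j,l_j}" as "no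
-- condition" minus the reverse relation gives a recursion for its series:
-- if f is the series of the top chain and Q that of the remaining zigzag, then
-- the new series is f Q minus the one where f is integrated along the next
-- chain.  With A the sum of the coefficients of f up to N, the identity
-- (1 - t^m)/(1 - t) = 1 + ⋯ + t^{m-1} turns A - f(t) into the series of tail
-- sums U f, which removes a chain and contributes the sum over n_{j-1} ≤ n_j;
-- after all chains are removed, what remains is exactly ζ_N(𝐤 ⊛ 𝐥^⋆).  Each
-- step costs the coefficient (U f ⊗ Q)_{N+1}, which is O(H^p / N) because
-- f_n = O(H^a / n²) and Q_n = O(H^b / n) for the harmonic number H = H_{N+1}.
module Submission where

open import Defs renaming (a to 𝕒; b to 𝕓)
open import Data.Bool using (Bool; true; false; if_then_else_; _∧_; not; T)
open import Data.Bool.Properties using (T?; ∧-assoc; ∧-comm; ∧-zeroʳ)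
open import Data.Empty using (⊥; ⊥-elim)
open import Data.Unit using (⊤)
import Data.Integer as ℤ
import Data.Integer.Properties as ℤₚ
import Data.Integer.Tactic.RingSolver as ℤ-Solver
open import Data.List using (List; []; _∷_; [_]; _++_; _∷ʳ_; map; reverse; concatMap; replicate; length; foldr; filter; initLast; _∷ʳ′_)
open import Data.List.Membership.Propositional using (_∈_)
open import Data.List.Membership.Propositional.Properties using (∈-++⁺ˡ; ∈-++⁺ʳ)
import Data.List.Properties as Lₚ
open import Data.List.Relation.Binary.Permutation.Propositional using (_↭_; prep; swap; ↭-refl; ↭-sym; ↭-trans; ↭-prep; ↭-swap; ↭-reflexive; ↭⇒↭ₛ; module PermutationReasoning)
open import Data.List.Relation.Binary.Permutation.Propositional.Properties using (∈-resp-↭; ++-comm; ++⁺ˡ; shifts)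
import Data.List.Relation.Binary.Permutation.Setoid.Properties as Permₛ
open import Data.List.Relation.Ternary.Interleaving.Propositional using (Interleaving; []; consˡ; consʳ)
open import Data.List.Relation.Unary.All as All using (All; []; _∷_)
import Data.List.Relation.Unary.All.Properties as Allₚ
open import Data.List.Relation.Unary.AllPairs using ([]; _∷_)
open import Data.List.Relation.Unary.Any using (here; there)
open import Data.List.Relation.Unary.Unique.Propositional using (Unique)
import Data.List.Relation.Unary.Unique.Propositional.Properties as Uniqueₚ
open import Data.Nat as ℕ using (ℕ; zero; suc; z≤n; s≤s)
open import Data.Nat.ListAction using (sum)
import Data.Nat.Properties as ℕₚ
open import Data.Product using (Σ; _×_; _,_; proj₁; proj₂; ∃-syntax)
open import Data.Rational using (ℚ; 0ℚ; 1ℚ; mkℚ; _+_; _*_; _-_; -_; _/_; 1/_; _≤_; _<_; ∣_∣; toℚᵘ; nonNegative; positive)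
open import Data.Rational.Properties
open import Data.Rational.Solver
import Data.Rational.Unnormalised as ℚᵘ
import Data.Rational.Unnormalised.Properties as ℚᵘₚ
open import Data.Sum using (_⊎_; inj₁; inj₂)
open import Function using (_∘_)
open import Relation.Binary.PropositionalEquality hiding ([_])
open import Relation.Nullary using (yes; no)

open +-*-Solver

-- Finite sums and power series

-- Both sides are evaluated exactly at every truncation N, in rational arithmetic; all loss sits in
-- the coefficients of degree N + 1. This is why A is a truncated sum: the tails in `U N f` are then
-- cut at N, exactly as in ζ_N. The decay 1/n² of f comes from the label 0 of b_{s,1}: the last
-- block continues the chain of the a's by letters e₀ only, that is, by l_s ≥ 1 divisions by n, and
-- the same divisions identify n_s with m_r. Removing a chain replaces f by tail sums, which are
-- only O(1/n), and then divides by n^l, which restores the decay at the price of a factor 2; so the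
-- recursion can go on. The other obstacle is at t = 0. A word beginning with e₀ is a divergent
-- integral, and its formal series has no meaning. No linear extension yields such a word, because
-- every element labelled 0 has something below it; but the sums are split over all orderings of the
-- elements, so these words occur in between and have to be carried along with indicator 0.

Seq : Set
Seq = ℕ → ℚ

∑ : ℕ → Seq → ℚ
∑ zero    f = 0ℚ
∑ (suc n) f = ∑ n f + f n

∑-cong : ∀ {f g : Seq} n → (∀ i → i ℕ.< n → f i ≡ g i) → ∑ n f ≡ ∑ n g
∑-cong zero    e = refl
∑-cong (suc n) e = cong₂ _+_ (∑-cong n λ i i<n → e i (ℕₚ.m<n⇒m<1+n i<n)) (e n (ℕₚ.n<1+n n))

∑-cong′ : ∀ {f g : Seq} n → (∀ i → f i ≡ g i) → ∑ n f ≡ ∑ n g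
∑-cong′ n e = ∑-cong n λ i _ → e i

∑-+ : ∀ f g n → ∑ n (λ i → f i + g i) ≡ ∑ n f + ∑ n g
∑-+ f g zero    = refl
∑-+ f g (suc n) = trans (cong (_+ (f n + g n)) (∑-+ f g n))
  (solve 4 (λ a b c d → (a :+ b) :+ (c :+ d) := (a :+ c) :+ (b :+ d)) refl (∑ n f) (∑ n g) (f n) (g n))

∑-* : ∀ c f n → ∑ n (λ i → c * f i) ≡ c * ∑ n f
∑-* c f zero    = sym (*-zeroʳ c)
∑-* c f (suc n) = trans (cong (_+ (c * f n)) (∑-* c f n)) (sym (*-distribˡ-+ c (∑ n f) (f n)))

∑-lin : ∀ c f g n → ∑ n (λ i → c * f i - g i) ≡ c * ∑ n f - ∑ n g
∑-lin c f g zero    = solve 1 (λ c → con 0ℚ := c :* con 0ℚ :- con 0ℚ) refl c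
∑-lin c f g (suc n) = trans (cong (_+ (c * f n - g n)) (∑-lin c f g n))
  (solve 5 (λ c a b d e → (c :* a :- b) :+ (c :* d :- e) := c :* (a :+ d) :- (b :+ e)) refl c (∑ n f) (∑ n g) (f n) (g n))

∑-head : ∀ f n → ∑ (suc n) f ≡ f 0 + ∑ n (λ i → f (suc i))
∑-head f zero    = +-comm 0ℚ (f 0)
∑-head f (suc n) = trans (cong (_+ f (suc n)) (∑-head f n)) (+-assoc (f 0) _ (f (suc n)))

ι : ℕ → ℚ
ι zero    = 0ℚ
ι (suc n) = 1ℚ + ι n

recip : ℕ → ℚ
recip zero    = 0ℚ
recip (suc n) = ℤ.+ 1 / suc n

δ : Seq
δ zero    = 1ℚ
δ (suc _) = 0ℚ

-- Termwise division by n is f ↦ ∫ f dt/t, and σ is multiplication by t/(1-t),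
-- so that O true f = ∫ f dt/(1-t).
D : Seq → Seq
D f n = recip n * f n

σ : Seq → Seq
σ f n = ∑ n f

τ : Bool → Seq → Seq
τ true  f = σ f
τ false f = f

O : Bool → Seq → Seq
O d f = D (τ d f)

run : Word → Seq → Seq
run []      f = f
run (d ∷ w) f = run w (O d f)

Li : Word → Seq
Li w = run w δ

infixl 7 _⊗_
-- The Cauchy product, by recursion on the degree with the first factor shifted, so that no
-- truncated subtraction n - i appears.
_⊗_ : Seq → Seq → Seq
(f ⊗ g) zero    = f 0 * g 0
(f ⊗ g) (suc n) = f 0 * g (suc n) + ((λ i → f (suc i)) ⊗ g) n

⊗-cong : ∀ {f f′ g g′ : Seq} n → (∀ i → i ℕ.≤ n → f i ≡ f′ i) → (∀ i → i ℕ.≤ n → g i ≡ g′ i) → (f ⊗ g) n ≡ (f′ ⊗ g′) n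
⊗-cong zero    e e′ = cong₂ _*_ (e 0 z≤n) (e′ 0 z≤n)
⊗-cong (suc n) e e′ = cong₂ _+_ (cong₂ _*_ (e 0 z≤n) (e′ (suc n) ℕₚ.≤-refl))
  (⊗-cong n (λ i p → e (suc i) (s≤s p)) (λ i p → e′ i (ℕₚ.m≤n⇒m≤1+n p)))

⊗-tail : ∀ f g n → (f ⊗ g) (suc n) ≡ f (suc n) * g 0 + (f ⊗ (λ i → g (suc i))) n
⊗-tail f g zero    = +-comm (f 0 * g 1) (f 1 * g 0)
⊗-tail f g (suc n) = trans (cong (λ z → f 0 * g (suc (suc n)) + z) (⊗-tail (λ i → f (suc i)) g n))
  (solve 3 (λ a b c → a :+ (b :+ c) := b :+ (a :+ c)) refl (f 0 * g (suc (suc n))) (f (suc (suc n)) * g 0) _)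

⊗-comm : ∀ f g n → (f ⊗ g) n ≡ (g ⊗ f) n
⊗-comm f g zero    = *-comm (f 0) (g 0)
⊗-comm f g (suc n) = trans (⊗-tail f g n)
  (cong₂ _+_ (*-comm (f (suc n)) (g 0)) (⊗-comm f (λ i → g (suc i)) n))

⊗-linˡ : ∀ c f f′ g n → ((λ i → c * f i - f′ i) ⊗ g) n ≡ c * (f ⊗ g) n - (f′ ⊗ g) n
⊗-linˡ c f f′ g zero    = solve 4 (λ c a b d → (c :* a :- b) :* d := c :* (a :* d) :- b :* d) refl c (f 0) (f′ 0) (g 0)
⊗-linˡ c f f′ g (suc n) = trans (cong (λ z → (c * f 0 - f′ 0) * g (suc n) + z) (⊗-linˡ c _ _ g n))
  (solve 6 (λ c a b d x y → (c :* a :- b) :* d :+ (c :* x :- y) := c :* (a :* d :+ x) :- (b :* d :+ y)) refl c (f 0) (f′ 0) (g (suc n)) _ _)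

⊗-+ˡ : ∀ f f′ g n → ((λ i → f i + f′ i) ⊗ g) n ≡ (f ⊗ g) n + (f′ ⊗ g) n
⊗-+ˡ f f′ g zero    = *-distribʳ-+ (g 0) (f 0) (f′ 0)
⊗-+ˡ f f′ g (suc n) = trans (cong (λ z → (f 0 + f′ 0) * g (suc n) + z) (⊗-+ˡ _ _ g n))
  (solve 5 (λ a b d x y → (a :+ b) :* d :+ (x :+ y) := (a :* d :+ x) :+ (b :* d :+ y)) refl (f 0) (f′ 0) (g (suc n)) _ _)

⊗-zeroˡ : ∀ g n → ((λ _ → 0ℚ) ⊗ g) n ≡ 0ℚ
⊗-zeroˡ g zero    = *-zeroˡ (g 0)
⊗-zeroˡ g (suc n) = trans (cong₂ _+_ (*-zeroˡ (g (suc n))) (⊗-zeroˡ g n)) refl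

⊗-*ˡ : ∀ c f g n → ((λ i → c * f i) ⊗ g) n ≡ c * (f ⊗ g) n
⊗-*ˡ c f g zero    = *-assoc c (f 0) (g 0)
⊗-*ˡ c f g (suc n) = trans (cong₂ _+_ (*-assoc c (f 0) (g (suc n))) (⊗-*ˡ c _ g n)) (sym (*-distribˡ-+ c _ _))

δ-⊗ : ∀ g n → (δ ⊗ g) n ≡ g n
δ-⊗ g zero    = *-identityˡ (g 0)
δ-⊗ g (suc n) = trans (cong₂ _+_ (*-identityˡ (g (suc n))) (⊗-zeroˡ g n)) (+-identityʳ (g (suc n)))

-- Associativity with the factor t/(1 - t).
⊗-σʳ : ∀ f g n → (f ⊗ σ g) n ≡ σ (f ⊗ g) n
⊗-σʳ f g zero    = *-zeroʳ (f 0)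
⊗-σʳ f g (suc n) = begin
  f 0 * ∑ (suc n) g + (f′ ⊗ σ g) n                          ≡⟨ cong₂ (λ x y → f 0 * x + y) (∑-head g n) (⊗-σʳ f′ g n) ⟩
  f 0 * (g 0 + ∑ n g′) + ∑ n (f′ ⊗ g)                       ≡⟨ solve 4 (λ a b c d → a :* (b :+ c) :+ d := a :* b :+ (a :* c :+ d)) refl (f 0) (g 0) (∑ n g′) _ ⟩
  f 0 * g 0 + (f 0 * ∑ n g′ + ∑ n (f′ ⊗ g))                 ≡⟨ cong (λ x → f 0 * g 0 + (x + ∑ n (f′ ⊗ g))) (sym (∑-* (f 0) g′ n)) ⟩
  f 0 * g 0 + (∑ n (λ i → f 0 * g′ i) + ∑ n (f′ ⊗ g))       ≡⟨ cong (λ z → f 0 * g 0 + z) (sym (∑-+ (λ i → f 0 * g′ i) (f′ ⊗ g) n)) ⟩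
  f 0 * g 0 + ∑ n (λ i → (f ⊗ g) (suc i))                   ≡⟨ sym (∑-head (f ⊗ g) n) ⟩
  ∑ (suc n) (f ⊗ g)                                         ∎
  where
  open ≡-Reasoning
  f′ g′ : Seq
  f′ i = f (suc i)
  g′ i = g (suc i)

⊗-σˡ : ∀ f g n → (σ f ⊗ g) n ≡ σ (f ⊗ g) n
⊗-σˡ f g n = begin
  (σ f ⊗ g) n  ≡⟨ ⊗-comm (σ f) g n ⟩
  (g ⊗ σ f) n  ≡⟨ ⊗-σʳ g f n ⟩
  σ (g ⊗ f) n  ≡⟨ ∑-cong′ n (⊗-comm g f) ⟩
  σ (f ⊗ g) n  ∎
  where open ≡-Reasoning

-- The derivation t d/dt and integration by parts

θ : Seq → Seq
θ f n = ι n * f n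

-- The Leibniz rule. In the induction the shift of the first factor turns `ι (suc i)` into
-- `1ℚ + ι i`; the extra copy of `f′ ⊗ g` is what raises the factor `ι n` to `1ℚ + ι n`.
⊗-θ : ∀ f g n → (θ f ⊗ g) n + (f ⊗ θ g) n ≡ θ (f ⊗ g) n
⊗-θ f g zero    = solve 2 (λ a b → con 0ℚ :* a :* b :+ a :* (con 0ℚ :* b) := con 0ℚ :* (a :* b)) refl (f 0) (g 0)
⊗-θ f g (suc n) = begin
  (0ℚ * f 0 * g (suc n) + ((λ i → ι (suc i) * f′ i) ⊗ g) n) + (f 0 * ((1ℚ + ι n) * g (suc n)) + (f′ ⊗ θ g) n)
    ≡⟨ cong (λ x → (0ℚ * f 0 * g (suc n) + x) + (f 0 * ((1ℚ + ι n) * g (suc n)) + (f′ ⊗ θ g) n))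
         (trans (⊗-cong {g = g} n (λ i _ → trans (*-distribʳ-+ (f′ i) 1ℚ (ι i)) (cong (_+ ι i * f′ i) (*-identityˡ (f′ i)))) (λ _ _ → refl))
                (⊗-+ˡ f′ (θ f′) g n)) ⟩
  (0ℚ * f 0 * g (suc n) + ((f′ ⊗ g) n + (θ f′ ⊗ g) n)) + (f 0 * ((1ℚ + ι n) * g (suc n)) + (f′ ⊗ θ g) n)
    ≡⟨ solve 6 (λ a b c x y z → (con 0ℚ :* a :* b :+ (x :+ y)) :+ (a :* (c :* b) :+ z) := c :* (a :* b) :+ x :+ (y :+ z)) refl
         (f 0) (g (suc n)) (1ℚ + ι n) _ _ _ ⟩
  (1ℚ + ι n) * (f 0 * g (suc n)) + (f′ ⊗ g) n + ((θ f′ ⊗ g) n + (f′ ⊗ θ g) n)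
    ≡⟨ cong (λ z → (1ℚ + ι n) * (f 0 * g (suc n)) + (f′ ⊗ g) n + z) (⊗-θ f′ g n) ⟩
  (1ℚ + ι n) * (f 0 * g (suc n)) + (f′ ⊗ g) n + ι n * (f′ ⊗ g) n
    ≡⟨ solve 3 (λ c a x → (con 1ℚ :+ c) :* a :+ x :+ c :* x := (con 1ℚ :+ c) :* (a :+ x)) refl (ι n) (f 0 * g (suc n)) _ ⟩
  (1ℚ + ι n) * (f ⊗ g) (suc n) ∎
  where
  open ≡-Reasoning
  f′ : Seq
  f′ i = f (suc i)

ι≃ : ∀ n → toℚᵘ (ι n) ℚᵘ.≃ ℚᵘ.mkℚᵘ (ℤ.+ n) 0
ι≃ zero    = ℚᵘ.*≡* refl
ι≃ (suc n) = ℚᵘₚ.≃-trans (toℚᵘ-homo-+ 1ℚ (ι n)) (ℚᵘₚ.≃-trans (ℚᵘₚ.+-congʳ (toℚᵘ 1ℚ) (ι≃ n))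
  (ℚᵘ.*≡* (ℤ-lem (ℤ.+ n))))
  where
  ℤ-lem : ∀ m → (ℤ.+ 1 ℤ.* ℤ.+ 1 ℤ.+ m ℤ.* ℤ.+ 1) ℤ.* ℤ.+ 1 ≡ (ℤ.+ 1 ℤ.+ m) ℤ.* (ℤ.+ 1 ℤ.* ℤ.+ 1)
  ℤ-lem = ℤ-Solver.solve-∀

ι*recip : ∀ n → ι (suc n) * recip (suc n) ≡ 1ℚ
ι*recip n = toℚᵘ-injective (ℚᵘₚ.≃-trans (toℚᵘ-homo-* (ι (suc n)) (recip (suc n)))
  (ℚᵘₚ.≃-trans (ℚᵘₚ.*-cong (ι≃ (suc n)) (toℚᵘ-fromℚᵘ (ℚᵘ.mkℚᵘ (ℤ.+ 1) n)))
    (ℚᵘ.*≡* (ℤ-lem (ℤ.+ suc n)))))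
  where
  ℤ-lem : ∀ m → (m ℤ.* ℤ.+ 1) ℤ.* ℤ.+ 1 ≡ ℤ.+ 1 ℤ.* (ℤ.+ 1 ℤ.* m)
  ℤ-lem = ℤ-Solver.solve-∀

D-zero : ∀ f → D f 0 ≡ 0ℚ
D-zero f = *-zeroˡ (f 0)

θD : ∀ f n → θ (D f) (suc n) ≡ f (suc n)
θD f n = trans (sym (*-assoc (ι (suc n)) (recip (suc n)) (f (suc n))))
  (trans (cong (_* f (suc n)) (ι*recip n)) (*-identityˡ (f (suc n))))

-- Differentiation undoes integration except in degree 0, where `D` erases the coefficient because
-- `recip 0` is `0ℚ`; hence the hypothesis.
θO : ∀ d f → τ d f 0 ≡ 0ℚ → ∀ n → θ (O d f) n ≡ τ d f n
θO d f z zero    = trans (*-zeroˡ (O d f 0)) (sym z)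
θO d f z (suc n) = θD (τ d f) n

⊗-τˡ : ∀ d f g n → (τ d f ⊗ g) n ≡ τ d (f ⊗ g) n
⊗-τˡ true  f g n = ⊗-σˡ f g n
⊗-τˡ false f g n = refl

⊗-τʳ : ∀ d f g n → (f ⊗ τ d g) n ≡ τ d (f ⊗ g) n
⊗-τʳ true  f g n = ⊗-σʳ f g n
⊗-τʳ false f g n = refl

-- Integration by parts: both sides have the same image under θ = t d/dt.
O-⊗-O : ∀ d e f g → τ d f 0 ≡ 0ℚ → τ e g 0 ≡ 0ℚ → ∀ n →
  (O d f ⊗ O e g) n ≡ O d (f ⊗ O e g) n + O e (O d f ⊗ g) n
O-⊗-O d e f g zf zg zero = begin
  O d f 0 * O e g 0                              ≡⟨ cong₂ _*_ (D-zero (τ d f)) (D-zero (τ e g)) ⟩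
  0ℚ * 0ℚ                                        ≡⟨⟩
  0ℚ + 0ℚ                                        ≡⟨ sym (cong₂ _+_ (D-zero (τ d (f ⊗ O e g))) (D-zero (τ e (O d f ⊗ g)))) ⟩
  O d (f ⊗ O e g) 0 + O e (O d f ⊗ g) 0          ∎
  where open ≡-Reasoning
O-⊗-O d e f g zf zg (suc n) = begin
  h                                                          ≡⟨ sym (*-identityˡ h) ⟩
  1ℚ * h                                                     ≡⟨ cong (_* h) (sym (trans (*-comm (recip (suc n)) (ι (suc n))) (ι*recip n))) ⟩
  recip (suc n) * ι (suc n) * h                              ≡⟨ *-assoc (recip (suc n)) (ι (suc n)) h ⟩
  recip (suc n) * θ (O d f ⊗ O e g) (suc n)                  ≡⟨ cong (recip (suc n) *_) (sym (⊗-θ (O d f) (O e g) (suc n))) ⟩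
  recip (suc n) * ((θ (O d f) ⊗ O e g) (suc n) + (O d f ⊗ θ (O e g)) (suc n))
    ≡⟨ cong (recip (suc n) *_) (cong₂ _+_
         (trans (⊗-cong {g = O e g} (suc n) (λ i _ → θO d f zf i) (λ _ _ → refl)) (⊗-τˡ d f (O e g) (suc n)))
         (trans (⊗-cong {f = O d f} (suc n) (λ _ _ → refl) (λ i _ → θO e g zg i)) (⊗-τʳ e (O d f) g (suc n)))) ⟩
  recip (suc n) * (τ d (f ⊗ O e g) (suc n) + τ e (O d f ⊗ g) (suc n)) ≡⟨ *-distribˡ-+ (recip (suc n)) _ _ ⟩
  O d (f ⊗ O e g) (suc n) + O e (O d f ⊗ g) (suc n)          ∎
  where
  open ≡-Reasoning
  h = (O d f ⊗ O e g) (suc n)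

-- Shuffles

-- The linear functional φ applied to the shuffle product of two words. Passing φ along instead of
-- listing the shuffles lets linear maps move in and out.
Sh : ∀ {A : Set} → (List A → ℚ) → List A → List A → ℚ
Sh φ []      q       = φ q
Sh φ (x ∷ p) []      = φ (x ∷ p)
Sh φ (x ∷ p) (y ∷ q) = Sh (φ ∘ (x ∷_)) p (y ∷ q) + Sh (φ ∘ (y ∷_)) (x ∷ p) q

module _ {A : Set} where

  Sh-[]ʳ : ∀ (φ : List A → ℚ) p → Sh φ p [] ≡ φ p
  Sh-[]ʳ φ []      = refl
  Sh-[]ʳ φ (x ∷ p) = refl

  Sh-+ : ∀ (φ ψ : List A → ℚ) p q → Sh (λ z → φ z + ψ z) p q ≡ Sh φ p q + Sh ψ p q
  Sh-+ φ ψ []      q       = refl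
  Sh-+ φ ψ (x ∷ p) []      = refl
  Sh-+ φ ψ (x ∷ p) (y ∷ q) = trans (cong₂ _+_ (Sh-+ _ _ p (y ∷ q)) (Sh-+ _ _ (x ∷ p) q))
    (solve 4 (λ a b c d → (a :+ b) :+ (c :+ d) := (a :+ c) :+ (b :+ d)) refl
      (Sh (φ ∘ (x ∷_)) p (y ∷ q)) (Sh (ψ ∘ (x ∷_)) p (y ∷ q)) (Sh (φ ∘ (y ∷_)) (x ∷ p) q) (Sh (ψ ∘ (y ∷_)) (x ∷ p) q))

  Sh-* : ∀ c (φ : List A → ℚ) p q → Sh (λ z → c * φ z) p q ≡ c * Sh φ p q
  Sh-* c φ []      q       = refl
  Sh-* c φ (x ∷ p) []      = refl
  Sh-* c φ (x ∷ p) (y ∷ q) = trans (cong₂ _+_ (Sh-* c _ p (y ∷ q)) (Sh-* c _ (x ∷ p) q)) (sym (*-distribˡ-+ c _ _))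

  Sh-0 : ∀ (p q : List A) → Sh (λ _ → 0ℚ) p q ≡ 0ℚ
  Sh-0 []      q       = refl
  Sh-0 (x ∷ p) []      = refl
  Sh-0 (x ∷ p) (y ∷ q) = cong₂ _+_ (Sh-0 p (y ∷ q)) (Sh-0 (x ∷ p) q)

  Sh-∑ : ∀ (F : List A → Seq) n p q → Sh (λ z → ∑ n (F z)) p q ≡ ∑ n (λ i → Sh (λ z → F z i) p q)
  Sh-∑ F zero    p q = Sh-0 p q
  Sh-∑ F (suc n) p q = trans (Sh-+ (λ z → ∑ n (F z)) (λ z → F z n) p q) (cong (_+ Sh (λ z → F z n) p q) (Sh-∑ F n p q))

  Sh-comm : ∀ (φ : List A → ℚ) p q → Sh φ p q ≡ Sh φ q p
  Sh-comm φ []      q       = sym (Sh-[]ʳ φ q)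
  Sh-comm φ (x ∷ p) []      = refl
  Sh-comm φ (x ∷ p) (y ∷ q) = trans (+-comm (Sh (φ ∘ (x ∷_)) p (y ∷ q)) (Sh (φ ∘ (y ∷_)) (x ∷ p) q))
    (cong₂ _+_ (Sh-comm _ (x ∷ p) q) (Sh-comm _ p (y ∷ q)))

  -- `Sh` recurses on first letters, whereas the last letter of a word is the outermost integration
  -- in `Li`; integration by parts needs this form.
  Sh-∷ʳ : ∀ (φ : List A → ℚ) p x q y →
    Sh φ (p ++ [ x ]) (q ++ [ y ]) ≡ Sh (φ ∘ (_++ [ x ])) p (q ++ [ y ]) + Sh (φ ∘ (_++ [ y ])) (p ++ [ x ]) q
  Sh-∷ʳ φ [] x [] y = +-comm (φ (x ∷ y ∷ [])) (φ (y ∷ x ∷ []))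
  Sh-∷ʳ φ [] x (v ∷ q) y = begin
    φ (x ∷ v ∷ q ++ [ y ]) + Sh φᵥ [ x ] (q ++ [ y ])                                                     ≡⟨ cong (φ (x ∷ v ∷ q ++ [ y ]) +_) (Sh-∷ʳ φᵥ [] x q y) ⟩
    φ (x ∷ v ∷ q ++ [ y ]) + (φ (v ∷ (q ++ [ y ]) ++ [ x ]) + Sh (φᵥ ∘ (_++ [ y ])) [ x ] q)     ≡⟨ solve 3 (λ a b c → a :+ (b :+ c) := b :+ (a :+ c)) refl
          (φ (x ∷ v ∷ q ++ [ y ])) (φ (v ∷ (q ++ [ y ]) ++ [ x ])) (Sh (φᵥ ∘ (_++ [ y ])) [ x ] q) ⟩
    φ (v ∷ (q ++ [ y ]) ++ [ x ]) + (φ (x ∷ v ∷ q ++ [ y ]) + Sh (φᵥ ∘ (_++ [ y ])) [ x ] q)     ∎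
    where
    open ≡-Reasoning
    φᵥ : List A → ℚ
    φᵥ = φ ∘ (v ∷_)
  Sh-∷ʳ φ (u ∷ p) x [] y = begin
    Sh φᵤ (p ++ [ x ]) [ y ] + φ (y ∷ u ∷ p ++ [ x ])   ≡⟨ cong (_+ φ (y ∷ u ∷ p ++ [ x ])) (Sh-∷ʳ φᵤ p x [] y) ⟩
    (Sh (φᵤ ∘ (_++ [ x ])) p [ y ] + Sh (φᵤ ∘ (_++ [ y ])) (p ++ [ x ]) []) + φ (y ∷ u ∷ p ++ [ x ])
      ≡⟨ solve 3 (λ a b c → (a :+ b) :+ c := (a :+ c) :+ b) refl
          (Sh (φᵤ ∘ (_++ [ x ])) p [ y ]) (Sh (φᵤ ∘ (_++ [ y ])) (p ++ [ x ]) []) (φ (y ∷ u ∷ p ++ [ x ])) ⟩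
    (Sh (φᵤ ∘ (_++ [ x ])) p [ y ] + φ (y ∷ u ∷ p ++ [ x ])) + Sh (φᵤ ∘ (_++ [ y ])) (p ++ [ x ]) []
      ≡⟨ cong (λ z → (Sh (φᵤ ∘ (_++ [ x ])) p [ y ] + φ (y ∷ u ∷ p ++ [ x ])) + z) (Sh-[]ʳ (φᵤ ∘ (_++ [ y ])) (p ++ [ x ])) ⟩
    (Sh (φᵤ ∘ (_++ [ x ])) p [ y ] + φ (y ∷ u ∷ p ++ [ x ])) + φ (u ∷ (p ++ [ x ]) ++ [ y ]) ∎
    where
    open ≡-Reasoning
    φᵤ : List A → ℚ
    φᵤ = φ ∘ (u ∷_)
  Sh-∷ʳ φ (u ∷ p) x (v ∷ q) y = trans
    (cong₂ _+_ (Sh-∷ʳ (φ ∘ (u ∷_)) p x (v ∷ q) y) (Sh-∷ʳ (φ ∘ (v ∷_)) (u ∷ p) x q y))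
    (solve 4 (λ a b c d → (a :+ b) :+ (c :+ d) := (a :+ c) :+ (b :+ d)) refl
      (Sh (φ ∘ (u ∷_) ∘ (_++ [ x ])) p (v ∷ q ++ [ y ])) (Sh (φ ∘ (u ∷_) ∘ (_++ [ y ])) (p ++ [ x ]) (v ∷ q))
      (Sh (φ ∘ (v ∷_) ∘ (_++ [ x ])) (u ∷ p) (q ++ [ y ])) (Sh (φ ∘ (v ∷_) ∘ (_++ [ y ])) (u ∷ p ++ [ x ]) q))

Sh-map : ∀ {A B : Set} (f : A → B) φ p q → Sh (φ ∘ map f) p q ≡ Sh φ (map f p) (map f q)
Sh-map f φ []      q       = refl
Sh-map f φ (x ∷ p) []      = refl
Sh-map f φ (x ∷ p) (y ∷ q) = cong₂ _+_ (Sh-map f (φ ∘ (f x ∷_)) p (y ∷ q)) (Sh-map f (φ ∘ (f y ∷_)) (x ∷ p) q)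

run-++ : ∀ v w f → run (v ++ w) f ≡ run w (run v f)
run-++ []      w f = refl
run-++ (d ∷ v) w f = run-++ v w (O d f)

O-cong : ∀ d {f g : Seq} → (∀ n → f n ≡ g n) → ∀ n → O d f n ≡ O d g n
O-cong true  e n = cong (recip n *_) (∑-cong′ n e)
O-cong false e n = cong (recip n *_) (e n)

Sh-O : ∀ {A : Set} d (F : List A → Seq) p q n → Sh (λ z → O d (F z) n) p q ≡ O d (λ i → Sh (λ z → F z i) p q) n
Sh-O true  F p q n = trans (Sh-* (recip n) (λ z → ∑ n (F z)) p q) (cong (recip n *_) (Sh-∑ F n p q))
Sh-O false F p q n = Sh-* (recip n) (λ z → F z n) p q

-- w is Proper when reverse w ∈ ℚ + e₁ℌ.  For the other words Li is a junk value,
-- because recip 0 = 0.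
data Proper : Word → Set where
  []   : Proper []
  one  : ∀ {w} → Proper w → Proper (true ∷ w)
  cons : ∀ {d w} → Proper (d ∷ w) → Proper (false ∷ d ∷ w)

Li-reverse : ∀ d w n → Li (reverse (d ∷ w)) n ≡ O d (Li (reverse w)) n
Li-reverse d w n = trans (cong (λ z → Li z n) (Lₚ.unfold-reverse d w)) (cong (λ f → f n) (run-++ (reverse w) [ d ] δ))

Li-zero : ∀ d w → Li (reverse (d ∷ w)) 0 ≡ 0ℚ
Li-zero d w = trans (Li-reverse d w 0) (D-zero (τ d (Li (reverse w))))

τ-zero : ∀ d w → Proper (d ∷ w) → τ d (Li (reverse w)) 0 ≡ 0ℚ
τ-zero true  w       _ = refl
τ-zero false (d ∷ w) _ = Li-zero d w

Proper-tail : ∀ {d w} → Proper (d ∷ w) → Proper w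
Proper-tail (one p)  = p
Proper-tail (cons p) = p

Sh-cong′ : ∀ {A : Set} {φ ψ : List A → ℚ} → (∀ z → φ z ≡ ψ z) → ∀ p q → Sh φ p q ≡ Sh ψ p q
Sh-cong′ e []      q       = e q
Sh-cong′ e (x ∷ p) []      = e (x ∷ p)
Sh-cong′ e (x ∷ p) (y ∷ q) = cong₂ _+_ (Sh-cong′ (e ∘ (x ∷_)) p (y ∷ q)) (Sh-cong′ (e ∘ (y ∷_)) (x ∷ p) q)

Li-∷ʳ : ∀ w d n → Li (w ++ [ d ]) n ≡ O d (Li w) n
Li-∷ʳ w d n = cong (λ f → f n) (run-++ w [ d ] δ)

-- Both sides obey the same recursion on last letters: the left by `Sh-∷ʳ`, the right by integration
-- by parts. The words are reversed to expose these letters, and properness supplies the vanishing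
-- constant terms.
Sh-Li : ∀ {v w} → Proper v → Proper w → ∀ n →
  Sh (λ z → Li z n) (reverse v) (reverse w) ≡ (Li (reverse v) ⊗ Li (reverse w)) n
Sh-Li {[]}    {w}     pv pw n = sym (δ-⊗ (Li (reverse w)) n)
Sh-Li {d ∷ v} {[]}    pv pw n = trans (Sh-[]ʳ (λ z → Li z n) (reverse (d ∷ v)))
  (sym (trans (⊗-comm (Li (reverse (d ∷ v))) δ n) (δ-⊗ (Li (reverse (d ∷ v))) n)))
Sh-Li {d ∷ v} {e ∷ w} pv pw n = begin
  Sh Φ (reverse (d ∷ v)) (reverse (e ∷ w))        ≡⟨ cong₂ (Sh Φ) (Lₚ.unfold-reverse d v) (Lₚ.unfold-reverse e w) ⟩
  Sh Φ (v′ ++ [ d ]) (w′ ++ [ e ])                ≡⟨ Sh-∷ʳ Φ v′ d w′ e ⟩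
  Sh (Φ ∘ (_++ [ d ])) v′ (w′ ++ [ e ]) + Sh (Φ ∘ (_++ [ e ])) (v′ ++ [ d ]) w′
    ≡⟨ cong₂ (λ s t → Sh (Φ ∘ (_++ [ d ])) v′ s + Sh (Φ ∘ (_++ [ e ])) t w′)
         (sym (Lₚ.unfold-reverse e w)) (sym (Lₚ.unfold-reverse d v)) ⟩
  Sh (Φ ∘ (_++ [ d ])) v′ (reverse (e ∷ w)) + Sh (Φ ∘ (_++ [ e ])) (reverse (d ∷ v)) w′
    ≡⟨ cong₂ _+_ (step d v′ (reverse (e ∷ w)) (Sh-Li (Proper-tail pv) pw))
                 (step e (reverse (d ∷ v)) w′ (Sh-Li pv (Proper-tail pw))) ⟩
  O d (Li v′ ⊗ Li (reverse (e ∷ w))) n + O e (Li (reverse (d ∷ v)) ⊗ Li w′) n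
    ≡⟨ cong₂ _+_ (O-cong d (λ i → ⊗-cong {f = Li v′} i (λ _ _ → refl) (λ j _ → Li-reverse e w j)) n)
                 (O-cong e (λ i → ⊗-cong {g = Li w′} i (λ j _ → Li-reverse d v j) (λ _ _ → refl)) n) ⟩
  O d (Li v′ ⊗ O e (Li w′)) n + O e (O d (Li v′) ⊗ Li w′) n
    ≡⟨ sym (O-⊗-O d e (Li v′) (Li w′) (τ-zero d v pv) (τ-zero e w pw) n) ⟩
  (O d (Li v′) ⊗ O e (Li w′)) n
    ≡⟨ sym (⊗-cong n (λ j _ → Li-reverse d v j) (λ j _ → Li-reverse e w j)) ⟩
  (Li (reverse (d ∷ v)) ⊗ Li (reverse (e ∷ w))) n ∎
  where
  open ≡-Reasoning
  Φ : Word → ℚ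
  Φ z = Li z n
  v′ w′ : Word
  v′ = reverse v
  w′ = reverse w
  step : ∀ d p q → (∀ i → Sh (λ z → Li z i) p q ≡ (Li p ⊗ Li q) i) →
    Sh (Φ ∘ (_++ [ d ])) p q ≡ O d (Li p ⊗ Li q) n
  step d p q ih = trans (Sh-cong′ (λ z → Li-∷ʳ z d n) p q) (trans (Sh-O d Li p q n) (O-cong d ih n))

-- Sums over permutations

sumL : ∀ {A : Set} → List A → (A → ℚ) → ℚ
sumL []       φ = 0ℚ
sumL (x ∷ xs) φ = φ x + sumL xs φ

module _ {A : Set} where

  sumL-++ : ∀ (xs ys : List A) φ → sumL (xs ++ ys) φ ≡ sumL xs φ + sumL ys φ
  sumL-++ []       ys φ = sym (+-identityˡ (sumL ys φ))
  sumL-++ (x ∷ xs) ys φ = trans (cong (φ x +_) (sumL-++ xs ys φ)) (sym (+-assoc (φ x) (sumL xs φ) (sumL ys φ)))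

  sumL-map : ∀ {B : Set} (f : B → A) xs φ → sumL (map f xs) φ ≡ sumL xs (φ ∘ f)
  sumL-map f []       φ = refl
  sumL-map f (x ∷ xs) φ = cong (φ (f x) +_) (sumL-map f xs φ)

  sumL-concatMap : ∀ {B : Set} (f : B → List A) xs φ → sumL (concatMap f xs) φ ≡ sumL xs (λ x → sumL (f x) φ)
  sumL-concatMap f []       φ = refl
  sumL-concatMap f (x ∷ xs) φ = trans (sumL-++ (f x) (concatMap f xs) φ) (cong (sumL (f x) φ +_) (sumL-concatMap f xs φ))

  sumL-cong : ∀ (xs : List A) {φ ψ : A → ℚ} → (∀ x → φ x ≡ ψ x) → sumL xs φ ≡ sumL xs ψ
  sumL-cong []       e = refl
  sumL-cong (x ∷ xs) e = cong₂ _+_ (e x) (sumL-cong xs e)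

  sumL-+ : ∀ (xs : List A) φ ψ → sumL xs (λ x → φ x + ψ x) ≡ sumL xs φ + sumL xs ψ
  sumL-+ []       φ ψ = refl
  sumL-+ (x ∷ xs) φ ψ = trans (cong (φ x + ψ x +_) (sumL-+ xs φ ψ))
    (solve 4 (λ a b c d → (a :+ b) :+ (c :+ d) := (a :+ c) :+ (b :+ d)) refl (φ x) (ψ x) (sumL xs φ) (sumL xs ψ))

  sumL-* : ∀ c (xs : List A) φ → sumL xs (λ x → c * φ x) ≡ c * sumL xs φ
  sumL-* c []       φ = sym (*-zeroʳ c)
  sumL-* c (x ∷ xs) φ = trans (cong (c * φ x +_) (sumL-* c xs φ)) (sym (*-distribˡ-+ c (φ x) (sumL xs φ)))

  sumL-- : ∀ (xs : List A) φ ψ → sumL xs (λ x → φ x - ψ x) ≡ sumL xs φ - sumL xs ψ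
  sumL-- []       φ ψ = refl
  sumL-- (x ∷ xs) φ ψ = trans (cong (φ x - ψ x +_) (sumL-- xs φ ψ))
    (solve 4 (λ a b c d → (a :- b) :+ (c :- d) := (a :+ c) :- (b :+ d)) refl (φ x) (ψ x) (sumL xs φ) (sumL xs ψ))

  sumL-0 : ∀ (xs : List A) → sumL xs (λ _ → 0ℚ) ≡ 0ℚ
  sumL-0 []       = refl
  sumL-0 (x ∷ xs) = cong (0ℚ +_) (sumL-0 xs)

module _ {A : Set} where

  sumL-swap : ∀ {B : Set} (xs : List A) (ys : List B) (φ : A → B → ℚ) →
    sumL xs (λ x → sumL ys (φ x)) ≡ sumL ys (λ y → sumL xs (λ x → φ x y))
  sumL-swap []       ys φ = sym (sumL-0 ys)
  sumL-swap (x ∷ xs) ys φ = trans (cong (sumL ys (φ x) +_) (sumL-swap xs ys φ)) (sym (sumL-+ ys (φ x) (λ y → sumL xs (λ x → φ x y))))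

module _ {A : Set} where

  ins : A → List A → (List A → ℚ) → ℚ
  ins x p φ = sumL (insertAll x p) φ

  permSum : (List A → ℚ) → List A → ℚ
  permSum φ E = sumL (perms E) φ

  ins-∷ : ∀ x y p φ → ins x (y ∷ p) φ ≡ φ (x ∷ y ∷ p) + ins x p (φ ∘ (y ∷_))
  ins-∷ x y p φ = cong (φ (x ∷ y ∷ p) +_) (sumL-map (y ∷_) (insertAll x p) φ)

  permSum-∷ : ∀ φ x E → permSum φ (x ∷ E) ≡ permSum (λ p → ins x p φ) E
  permSum-∷ φ x E = sumL-concatMap (insertAll x) (perms E) φ

  ins-cong : ∀ x p {φ ψ : List A → ℚ} → (∀ z → z ↭ x ∷ p → φ z ≡ ψ z) → ins x p φ ≡ ins x p ψ
  ins-cong x []      e = cong (_+ 0ℚ) (e (x ∷ []) ↭-refl)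
  ins-cong x (y ∷ p) {φ} {ψ} e = trans (ins-∷ x y p φ) (trans
    (cong₂ _+_ (e (x ∷ y ∷ p) ↭-refl) (ins-cong x p (λ z z↭ → e (y ∷ z) (↭-trans (↭-prep y z↭) (↭-swap y x ↭-refl)))))
    (sym (ins-∷ x y p ψ)))

  permSum-cong : ∀ E {φ ψ : List A → ℚ} → (∀ z → z ↭ E → φ z ≡ ψ z) → permSum φ E ≡ permSum ψ E
  permSum-cong []      e = cong (_+ 0ℚ) (e [] ↭-refl)
  permSum-cong (x ∷ E) {φ} {ψ} e = trans (permSum-∷ φ x E) (trans
    (permSum-cong E (λ p p↭ → ins-cong x p (λ z z↭ → e z (↭-trans z↭ (↭-prep x p↭)))))
    (sym (permSum-∷ ψ x E)))

  Sh-ins₁ : ∀ φ x q → Sh φ [ x ] q ≡ ins x q φ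
  Sh-ins₁ φ x []      = sym (+-identityʳ (φ [ x ]))
  Sh-ins₁ φ x (y ∷ q) = trans (cong (φ (x ∷ y ∷ q) +_) (Sh-ins₁ (φ ∘ (y ∷_)) x q)) (sym (ins-∷ x y q φ))

  -- Insertion of x is the shuffle with the one-letter word [ x ] (`Sh-ins₁`), so this is
  -- associativity of the shuffle product.
  Sh-ins : ∀ φ x p q → Sh (λ z → ins x z φ) p q ≡ ins x p (λ p′ → Sh φ p′ q)
  Sh-ins φ x []      q       = trans (sym (Sh-ins₁ φ x q)) (sym (+-identityʳ (Sh φ [ x ] q)))
  Sh-ins φ x (y ∷ p) []      = sumL-cong (insertAll x (y ∷ p)) (λ z → sym (Sh-[]ʳ φ z))
  Sh-ins φ x (y ∷ p) (w ∷ q) = begin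
    Sh (λ z → ins x (y ∷ z) φ) p (w ∷ q) + Sh (λ z → ins x (w ∷ z) φ) (y ∷ p) q
      ≡⟨ cong₂ _+_ (expand y p (w ∷ q)) (expand w (y ∷ p) q) ⟩
    (A₁ + ins x p (λ p′ → Sh (φ ∘ (y ∷_)) p′ (w ∷ q))) + (A₂ + ins x (y ∷ p) (λ p′ → Sh (φ ∘ (w ∷_)) p′ q))
      ≡⟨ cong (λ t → (A₁ + B₁) + (A₂ + t)) (ins-∷ x y p (λ p′ → Sh (φ ∘ (w ∷_)) p′ q)) ⟩
    (A₁ + B₁) + (A₂ + (C₁ + C₂))
      ≡⟨ solve 5 (λ a b c d e → (a :+ b) :+ (c :+ (d :+ e)) := (a :+ c :+ d) :+ (b :+ e)) refl A₁ B₁ A₂ C₁ C₂ ⟩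
    (A₁ + A₂ + C₁) + (B₁ + C₂)
      ≡⟨ cong (A₁ + A₂ + C₁ +_) (sym (sumL-+ (insertAll x p) (λ p′ → Sh (φ ∘ (y ∷_)) p′ (w ∷ q)) (λ p′ → Sh (φ ∘ (w ∷_)) (y ∷ p′) q))) ⟩
    Sh φ (x ∷ y ∷ p) (w ∷ q) + ins x p (λ p′ → Sh φ (y ∷ p′) (w ∷ q))
      ≡⟨ sym (ins-∷ x y p (λ p′ → Sh φ p′ (w ∷ q))) ⟩
    ins x (y ∷ p) (λ p′ → Sh φ p′ (w ∷ q)) ∎
    where
    open ≡-Reasoning
    A₁ = Sh (λ z → φ (x ∷ y ∷ z)) p (w ∷ q)
    A₂ = Sh (λ z → φ (x ∷ w ∷ z)) (y ∷ p) q
    B₁ = ins x p (λ p′ → Sh (φ ∘ (y ∷_)) p′ (w ∷ q))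
    C₁ = Sh (φ ∘ (w ∷_)) (x ∷ y ∷ p) q
    C₂ = ins x p (λ p′ → Sh (φ ∘ (w ∷_)) (y ∷ p′) q)
    expand : ∀ v p q → Sh (λ z → ins x (v ∷ z) φ) p q ≡ Sh (λ z → φ (x ∷ v ∷ z)) p q + ins x p (λ p′ → Sh (φ ∘ (v ∷_)) p′ q)
    expand v p q = trans (Sh-cong′ (λ z → ins-∷ x v z φ) p q) (trans
      (Sh-+ (λ z → φ (x ∷ v ∷ z)) (λ z → ins x z (φ ∘ (v ∷_))) p q)
      (cong (Sh (λ z → φ (x ∷ v ∷ z)) p q +_) (Sh-ins (φ ∘ (v ∷_)) x p q)))

  -- An ordering of a disjoint union is a pair of orderings together with a shuffle of them. This is
  -- how products of series arise from posets.
  permSum-++ : ∀ φ E F → permSum φ (E ++ F) ≡ permSum (λ p → permSum (λ q → Sh φ p q) F) E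
  permSum-++ φ []      F = sym (+-identityʳ (permSum φ F))
  permSum-++ φ (x ∷ E) F = begin
    permSum φ (x ∷ E ++ F)                                                          ≡⟨ permSum-∷ φ x (E ++ F) ⟩
    permSum (λ p → ins x p φ) (E ++ F)                                              ≡⟨ permSum-++ (λ p → ins x p φ) E F ⟩
    permSum (λ p → permSum (λ q → Sh (λ z → ins x z φ) p q) F) E
      ≡⟨ sumL-cong (perms E) (λ p → trans (sumL-cong (perms F) (Sh-ins φ x p)) (sumL-swap (perms F) (insertAll x p) (λ q p′ → Sh φ p′ q))) ⟩
    permSum (λ p → ins x p (λ p′ → permSum (λ q → Sh φ p′ q) F)) E                  ≡⟨ sym (permSum-∷ (λ p′ → permSum (λ q → Sh φ p′ q) F) x E) ⟩
    permSum (λ p → permSum (λ q → Sh φ p q) F) (x ∷ E)                              ∎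
    where open ≡-Reasoning

  permSum-↭ : ∀ {E F} → E ↭ F → ∀ φ → permSum φ E ≡ permSum φ F
  permSum-↭ _↭_.refl φ = refl
  permSum-↭ {x ∷ E} {x ∷ F} (prep x E↭F) φ = trans (permSum-∷ φ x E) (trans (permSum-↭ E↭F (λ p → ins x p φ)) (sym (permSum-∷ φ x F)))
  permSum-↭ {x ∷ y ∷ E} {y ∷ x ∷ F} (swap x y E↭F) φ = begin
    -- Once the two-element list is split off, exchanging x and y only exchanges two summands.
    permSum φ (x ∷ y ∷ E)                              ≡⟨ permSum-++ φ (x ∷ y ∷ []) E ⟩
    G E (x ∷ y ∷ []) + (G E (y ∷ x ∷ []) + 0ℚ)         ≡⟨ solve 2 (λ a b → a :+ (b :+ con 0ℚ) := b :+ (a :+ con 0ℚ)) refl (G E (x ∷ y ∷ [])) (G E (y ∷ x ∷ [])) ⟩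
    G E (y ∷ x ∷ []) + (G E (x ∷ y ∷ []) + 0ℚ)         ≡⟨ cong₂ (λ s t → s + (t + 0ℚ)) (permSum-↭ E↭F (Sh φ (y ∷ x ∷ []))) (permSum-↭ E↭F (Sh φ (x ∷ y ∷ []))) ⟩
    G F (y ∷ x ∷ []) + (G F (x ∷ y ∷ []) + 0ℚ)         ≡⟨ sym (permSum-++ φ (y ∷ x ∷ []) F) ⟩
    permSum φ (y ∷ x ∷ F)                              ∎
    where
    open ≡-Reasoning
    G : List A → List A → ℚ
    G E p = permSum (λ q → Sh φ p q) E
  permSum-↭ (_↭_.trans p q) φ = trans (permSum-↭ p φ) (permSum-↭ q φ)

  Sh-cong : ∀ {φ ψ : List A → ℚ} p q → (∀ z → Interleaving p q z → φ z ≡ ψ z) → Sh φ p q ≡ Sh ψ p q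
  Sh-cong []      q       e = e q (right q)
    where
    right : ∀ q → Interleaving [] q q
    right []      = []
    right (y ∷ q) = consʳ (right q)
  Sh-cong (x ∷ p) []      e = e (x ∷ p) (left (x ∷ p))
    where
    left : ∀ p → Interleaving p [] p
    left []      = []
    left (y ∷ p) = consˡ (left p)
  Sh-cong (x ∷ p) (y ∷ q) e = cong₂ _+_ (Sh-cong p (y ∷ q) (λ z i → e (x ∷ z) (consˡ i))) (Sh-cong (x ∷ p) q (λ z i → e (y ∷ z) (consʳ i)))

  ⊗-sumL : ∀ {f : Seq} (xs : List A) (G : A → Seq) n → sumL xs (λ x → (f ⊗ G x) n) ≡ (f ⊗ (λ j → sumL xs (λ x → G x j))) n
  ⊗-sumL {f} []       G n = sym (trans (⊗-comm f (λ _ → 0ℚ) n) (⊗-zeroˡ f n))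
  ⊗-sumL {f} (x ∷ xs) G n = begin
    (f ⊗ G x) n + sumL xs (λ x → (f ⊗ G x) n)          ≡⟨ cong₂ _+_ (⊗-comm f (G x) n) (trans (⊗-sumL {f} xs G n) (⊗-comm f _ n)) ⟩
    (G x ⊗ f) n + ((λ j → sumL xs (λ x → G x j)) ⊗ f) n ≡⟨ sym (⊗-+ˡ (G x) _ f n) ⟩
    ((λ j → G x j + sumL xs (λ x → G x j)) ⊗ f) n      ≡⟨ ⊗-comm _ f n ⟩
    (f ⊗ (λ j → G x j + sumL xs (λ x → G x j))) n      ∎
    where open ≡-Reasoning

-- Linear extensions of zigzag posets

Unique-++ˡ : ∀ {A : Set} (xs : List A) {ys} → Unique (xs ++ ys) → Unique xs
Unique-++ˡ []       _        = []
Unique-++ˡ (x ∷ xs) (p ∷ u) = Allₚ.++⁻ˡ xs p ∷ Unique-++ˡ xs u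

Unique-++ʳ : ∀ {A : Set} (xs : List A) {ys} → Unique (xs ++ ys) → Unique ys
Unique-++ʳ []       u       = u
Unique-++ʳ (x ∷ xs) (_ ∷ u) = Unique-++ʳ xs u

Unique-++-≢ : ∀ {A : Set} (xs : List A) {ys x y} → Unique (xs ++ ys) → x ∈ xs → y ∈ ys → x ≢ y
Unique-++-≢ (x ∷ xs) (p ∷ u) (here refl) y∈ = All.lookup p (∈-++⁺ʳ xs y∈)
Unique-++-≢ (x ∷ xs) (p ∷ u) (there x∈)  y∈ = Unique-++-≢ xs u x∈ y∈

ind : Bool → ℚ
ind b = if b then 1ℚ else 0ℚ

ind-∧ : ∀ b c → ind (b ∧ c) ≡ ind b * ind c
ind-∧ true  c = sym (*-identityˡ (ind c))
ind-∧ false c = sym (*-zeroˡ (ind c))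

Proper-∷ʳ : ∀ w → Proper (w ++ [ true ])
Proper-∷ʳ []              = one []
Proper-∷ʳ (true ∷ w)      = one (Proper-∷ʳ w)
Proper-∷ʳ (false ∷ [])    = cons (one [])
Proper-∷ʳ (false ∷ d ∷ w) = cons (Proper-∷ʳ (d ∷ w))

Sh-Li-true : ∀ v w n → Sh (λ z → Li z n) (true ∷ v) (true ∷ w) ≡ (Li (true ∷ v) ⊗ Li (true ∷ w)) n
Sh-Li-true v w n = subst₂ (λ s t → Sh (λ z → Li z n) s t ≡ (Li s ⊗ Li t) n)
  (Lₚ.reverse-involutive (true ∷ v)) (Lₚ.reverse-involutive (true ∷ w)) (Sh-Li (proper v) (proper w) n)
  where
  proper : ∀ v → Proper (reverse (true ∷ v))
  proper v = subst Proper (sym (Lₚ.unfold-reverse true v)) (Proper-∷ʳ (reverse v))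

-- The series of a zigzag of chains: a chain with series f, and then chains
-- with words w ∷ ws, the bottom of each lying below the top of the previous
-- one.  Dropping that relation for the first two gives a disjoint union;
-- reversing it merges the first two chains into one.
Z : Seq → List Word → Seq
Z f []       n = f n
Z f (w ∷ ws) n = (f ⊗ Z (Li w) ws) n - Z (run w f) ws n

module LinearExtensions {E : Set} (X : TwoPoset E)
  (eq-sound : ∀ x y → TwoPoset.eqᵇ X x y ≡ true → x ≡ y) (eq-refl : ∀ x → TwoPoset.eqᵇ X x x ≡ true) where

  open TwoPoset X

  ≢⇒eqᵇ : ∀ {x y} → x ≢ y → eqᵇ x y ≡ false
  ≢⇒eqᵇ {x} {y} x≢y with eqᵇ x y in eq
  ... | false = refl
  ... | true  = ⊥-elim (x≢y (eq-sound x y eq))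

  ok : List (E × E) → List E → Bool
  ok []            zs = true
  ok ((x , y) ∷ g) zs = before X x y zs ∧ ok g zs

  chain : E → List E → List (E × E)
  chain x []       = []
  chain x (y ∷ ys) = (x , y) ∷ chain y ys

  top : E → List E → E
  top x []       = x
  top x (y ∷ ys) = top y ys

  Block : Set
  Block = E × List E

  zigzag : E → List E → List Block → List (E × E)
  zigzag x xs []              = chain x xs
  zigzag x xs ((y , ys) ∷ Bs) = chain x xs ++ (y , top x xs) ∷ zigzag y ys Bs

  elements : E → List E → List Block → List E
  elements x xs []              = x ∷ xs
  elements x xs ((y , ys) ∷ Bs) = x ∷ xs ++ elements y ys Bs

  ok-++ : ∀ g h zs → ind (ok (g ++ h) zs) ≡ ind (ok g zs) * ind (ok h zs)
  ok-++ []            h zs = sym (*-identityˡ (ind (ok h zs)))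
  ok-++ ((x , y) ∷ g) h zs = begin
    ind (b ∧ ok (g ++ h) zs)                   ≡⟨ ind-∧ b (ok (g ++ h) zs) ⟩
    ind b * ind (ok (g ++ h) zs)               ≡⟨ cong (ind b *_) (ok-++ g h zs) ⟩
    ind b * (ind (ok g zs) * ind (ok h zs))    ≡⟨ sym (*-assoc (ind b) (ind (ok g zs)) (ind (ok h zs))) ⟩
    ind b * ind (ok g zs) * ind (ok h zs)      ≡⟨ cong (_* ind (ok h zs)) (sym (ind-∧ b (ok g zs))) ⟩
    ind (b ∧ ok g zs) * ind (ok h zs)          ∎
    where
    open ≡-Reasoning
    b = before X x y zs

  -- `before` is decided at the first occurrence of either element, so as soon as one of the two
  -- distinct elements occurs, exactly one of the two orders holds.
  before-flip : ∀ {x y} zs → x ≢ y → y ∈ zs → ind (before X y x zs) ≡ 1ℚ - ind (before X x y zs)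
  before-flip {x} {y} (z ∷ zs) x≢y (here refl) rewrite eq-refl z | ≢⇒eqᵇ (λ p → x≢y (sym p)) = refl
  before-flip {x} {y} (z ∷ zs) x≢y (there y∈)  with eqᵇ z x in ex | eqᵇ z y in ey
  ... | true  | true  = ⊥-elim (x≢y (trans (sym (eq-sound z x ex)) (eq-sound z y ey)))
  ... | true  | false = refl
  ... | false | true  = refl
  ... | false | false = before-flip zs x≢y y∈

  Avoids : List E → E × E → Set
  Avoids q (x , y) = ∀ w → w ∈ q → w ≢ x × w ≢ y

  before-Interleaving : ∀ {p q z} x y → Avoids q (x , y) → Interleaving p q z → before X x y z ≡ before X x y p
  before-Interleaving x y av [] = refl
  before-Interleaving {u ∷ p} x y av (consˡ i) with eqᵇ u y | eqᵇ u x
  ... | true  | _     = refl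
  ... | false | true  = refl
  ... | false | false = before-Interleaving x y av i
  before-Interleaving {p} {v ∷ q} x y av (consʳ i)
    rewrite ≢⇒eqᵇ (proj₂ (av v (here refl))) | ≢⇒eqᵇ (proj₁ (av v (here refl))) = before-Interleaving x y (λ w w∈ → av w (there w∈)) i

  -- A condition on one part of a disjoint union does not see how the other part is shuffled in, so
  -- its indicator leaves the sum over shuffles as a constant factor.
  ok-Interleaving : ∀ {p q z} g → All (Avoids q) g → Interleaving p q z → ok g z ≡ ok g p
  ok-Interleaving []            []         i = refl
  ok-Interleaving ((x , y) ∷ g) (av ∷ avs) i = cong₂ _∧_ (before-Interleaving x y av i) (ok-Interleaving g avs i)

  Within : List E → E × E → Set
  Within E (x , y) = x ∈ E × y ∈ E

  chain-within : ∀ x xs → All (Within (x ∷ xs)) (chain x xs)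
  chain-within x []       = []
  chain-within x (y ∷ ys) = (here refl , there (here refl)) ∷ All.map (λ (a , b) → there a , there b) (chain-within y ys)

  top∈ : ∀ x xs → top x xs ∈ x ∷ xs
  top∈ x []       = here refl
  top∈ x (y ∷ ys) = there (top∈ y ys)

  head∈ : ∀ x xs Bs → x ∈ elements x xs Bs
  head∈ x xs []      = here refl
  head∈ x xs (B ∷ Bs) = here refl

  zigzag-within : ∀ x xs Bs → All (Within (elements x xs Bs)) (zigzag x xs Bs)
  zigzag-within x xs []              = chain-within x xs
  zigzag-within x xs ((y , ys) ∷ Bs) = Allₚ.++⁺
    (All.map (λ (a , b) → ∈-++⁺ˡ a , ∈-++⁺ˡ b) (chain-within x xs))
    ((∈-++⁺ʳ (x ∷ xs) (head∈ y ys Bs) , ∈-++⁺ˡ (top∈ x xs))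
     ∷ All.map (λ (a , b) → ∈-++⁺ʳ (x ∷ xs) a , ∈-++⁺ʳ (x ∷ xs) b) (zigzag-within y ys Bs))

  Within⇒Avoids : ∀ {F q} g → All (Within F) g → (∀ {v w} → v ∈ F → w ∈ q → v ≢ w) → All (Avoids q) g
  Within⇒Avoids g wi d = All.map (λ (a , b) w w∈ → (λ e → d a w∈ (sym e)) , (λ e → d b w∈ (sym e))) wi

  -- A chain has a single linear extension. By induction the rest is already in the order y ∷ ys,
  -- and inserting x anywhere but in front leaves y first, against x < y.
  chain-sum : ∀ x xs → Unique (x ∷ xs) → ∀ φ → permSum (λ zs → ind (ok (chain x xs) zs) * φ zs) (x ∷ xs) ≡ φ (x ∷ xs)
  chain-sum x []       u φ = trans (+-identityʳ _) (*-identityˡ (φ (x ∷ [])))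
  chain-sum x (y ∷ ys) (x∉ ∷ u) φ = begin
    permSum ψ (x ∷ y ∷ ys)                                           ≡⟨ permSum-∷ ψ x (y ∷ ys) ⟩
    permSum (λ p → ins x p ψ) (y ∷ ys)                               ≡⟨ permSum-cong (y ∷ ys) pull ⟩
    permSum (λ p → ind (ok c p) * ins x p χ) (y ∷ ys)                ≡⟨ chain-sum y ys u (λ p → ins x p χ) ⟩
    ins x (y ∷ ys) χ                                                 ≡⟨ ins-∷ x y ys χ ⟩
    χ (x ∷ y ∷ ys) + ins x ys (χ ∘ (y ∷_))                           ≡⟨ cong₂ _+_ first (trans (sumL-cong (insertAll x ys) rest) (sumL-0 (insertAll x ys))) ⟩
    φ (x ∷ y ∷ ys) + 0ℚ                                              ≡⟨ +-identityʳ _ ⟩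
    φ (x ∷ y ∷ ys)                                                   ∎
    where
    open ≡-Reasoning
    c = chain y ys
    ψ χ : List E → ℚ
    ψ zs = ind (ok (chain x (y ∷ ys)) zs) * φ zs
    χ zs = ind (before X x y zs) * φ zs
    x≢y : x ≢ y
    x≢y = All.lookup x∉ (here refl)
    first : χ (x ∷ y ∷ ys) ≡ φ (x ∷ y ∷ ys)
    first rewrite ≢⇒eqᵇ x≢y | eq-refl x = *-identityˡ (φ (x ∷ y ∷ ys))
    rest : ∀ z → χ (y ∷ z) ≡ 0ℚ
    rest z rewrite eq-refl y = *-zeroˡ (φ (y ∷ z))
    pull : ∀ p → p ↭ y ∷ ys → ins x p ψ ≡ ind (ok c p) * ins x p χ
    pull p p↭ = begin
      ins x p ψ                              ≡⟨ sym (Sh-ins₁ ψ x p) ⟩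
      Sh ψ [ x ] p                           ≡⟨ Sh-comm ψ [ x ] p ⟩
      Sh ψ p [ x ]                           ≡⟨ Sh-cong p [ x ] (λ z i → trans
           (cong (_* φ z) (trans (ind-∧ (before X x y z) (ok c z)) (cong (λ b → ind (before X x y z) * ind b) (ok-Interleaving c av i))))
           (solve 3 (λ a b c → a :* b :* c := b :* (a :* c)) refl (ind (before X x y z)) (ind (ok c p)) (φ z))) ⟩
      Sh (λ z → ind (ok c p) * χ z) p [ x ]  ≡⟨ Sh-* (ind (ok c p)) χ p [ x ] ⟩
      ind (ok c p) * Sh χ p [ x ]            ≡⟨ cong (ind (ok c p) *_) (trans (Sh-comm χ p [ x ]) (Sh-ins₁ χ x p)) ⟩
      ind (ok c p) * ins x p χ               ∎
      where
      av : All (Avoids [ x ]) c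
      av = Within⇒Avoids c (chain-within y ys) (λ { v∈ (here refl) v≡x → All.lookup x∉ v∈ (sym v≡x) })

  chain-++ : ∀ x xs y ys → chain x (xs ++ y ∷ ys) ≡ chain x xs ++ (top x xs , y) ∷ chain y ys
  chain-++ x []       y ys = refl
  chain-++ x (z ∷ zs) y ys = cong ((x , z) ∷_) (chain-++ z zs y ys)

  top-++ : ∀ x xs y ys → top x (xs ++ y ∷ ys) ≡ top y ys
  top-++ x []       y ys = refl
  top-++ x (z ∷ zs) y ys = top-++ z zs y ys

  zigzag-++ : ∀ x xs y ys Bs → zigzag x (xs ++ y ∷ ys) Bs ≡ chain x xs ++ (top x xs , y) ∷ zigzag y ys Bs
  zigzag-++ x xs y ys []              = chain-++ x xs y ys
  zigzag-++ x xs y ys ((z , zs) ∷ Bs) = trans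
    (cong₂ (λ c t → c ++ (z , t) ∷ zigzag z zs Bs) (chain-++ x xs y ys) (top-++ x xs y ys))
    (Lₚ.++-assoc (chain x xs) ((top x xs , y) ∷ chain y ys) ((z , top y ys) ∷ zigzag z zs Bs))

  elements-++ : ∀ x xs y ys Bs → elements x (xs ++ y ∷ ys) Bs ≡ x ∷ xs ++ elements y ys Bs
  elements-++ x xs y ys []              = refl
  elements-++ x xs y ys ((z , zs) ∷ Bs) = Lₚ.++-assoc (x ∷ xs) (y ∷ ys) (elements z zs Bs)

  HeadOne : Block → Set
  HeadOne (y , ys) = label y ≡ true

  Covered : List (E × E) → E → Set
  Covered g z = label z ≡ true ⊎ ∃[ u ] (u , z) ∈ g

  chain-covered : ∀ x xs → All (λ z → ∃[ u ] (u , z) ∈ chain x xs) xs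
  chain-covered x []       = []
  chain-covered x (y ∷ ys) = (x , here refl) ∷ All.map (λ (u , p) → u , there p) (chain-covered y ys)

  zigzag-covered : ∀ x xs Bs → label x ≡ true → All HeadOne Bs → All (Covered (zigzag x xs Bs)) (elements x xs Bs)
  zigzag-covered x xs []              hx []         = inj₁ hx ∷ All.map inj₂ (chain-covered x xs)
  zigzag-covered x xs ((y , ys) ∷ Bs) hx (hy ∷ hBs) = Allₚ.++⁺
    {xs = x ∷ xs} (inj₁ hx ∷ All.map (λ (u , p) → inj₂ (u , ∈-++⁺ˡ p)) (chain-covered x xs))
    (All.map (λ { (inj₁ h) → inj₁ h ; (inj₂ (u , p)) → inj₂ (u , ∈-++⁺ʳ (chain x xs) (there p)) }) (zigzag-covered y ys Bs hy hBs))

  ok-false : ∀ {u z q} g → (u , z) ∈ g → ok g (z ∷ q) ≡ false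
  ok-false {u} {z} {q} _ (here refl) rewrite eq-refl z = refl
  ok-false {u} {z} {q} ((x , y) ∷ g) (there p) rewrite ok-false {q = q} g p = ∧-zeroʳ (before X x y (z ∷ q))

  -- An element labelled `false` is the upper member of some relation, which fails if that element
  -- comes first. So an ordering with non-zero indicator gives a word starting with e₁, where `Li`
  -- is multiplicative on shuffles.
  first-label : ∀ x xs Bs → label x ≡ true → All HeadOne Bs → ∀ z q → z ∷ q ↭ elements x xs Bs →
    label z ≡ true ⊎ ok (zigzag x xs Bs) (z ∷ q) ≡ false
  first-label x xs Bs hx hBs z q z↭ with All.lookup (zigzag-covered x xs Bs hx hBs) (∈-resp-↭ z↭ (here refl))
  ... | inj₁ h       = inj₁ h
  ... | inj₂ (u , p) = inj₂ (ok-false (zigzag x xs Bs) p)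

  labels : Block → Word
  labels (y , ys) = map label (y ∷ ys)

  zigzag-sum : ∀ x xs Bs → label x ≡ true → All HeadOne Bs → Unique (elements x xs Bs) → ∀ n →
    permSum (λ zs → ind (ok (zigzag x xs Bs) zs) * Li (map label zs) n) (elements x xs Bs)
      ≡ Z (Li (map label (x ∷ xs))) (map labels Bs) n
  zigzag-sum x xs []              hx []         u n = chain-sum x xs u (λ zs → Li (map label zs) n)
  zigzag-sum x xs ((y , ys) ∷ Bs) hx (hy ∷ hBs) u n = begin
    permSum (λ zs → ind (ok (c ++ (y , t) ∷ g) zs) * L zs n) (E₁ ++ E₂)           ≡⟨ permSum-cong (E₁ ++ E₂) separate ⟩
    permSum (λ zs → Φ zs - Ψ zs) (E₁ ++ E₂)                                       ≡⟨ sumL-- (perms (E₁ ++ E₂)) Φ Ψ ⟩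
    permSum Φ (E₁ ++ E₂) - permSum Ψ (E₁ ++ E₂)                                   ≡⟨ cong₂ _-_ product merged ⟩
    (L E₁ ⊗ Z (Li (labels (y , ys))) (map labels Bs)) n - Z (run (labels (y , ys)) (L E₁)) (map labels Bs) n ∎
    where
    open ≡-Reasoning
    E₁ E₂ : List E
    E₁ = x ∷ xs
    E₂ = elements y ys Bs
    c g : List (E × E)
    c = chain x xs
    g = zigzag y ys Bs
    t : E
    t = top x xs
    L : List E → Seq
    L zs = Li (map label zs)
    Φ Ψ : List E → ℚ
    Φ zs = ind (ok c zs) * (ind (ok g zs) * L zs n)
    Ψ zs = ind (ok (c ++ (t , y) ∷ g) zs) * L zs n
    disjoint : ∀ {v w} → v ∈ E₁ → w ∈ E₂ → v ≢ w
    disjoint = Unique-++-≢ E₁ u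
    ok-mid : ∀ a b zs → ind (ok (c ++ (a , b) ∷ g) zs) ≡ ind (ok c zs) * (ind (before X a b zs) * ind (ok g zs))
    ok-mid a b zs = trans (ok-++ c ((a , b) ∷ g) zs) (cong (ind (ok c zs) *_) (ind-∧ (before X a b zs) (ok g zs)))
    separate : ∀ zs → zs ↭ E₁ ++ E₂ → ind (ok (c ++ (y , t) ∷ g) zs) * L zs n ≡ Φ zs - Ψ zs
    separate zs zs↭ = begin
      ind (ok (c ++ (y , t) ∷ g) zs) * L zs n
        ≡⟨ cong (_* L zs n) (ok-mid y t zs) ⟩
      oc * (ind (before X y t zs) * og) * L zs n
        ≡⟨ cong (λ b → oc * (b * og) * L zs n) (before-flip zs (disjoint (top∈ x xs) (head∈ y ys Bs))
             (∈-resp-↭ (↭-sym zs↭) (∈-++⁺ʳ E₁ (head∈ y ys Bs)))) ⟩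
      oc * ((1ℚ - bt) * og) * L zs n
        ≡⟨ solve 4 (λ a b c d → a :* ((con 1ℚ :- b) :* c) :* d := a :* (c :* d) :- a :* (b :* c) :* d) refl oc bt og (L zs n) ⟩
      Φ zs - oc * (bt * og) * L zs n
        ≡⟨ cong (λ b → Φ zs - b * L zs n) (sym (ok-mid t y zs)) ⟩
      Φ zs - Ψ zs ∎
      where
      oc = ind (ok c zs)
      og = ind (ok g zs)
      bt = ind (before X t y zs)
    merged : permSum Ψ (E₁ ++ E₂) ≡ Z (run (labels (y , ys)) (L E₁)) (map labels Bs) n
    merged = begin
      permSum Ψ (E₁ ++ E₂)
        ≡⟨ cong₂ (λ h F → permSum (λ zs → ind (ok h zs) * L zs n) F) (sym (zigzag-++ x xs y ys Bs)) (sym (elements-++ x xs y ys Bs)) ⟩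
      permSum (λ zs → ind (ok (zigzag x (xs ++ y ∷ ys) Bs) zs) * L zs n) (elements x (xs ++ y ∷ ys) Bs)
        ≡⟨ zigzag-sum x (xs ++ y ∷ ys) Bs hx hBs (subst Unique (sym (elements-++ x xs y ys Bs)) u) n ⟩
      Z (L (E₁ ++ y ∷ ys)) (map labels Bs) n
        ≡⟨ cong (λ f → Z f (map labels Bs) n) (trans (cong Li (Lₚ.map-++ label E₁ (y ∷ ys))) (run-++ (map label E₁) (labels (y , ys)) δ)) ⟩
      Z (run (labels (y , ys)) (L E₁)) (map labels Bs) n ∎
    factor : ∀ p → p ↭ E₁ → ∀ q → q ↭ E₂ → Sh Φ p q ≡ ind (ok c p) * (ind (ok g q) * Sh (λ z → L z n) p q)
    factor p p↭ q q↭ = begin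
      Sh Φ p q
        ≡⟨ Sh-cong p q (λ z i → cong (λ b → ind b * (ind (ok g z) * L z n)) (ok-Interleaving c avc i)) ⟩
      Sh (λ z → ind (ok c p) * (ind (ok g z) * L z n)) p q
        ≡⟨ Sh-* (ind (ok c p)) (λ z → ind (ok g z) * L z n) p q ⟩
      ind (ok c p) * Sh (λ z → ind (ok g z) * L z n) p q
        ≡⟨ cong (ind (ok c p) *_) (begin
             Sh (λ z → ind (ok g z) * L z n) p q        ≡⟨ Sh-comm (λ z → ind (ok g z) * L z n) p q ⟩
             Sh (λ z → ind (ok g z) * L z n) q p        ≡⟨ Sh-cong q p (λ z i → cong (λ b → ind b * L z n) (ok-Interleaving g avg i)) ⟩
             Sh (λ z → ind (ok g q) * L z n) q p        ≡⟨ Sh-* (ind (ok g q)) (λ z → L z n) q p ⟩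
             ind (ok g q) * Sh (λ z → L z n) q p        ≡⟨ cong (ind (ok g q) *_) (Sh-comm (λ z → L z n) q p) ⟩
             ind (ok g q) * Sh (λ z → L z n) p q        ∎) ⟩
      ind (ok c p) * (ind (ok g q) * Sh (λ z → L z n) p q) ∎
      where
      avc : All (Avoids q) c
      avc = Within⇒Avoids c (chain-within x xs) (λ v∈ w∈ → disjoint v∈ (∈-resp-↭ q↭ w∈))
      avg : All (Avoids p) g
      avg = Within⇒Avoids g (zigzag-within y ys Bs) (λ v∈ w∈ e → disjoint (∈-resp-↭ p↭ w∈) v∈ (sym e))
    -- Shuffles become products only for orderings that satisfy `g`, so the indicator has to stay in
    -- front until this point.
    shuffle : ∀ q → q ↭ E₂ → ind (ok g q) * Sh (λ z → L z n) E₁ q ≡ (L E₁ ⊗ (λ j → ind (ok g q) * L q j)) n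
    shuffle q q↭ = trans (go q q↭) (sym (trans (⊗-comm (L E₁) _ n) (trans (⊗-*ˡ (ind (ok g q)) (L q) (L E₁) n)
                     (cong (ind (ok g q) *_) (⊗-comm (L q) (L E₁) n)))))
      where
      go : ∀ q → q ↭ E₂ → ind (ok g q) * Sh (λ z → L z n) E₁ q ≡ ind (ok g q) * (L E₁ ⊗ L q) n
      go []      q↭ = cong (ind (ok g []) *_) (sym (trans (⊗-comm (L E₁) δ n) (δ-⊗ (L E₁) n)))
      go (z ∷ q) q↭ with first-label y ys Bs hy hBs z q q↭
      -- The ordering starts with e₀: its indicator is 0 and both sides vanish.
      ... | inj₂ f rewrite f = trans (*-zeroˡ (Sh (λ z → L z n) E₁ (z ∷ q))) (sym (*-zeroˡ ((L E₁ ⊗ L (z ∷ q)) n)))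
      ... | inj₁ h = cong (ind (ok g (z ∷ q)) *_) (trans (Sh-map label (λ w → Li w n) E₁ (z ∷ q))
             (subst₂ (λ a b → Sh (λ w → Li w n) (a ∷ map label xs) (b ∷ map label q) ≡ (Li (a ∷ map label xs) ⊗ Li (b ∷ map label q)) n)
               (sym hx) (sym h) (Sh-Li-true (map label xs) (map label q) n)))
    product : permSum Φ (E₁ ++ E₂) ≡ (L E₁ ⊗ Z (Li (labels (y , ys))) (map labels Bs)) n
    product = begin
      permSum Φ (E₁ ++ E₂)
        ≡⟨ permSum-++ Φ E₁ E₂ ⟩
      permSum (λ p → permSum (λ q → Sh Φ p q) E₂) E₁
        ≡⟨ permSum-cong E₁ (λ p p↭ → trans (permSum-cong E₂ (factor p p↭))
             (sumL-* (ind (ok c p)) (perms E₂) (λ q → ind (ok g q) * Sh (λ z → L z n) p q))) ⟩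
      permSum (λ p → ind (ok c p) * permSum (λ q → ind (ok g q) * Sh (λ z → L z n) p q) E₂) E₁
        ≡⟨ chain-sum x xs (Unique-++ˡ E₁ u) (λ p → permSum (λ q → ind (ok g q) * Sh (λ z → L z n) p q) E₂) ⟩
      permSum (λ q → ind (ok g q) * Sh (λ z → L z n) E₁ q) E₂
        ≡⟨ permSum-cong E₂ shuffle ⟩
      permSum (λ q → (L E₁ ⊗ (λ j → ind (ok g q) * L q j)) n) E₂
        ≡⟨ ⊗-sumL {f = L E₁} (perms E₂) (λ q j → ind (ok g q) * L q j) n ⟩
      (L E₁ ⊗ (λ j → permSum (λ q → ind (ok g q) * L q j) E₂)) n
        ≡⟨ ⊗-cong {f = L E₁} n (λ _ _ → refl) (λ j _ → zigzag-sum y ys Bs hy hBs (Unique-++ʳ E₁ u) j) ⟩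
      (L E₁ ⊗ Z (Li (labels (y , ys))) (map labels Bs)) n ∎

-- Truncated sums

T⇒≡ : ∀ {b} → T b → b ≡ true
T⇒≡ {true} _ = refl

<ᵇ-true : ∀ {m n} → m ℕ.< n → (m ℕ.<ᵇ n) ≡ true
<ᵇ-true m<n = T⇒≡ (ℕₚ.<⇒<ᵇ m<n)

<ᵇ-false : ∀ {m n} → n ℕ.≤ m → (m ℕ.<ᵇ n) ≡ false
<ᵇ-false {m} {n} n≤m with m ℕ.<ᵇ n in e
... | false = refl
... | true  = ⊥-elim (ℕₚ.<-irrefl refl (ℕₚ.<-≤-trans (ℕₚ.<ᵇ⇒< m n (subst T (sym e) _)) n≤m))

sumRange-suc : ∀ {lo N} f → lo ℕ.≤ N → sumRange lo (suc N) f ≡ sumRange lo N f + f (suc N)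
sumRange-suc {lo} {N} f lo≤N rewrite <ᵇ-true (s≤s lo≤N) = refl

sumRange-0 : ∀ {lo} N f → N ℕ.≤ lo → sumRange lo N f ≡ 0ℚ
sumRange-0 zero    f p = refl
sumRange-0 (suc N) f p rewrite <ᵇ-false p = trans (+-identityʳ _) (sumRange-0 N f (ℕₚ.<⇒≤ p))

sumRange-cong : ∀ {lo} N {f g} → (∀ m → m ℕ.< N → f (suc m) ≡ g (suc m)) → sumRange lo N f ≡ sumRange lo N g
sumRange-cong zero    e = refl
sumRange-cong {lo} (suc N) e = cong₂ (λ x y → x + (if lo ℕ.<ᵇ suc N then y else 0ℚ))
  (sumRange-cong N (λ m p → e m (ℕₚ.m<n⇒m<1+n p))) (e N ℕₚ.≤-refl)

sumRange-+ : ∀ lo N f g → sumRange lo N (λ m → f m + g m) ≡ sumRange lo N f + sumRange lo N g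
sumRange-+ lo zero    f g = refl
sumRange-+ lo (suc N) f g with lo ℕ.<ᵇ suc N
... | true  = trans (cong (_+ (f (suc N) + g (suc N))) (sumRange-+ lo N f g))
  (solve 4 (λ a b c d → (a :+ b) :+ (c :+ d) := (a :+ c) :+ (b :+ d)) refl (sumRange lo N f) (sumRange lo N g) (f (suc N)) (g (suc N)))
... | false = trans (cong (_+ 0ℚ) (sumRange-+ lo N f g))
  (solve 2 (λ a b → (a :+ b) :+ con 0ℚ := (a :+ con 0ℚ) :+ (b :+ con 0ℚ)) refl (sumRange lo N f) (sumRange lo N g))

sumRange-* : ∀ c lo N f → sumRange lo N (λ m → c * f m) ≡ c * sumRange lo N f
sumRange-* c lo zero    f = sym (*-zeroʳ c)
sumRange-* c lo (suc N) f with lo ℕ.<ᵇ suc N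
... | true  = trans (cong (_+ c * f (suc N)) (sumRange-* c lo N f)) (sym (*-distribˡ-+ c (sumRange lo N f) (f (suc N))))
... | false = trans (cong (_+ 0ℚ) (sumRange-* c lo N f)) (solve 2 (λ c a → c :* a :+ con 0ℚ := c :* (a :+ con 0ℚ)) refl c (sumRange lo N f))

sumRange-sumL : ∀ {A : Set} lo N (xs : List A) (F : ℕ → A → ℚ) →
  sumL xs (λ x → sumRange lo N (λ m → F m x)) ≡ sumRange lo N (λ m → sumL xs (F m))
sumRange-sumL lo N []       F = sym (zeros N)
  where
  zeros : ∀ N → sumRange lo N (λ _ → 0ℚ) ≡ 0ℚ
  zeros N = trans (sumRange-* 0ℚ lo N (λ _ → 0ℚ)) (*-zeroˡ (sumRange lo N (λ _ → 0ℚ)))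
sumRange-sumL lo N (x ∷ xs) F = trans (cong (sumRange lo N (λ m → F m x) +_) (sumRange-sumL lo N xs F))
  (sym (sumRange-+ lo N (λ m → F m x) (λ m → sumL xs (F m))))

∑-sumRange : ∀ f → f 0 ≡ 0ℚ → ∀ N → ∑ (suc N) f ≡ sumRange 0 N f
∑-sumRange f f0 zero    = trans (+-identityˡ (f 0)) f0
∑-sumRange f f0 (suc N) = cong (_+ f (suc N)) (∑-sumRange f f0 N)

∑-split : ∀ f m N → m ℕ.≤ N → ∑ (suc N) f ≡ ∑ m f + f m + sumRange m N f
∑-split f zero    zero    z≤n = sym (+-identityʳ (0ℚ + f 0))
∑-split f m       (suc N) m≤ with m ℕₚ.≟ suc N
... | yes refl = sym (trans (cong (∑ (suc N) f + f (suc N) +_) (sumRange-0 (suc N) f ℕₚ.≤-refl)) (+-identityʳ _))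
... | no  m≢   = begin
  ∑ (suc N) f + f (suc N)                             ≡⟨ cong (_+ f (suc N)) (∑-split f m N m≤N) ⟩
  ∑ m f + f m + sumRange m N f + f (suc N)            ≡⟨ +-assoc (∑ m f + f m) (sumRange m N f) (f (suc N)) ⟩
  ∑ m f + f m + (sumRange m N f + f (suc N))          ≡⟨ cong (∑ m f + f m +_) (sym (sumRange-suc f m≤N)) ⟩
  ∑ m f + f m + sumRange m (suc N) f                  ∎
  where
  open ≡-Reasoning
  m≤N : m ℕ.≤ N
  m≤N = ℕₚ.≤-pred (ℕₚ.≤∧≢⇒< m≤ m≢)

-- Both sides run over lo < m < n ≤ N; `pred n` is the largest m allowed.
sumRange-swap : ∀ lo N (B : ℕ → ℕ → ℚ) →
  sumRange lo N (λ m → sumRange m N (B m)) ≡ sumRange lo N (λ n → sumRange lo (ℕ.pred n) (λ m → B m n))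
sumRange-swap lo zero    B = refl
sumRange-swap lo (suc N) B with lo ℕₚ.≤? N
... | no  lo≰N = trans (sumRange-0 (suc N) _ (ℕₚ.≰⇒> lo≰N)) (sym (sumRange-0 (suc N) _ (ℕₚ.≰⇒> lo≰N)))
... | yes lo≤N = begin
  sumRange lo (suc N) (λ m → sumRange m (suc N) (B m))
    ≡⟨ sumRange-suc _ lo≤N ⟩
  sumRange lo N (λ m → sumRange m (suc N) (B m)) + sumRange (suc N) (suc N) (B (suc N))
    ≡⟨ cong₂ _+_ (trans (sumRange-cong N (λ m m<N → sumRange-suc (B (suc m)) m<N)) (sumRange-+ lo N (λ m → sumRange m N (B m)) (λ m → B m (suc N))))
                 (sumRange-0 (suc N) (B (suc N)) ℕₚ.≤-refl) ⟩
  sumRange lo N (λ m → sumRange m N (B m)) + sumRange lo N (λ m → B m (suc N)) + 0ℚ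
    ≡⟨ +-identityʳ _ ⟩
  sumRange lo N (λ m → sumRange m N (B m)) + sumRange lo N (λ m → B m (suc N))
    ≡⟨ cong (_+ sumRange lo N (λ m → B m (suc N))) (sumRange-swap lo N B) ⟩
  sumRange lo N (λ n → sumRange lo (ℕ.pred n) (λ m → B m n)) + sumRange lo N (λ m → B m (suc N))
    ≡⟨ sym (sumRange-suc (λ n → sumRange lo (ℕ.pred n) (λ m → B m n)) lo≤N) ⟩
  sumRange lo (suc N) (λ n → sumRange lo (ℕ.pred n) (λ m → B m n)) ∎
  where open ≡-Reasoning

-- The square of pairs of summation variables splits into m < n, n < m and m = n, which are the
-- three terms of the harmonic product.
sumRange-product : ∀ lo N F G → sumRange lo N F * sumRange lo N G ≡
  sumRange lo N (λ m → F m * sumRange m N G) + (sumRange lo N (λ m → G m * sumRange m N F) + sumRange lo N (λ m → F m * G m))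
sumRange-product lo zero    F G = refl
sumRange-product lo (suc N) F G with lo ℕₚ.≤? N
... | no  lo≰N = trans (cong₂ _*_ (z F) (z G)) (sym (cong₂ _+_ (z _) (cong₂ _+_ (z _) (z _))))
  where
  z : ∀ f → sumRange lo (suc N) f ≡ 0ℚ
  z f = sumRange-0 (suc N) f (ℕₚ.≰⇒> lo≰N)
... | yes lo≤N = begin
  sumRange lo (suc N) F * sumRange lo (suc N) G
    ≡⟨ cong₂ _*_ (sumRange-suc F lo≤N) (sumRange-suc G lo≤N) ⟩
  (sF + F′) * (sG + G′)
    ≡⟨ solve 4 (λ a b c d → (a :+ b) :* (c :+ d) := a :* c :+ (d :* a :+ (b :* c :+ b :* d))) refl sF F′ sG G′ ⟩
  sF * sG + (G′ * sF + (F′ * sG + F′ * G′))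
    ≡⟨ cong (_+ (G′ * sF + (F′ * sG + F′ * G′))) (sumRange-product lo N F G) ⟩
  x + (y + z) + (G′ * sF + (F′ * sG + F′ * G′))
    ≡⟨ solve 6 (λ x y z p q r → x :+ (y :+ z) :+ (p :+ (q :+ r)) := (x :+ p) :+ ((y :+ q) :+ (z :+ r))) refl x y z (G′ * sF) (F′ * sG) (F′ * G′) ⟩
  (x + G′ * sF) + ((y + F′ * sG) + (z + F′ * G′))
    ≡⟨ sym (cong₂ _+_ (step F G) (cong₂ _+_ (step G F) (sumRange-suc (λ m → F m * G m) lo≤N))) ⟩
  sumRange lo (suc N) (λ m → F m * sumRange m (suc N) G) + (sumRange lo (suc N) (λ m → G m * sumRange m (suc N) F) + sumRange lo (suc N) (λ m → F m * G m)) ∎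
  where
  open ≡-Reasoning
  sF = sumRange lo N F
  sG = sumRange lo N G
  F′ = F (suc N)
  G′ = G (suc N)
  x = sumRange lo N (λ m → F m * sumRange m N G)
  y = sumRange lo N (λ m → G m * sumRange m N F)
  z = sumRange lo N (λ m → F m * G m)
  step : ∀ F G → sumRange lo (suc N) (λ m → F m * sumRange m (suc N) G) ≡ sumRange lo N (λ m → F m * sumRange m N G) + G (suc N) * sumRange lo N F
  step F G = begin
    sumRange lo (suc N) (λ m → F m * sumRange m (suc N) G)
      ≡⟨ sumRange-suc (λ m → F m * sumRange m (suc N) G) lo≤N ⟩
    sumRange lo N (λ m → F m * sumRange m (suc N) G) + F (suc N) * sumRange (suc N) (suc N) G
      ≡⟨ cong₂ _+_ (sumRange-cong N (λ m m<N → trans (cong (F (suc m) *_) (sumRange-suc G m<N))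
            (solve 3 (λ a b c → a :* (b :+ c) := a :* b :+ c :* a) refl (F (suc m)) (sumRange (suc m) N G) (G (suc N)))))
           (trans (cong (F (suc N) *_) (sumRange-0 (suc N) G ℕₚ.≤-refl)) (*-zeroʳ (F (suc N)))) ⟩
    sumRange lo N (λ m → F m * sumRange m N G + G (suc N) * F m) + 0ℚ
      ≡⟨ +-identityʳ _ ⟩
    sumRange lo N (λ m → F m * sumRange m N G + G (suc N) * F m)
      ≡⟨ sumRange-+ lo N (λ m → F m * sumRange m N G) (λ m → G (suc N) * F m) ⟩
    sumRange lo N (λ m → F m * sumRange m N G) + sumRange lo N (λ m → G (suc N) * F m)
      ≡⟨ cong (sumRange lo N (λ m → F m * sumRange m N G) +_) (sumRange-* (G (suc N)) lo N F) ⟩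
    sumRange lo N (λ m → F m * sumRange m N G) + G (suc N) * sumRange lo N F ∎

-- Both sides run over j < n ≤ N: the adjoint of `σ` sums over the indices above j.
∑-triangle : ∀ f g N → ∑ (suc N) (λ n → ∑ n f * g n) ≡ ∑ (suc N) (λ j → f j * sumRange j N g)
∑-triangle f g zero    = cong (0ℚ +_) (trans (*-zeroˡ (g 0)) (sym (*-zeroʳ (f 0))))
∑-triangle f g (suc N) = begin
  ∑ (suc N) (λ n → ∑ n f * g n) + ∑ (suc N) f * g (suc N)
    ≡⟨ cong₂ _+_ (∑-triangle f g N) (*-comm (∑ (suc N) f) (g (suc N))) ⟩
  ∑ (suc N) (λ j → f j * sumRange j N g) + g (suc N) * ∑ (suc N) f
    ≡⟨ cong (∑ (suc N) (λ j → f j * sumRange j N g) +_) (sym (∑-* (g (suc N)) f (suc N))) ⟩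
  ∑ (suc N) (λ j → f j * sumRange j N g) + ∑ (suc N) (λ j → g (suc N) * f j)
    ≡⟨ sym (∑-+ _ _ (suc N)) ⟩
  ∑ (suc N) (λ j → f j * sumRange j N g + g (suc N) * f j)
    ≡⟨ ∑-cong (suc N) (λ j j<N → sym (trans (cong (f j *_) (sumRange-suc g (ℕₚ.≤-pred j<N)))
         (solve 3 (λ a b c → a :* (b :+ c) := a :* b :+ c :* a) refl (f j) (sumRange j N g) (g (suc N))))) ⟩
  ∑ (suc N) (λ j → f j * sumRange j (suc N) g)
    ≡⟨ sym (trans (cong (∑ (suc N) (λ j → f j * sumRange j (suc N) g) +_)
         (trans (cong (f (suc N) *_) (sumRange-0 (suc N) g ℕₚ.≤-refl)) (*-zeroʳ (f (suc N))))) (+-identityʳ _)) ⟩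
  ∑ (suc (suc N)) (λ j → f j * sumRange j (suc N) g) ∎
  where open ≡-Reasoning

pw : ℕ → ℕ → ℚ
pw m k = powℚ (recip m) k

powℚ-+ : ∀ q m n → powℚ q (m ℕ.+ n) ≡ powℚ q m * powℚ q n
powℚ-+ q zero    n = sym (*-identityˡ (powℚ q n))
powℚ-+ q (suc m) n = trans (cong (q *_) (powℚ-+ q m n)) (sym (*-assoc q (powℚ q m) (powℚ q n)))

ζtrunc-∷ : ∀ lo N k ks → ζtrunc lo N (k ∷ ks) ≡ sumRange lo N (λ m → pw m k * ζtrunc m N ks)
ζtrunc-∷ lo N k ks = sumRange-cong N (λ m _ → refl)

-- Words and indices

indexFrom : ℕ → Word → Index
indexFrom c []          = c ∷ []
indexFrom c (true ∷ w)  = c ∷ indexFrom 1 w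
indexFrom c (false ∷ w) = indexFrom (suc c) w

-- The left-hand side of toIndexFrom is the auxiliary function of toIndex,
-- which is private to Defs and can only be referred to by unification.
toIndex-true : ∀ w → toIndex (true ∷ w) ≡ indexFrom 1 w
toIndexFrom : ∀ c w → _ ≡ indexFrom c w
toIndex-true w with 1
... | c = toIndexFrom c w
toIndexFrom c []          = refl
toIndexFrom c (true ∷ w)  = cong (c ∷_) (toIndexFrom 1 w)
toIndexFrom c (false ∷ w) = toIndexFrom (suc c) w

-- The adjoint of run w with respect to (f , g) ↦ ∑_{n ≤ N} f n g n, at g = 1.
dual : ℕ → Word → Seq
dual N []          n = 1ℚ
dual N (false ∷ w) n = recip n * dual N w n
dual N (true ∷ w)  j = sumRange j N (λ n → recip n * dual N w n)

∑-run : ∀ N w f → ∑ (suc N) (run w f) ≡ ∑ (suc N) (λ n → f n * dual N w n)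
∑-run N []          f = ∑-cong′ (suc N) (λ n → sym (*-identityʳ (f n)))
∑-run N (false ∷ w) f = trans (∑-run N w (D f)) (∑-cong′ (suc N) (λ n →
  solve 3 (λ a b c → a :* b :* c := b :* (a :* c)) refl (recip n) (f n) (dual N w n)))
∑-run N (true ∷ w)  f = trans (∑-run N w (D (σ f))) (trans (∑-cong′ (suc N) (λ n →
  solve 3 (λ a b c → a :* b :* c := b :* (a :* c)) refl (recip n) (σ f n) (dual N w n)))
  (∑-triangle f (λ n → recip n * dual N w n) N))

-- Reading `dual` from the left spells out the nested sum: a letter `false` raises the exponent of
-- the current variable, a letter `true` opens the next, larger one.
ζtrunc-indexFrom : ∀ lo N c w → ζtrunc lo N (indexFrom c w) ≡ sumRange lo N (λ m → pw m c * dual N w m)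
ζtrunc-indexFrom lo N c []          = ζtrunc-∷ lo N c []
ζtrunc-indexFrom lo N c (true ∷ w)  = trans (ζtrunc-∷ lo N c (indexFrom 1 w)) (sumRange-cong N (λ m _ →
  cong (pw (suc m) c *_) (trans (ζtrunc-indexFrom (suc m) N 1 w)
    (sumRange-cong N (λ n _ → cong (_* dual N w (suc n)) (*-identityʳ (recip (suc n))))))))
ζtrunc-indexFrom lo N c (false ∷ w) = trans (ζtrunc-indexFrom lo N (suc c) w) (sumRange-cong N (λ m _ →
  solve 3 (λ a b c → a :* b :* c := b :* (a :* c)) refl (recip (suc m)) (pw (suc m) c) (dual N w (suc m))))

∑-δ : ∀ n → ∑ (suc n) δ ≡ 1ℚ
∑-δ zero    = refl
∑-δ (suc n) = cong (_+ 0ℚ) (∑-δ n)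

Dσδ : ∀ n → D (σ δ) n ≡ recip n
Dσδ zero    = refl
Dσδ (suc n) = trans (cong (recip (suc n) *_) (∑-δ n)) (*-identityʳ (recip (suc n)))

ζN-toIndex : ∀ N w → ζN N (toIndex (true ∷ w)) ≡ ∑ (suc N) (Li (true ∷ w))
ζN-toIndex N w = begin
  ζN N (toIndex (true ∷ w))                            ≡⟨ cong (ζN N) (toIndex-true w) ⟩
  ζN N (indexFrom 1 w)                                 ≡⟨ ζtrunc-indexFrom 0 N 1 w ⟩
  sumRange 0 N (λ m → pw m 1 * dual N w m)             ≡⟨ sym (∑-sumRange (λ m → pw m 1 * dual N w m) (*-zeroˡ (dual N w 0)) N) ⟩
  ∑ (suc N) (λ m → pw m 1 * dual N w m)                ≡⟨ ∑-cong′ (suc N) (λ n → cong (_* dual N w n) (trans (*-identityʳ (recip n)) (sym (Dσδ n)))) ⟩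
  ∑ (suc N) (λ m → D (σ δ) m * dual N w m)             ≡⟨ sym (∑-run N w (D (σ δ))) ⟩
  ∑ (suc N) (Li (true ∷ w))                            ∎
  where open ≡-Reasoning

eWord : ℕ → Word
eWord k = true ∷ replicate (ℕ.pred k) false

indexWord : Index → Word
indexWord = concatMap eWord

indexFrom-word : ∀ c n ks → All (1 ℕ.≤_) ks → indexFrom c (replicate n false ++ indexWord ks) ≡ c ℕ.+ n ∷ ks
indexFrom-word c (suc n) ks       p = trans (indexFrom-word (suc c) n ks p) (cong (_∷ ks) (sym (ℕₚ.+-suc c n)))
indexFrom-word c zero    []       p = cong (_∷ []) (sym (ℕₚ.+-identityʳ c))
indexFrom-word c zero    (suc k ∷ ks) (_ ∷ p) = cong₂ _∷_ (sym (ℕₚ.+-identityʳ c)) (indexFrom-word 1 k ks p)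

ζN-index : ∀ N k ks → All (1 ℕ.≤_) (k ∷ ks) → ∑ (suc N) (Li (indexWord (k ∷ ks))) ≡ ζN N (k ∷ ks)
ζN-index N (suc k) ks (_ ∷ p) = trans (sym (ζN-toIndex N (replicate k false ++ indexWord ks)))
  (cong (ζN N) (trans (toIndex-true (replicate k false ++ indexWord ks)) (indexFrom-word 1 k ks p)))

-- The harmonic products

sumL-∷ : ∀ lo N c us → sumL us (λ u → ζtrunc lo N (c ∷ u)) ≡ sumRange lo N (λ m → pw m c * sumL us (ζtrunc m N))
sumL-∷ lo N c us = trans (sumL-cong us (ζtrunc-∷ lo N c)) (trans (sumRange-sumL lo N us (λ m u → pw m c * ζtrunc m N u))
  (sumRange-cong N (λ m _ → sumL-* (pw (suc m) c) us (ζtrunc (suc m) N))))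

-- Truncated sums multiply exactly, for every N. The lower bound is general because the induction
-- fixes the smallest variable and continues above it.
ζtrunc-⋆ : ∀ lo N v w → sumL (v ⋆ w) (ζtrunc lo N) ≡ ζtrunc lo N v * ζtrunc lo N w
ζtrunc-⋆ lo N []      w       = trans (+-identityʳ (ζtrunc lo N w)) (sym (*-identityˡ (ζtrunc lo N w)))
ζtrunc-⋆ lo N (k ∷ v) []      = trans (+-identityʳ (ζtrunc lo N (k ∷ v))) (sym (*-identityʳ (ζtrunc lo N (k ∷ v))))
ζtrunc-⋆ lo N (k ∷ v) (l ∷ w) = begin
  sumL (map (k ∷_) X₁ ++ map (l ∷_) X₂ ++ map (k ℕ.+ l ∷_) X₃) ζlo
    ≡⟨ trans (sumL-++ (map (k ∷_) X₁) _ ζlo) (cong (sumL (map (k ∷_) X₁) ζlo +_) (sumL-++ (map (l ∷_) X₂) (map (k ℕ.+ l ∷_) X₃) ζlo)) ⟩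
  sumL (map (k ∷_) X₁) ζlo + (sumL (map (l ∷_) X₂) ζlo + sumL (map (k ℕ.+ l ∷_) X₃) ζlo)
    ≡⟨ cong₂ _+_ (part k X₁) (cong₂ _+_ (part l X₂) (part (k ℕ.+ l) X₃)) ⟩
  sumRange lo N (λ m → pw m k * sumL X₁ (ζtrunc m N)) + (sumRange lo N (λ m → pw m l * sumL X₂ (ζtrunc m N)) + sumRange lo N (λ m → pw m (k ℕ.+ l) * sumL X₃ (ζtrunc m N)))
    ≡⟨ cong₂ _+_ (sumRange-cong N (λ m _ → e₁ (suc m) (ζtrunc-⋆ (suc m) N v (l ∷ w)))) (cong₂ _+_ (sumRange-cong N (λ m _ → e₂ (suc m) (ζtrunc-⋆ (suc m) N (k ∷ v) w))) (sumRange-cong N (λ m _ → e₃ (suc m) (ζtrunc-⋆ (suc m) N v w)))) ⟩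
  sumRange lo N (λ m → F m * sumRange m N G) + (sumRange lo N (λ m → G m * sumRange m N F) + sumRange lo N (λ m → F m * G m))
    ≡⟨ sym (sumRange-product lo N F G) ⟩
  sumRange lo N F * sumRange lo N G
    ≡⟨ sym (cong₂ _*_ (ζtrunc-∷ lo N k v) (ζtrunc-∷ lo N l w)) ⟩
  ζlo (k ∷ v) * ζlo (l ∷ w) ∎
  where
  open ≡-Reasoning
  ζlo : Index → ℚ
  ζlo = ζtrunc lo N
  X₁ X₂ X₃ : List Index
  X₁ = v ⋆ (l ∷ w)
  X₂ = (k ∷ v) ⋆ w
  X₃ = v ⋆ w
  F G : Seq
  F m = pw m k * ζtrunc m N v
  G m = pw m l * ζtrunc m N w
  part : ∀ c us → sumL (map (c ∷_) us) ζlo ≡ sumRange lo N (λ m → pw m c * sumL us (ζtrunc m N))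
  part c us = trans (sumL-map (c ∷_) us ζlo) (sumL-∷ lo N c us)
  e₁ : ∀ m → sumL X₁ (ζtrunc m N) ≡ ζtrunc m N v * ζtrunc m N (l ∷ w) → pw m k * sumL X₁ (ζtrunc m N) ≡ F m * sumRange m N G
  e₁ m ih = trans (cong (pw m k *_) (trans ih (cong (ζtrunc m N v *_) (ζtrunc-∷ m N l w))))
    (sym (*-assoc (pw m k) (ζtrunc m N v) (sumRange m N G)))
  e₂ : ∀ m → sumL X₂ (ζtrunc m N) ≡ ζtrunc m N (k ∷ v) * ζtrunc m N w → pw m l * sumL X₂ (ζtrunc m N) ≡ G m * sumRange m N F
  e₂ m ih = trans (cong (pw m l *_) (trans ih (cong (_* ζtrunc m N w) (ζtrunc-∷ m N k v))))
    (solve 3 (λ a b c → a :* (b :* c) := a :* c :* b) refl (pw m l) (sumRange m N F) (ζtrunc m N w))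
  e₃ : ∀ m → sumL X₃ (ζtrunc m N) ≡ ζtrunc m N v * ζtrunc m N w → pw m (k ℕ.+ l) * sumL X₃ (ζtrunc m N) ≡ F m * G m
  e₃ m ih = trans (cong₂ _*_ (powℚ-+ (recip m) k l) ih)
    (solve 4 (λ a b c d → a :* b :* (c :* d) := a :* c :* (b :* d)) refl (pw m k) (pw m l) (ζtrunc m N v) (ζtrunc m N w))

-- ζtrunc with the extra factor h(m_r) at the largest summation variable; the
-- lower bound lo plays that role for the empty index.
ζtruncᵂ : Seq → ℕ → ℕ → Index → ℚ
ζtruncᵂ h lo N []       = h lo
ζtruncᵂ h lo N (k ∷ ks) = sumRange lo N (λ m → pw m k * ζtruncᵂ h m N ks)

-- The recursion removes the smallest variable, while `⊛` acts on the largest. Exchanging the sums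
-- brings the largest one, m, to the front; the others then stay below it, whence `ℕ.pred m`.
ζtruncᵂ-∷ʳ : ∀ h lo N w c → ζtruncᵂ h lo N (w ++ [ c ]) ≡ sumRange lo N (λ m → pw m c * h m * ζtrunc lo (ℕ.pred m) w)
ζtruncᵂ-∷ʳ h lo N []      c = sumRange-cong N (λ m _ → sym (*-identityʳ (pw (suc m) c * h (suc m))))
ζtruncᵂ-∷ʳ h lo N (d ∷ w) c = begin
  sumRange lo N (λ m → pw m d * ζtruncᵂ h m N (w ++ [ c ]))
    ≡⟨ sumRange-cong N (λ m _ → trans (cong (pw (suc m) d *_) (ζtruncᵂ-∷ʳ h (suc m) N w c))
         (sym (sumRange-* (pw (suc m) d) (suc m) N (λ n → pw n c * h n * ζtrunc (suc m) (ℕ.pred n) w)))) ⟩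
  sumRange lo N (λ m → sumRange m N (λ n → pw m d * (pw n c * h n * ζtrunc m (ℕ.pred n) w)))
    ≡⟨ sumRange-swap lo N (λ m n → pw m d * (pw n c * h n * ζtrunc m (ℕ.pred n) w)) ⟩
  sumRange lo N (λ n → sumRange lo (ℕ.pred n) (λ m → pw m d * (pw n c * h n * ζtrunc m (ℕ.pred n) w)))
    ≡⟨ sumRange-cong N (λ n _ → begin
         sumRange lo n (λ m → pw m d * (pw (suc n) c * h (suc n) * ζtrunc m n w))
           ≡⟨ sumRange-cong n (λ m _ → solve 3 (λ a b c → a :* (b :* c) := b :* (a :* c)) refl (pw (suc m) d) (pw (suc n) c * h (suc n)) (ζtrunc (suc m) n w)) ⟩
         sumRange lo n (λ m → pw (suc n) c * h (suc n) * (pw m d * ζtrunc m n w))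
           ≡⟨ sumRange-* (pw (suc n) c * h (suc n)) lo n (λ m → pw m d * ζtrunc m n w) ⟩
         pw (suc n) c * h (suc n) * sumRange lo n (λ m → pw m d * ζtrunc m n w)
           ≡⟨ cong (pw (suc n) c * h (suc n) *_) (sym (ζtrunc-∷ lo n d w)) ⟩
         pw (suc n) c * h (suc n) * ζtrunc lo n (d ∷ w) ∎) ⟩
  sumRange lo N (λ n → pw n c * h n * ζtrunc lo (ℕ.pred n) (d ∷ w)) ∎
  where open ≡-Reasoning

ζtruncᵂ-1 : ∀ lo N w → ζtruncᵂ (λ _ → 1ℚ) lo N w ≡ ζtrunc lo N w
ζtruncᵂ-1 lo N []      = refl
ζtruncᵂ-1 lo N (k ∷ w) = trans (sumRange-cong N (λ m _ → cong (pw (suc m) k *_) (ζtruncᵂ-1 (suc m) N w))) (sym (ζtrunc-∷ lo N k w))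

ζtrunc-∷ʳ : ∀ lo N w c → ζtrunc lo N (w ++ [ c ]) ≡ sumRange lo N (λ m → pw m c * ζtrunc lo (ℕ.pred m) w)
ζtrunc-∷ʳ lo N w c = trans (sym (ζtruncᵂ-1 lo N (w ++ [ c ]))) (trans (ζtruncᵂ-∷ʳ (λ _ → 1ℚ) lo N w c)
  (sumRange-cong N (λ m _ → cong (_* ζtrunc lo m w) (*-identityʳ (pw (suc m) c)))))

unsnoc-∷ʳ : ∀ w c → unsnoc (w ++ [ c ]) ≡ [ w , c ]
unsnoc-∷ʳ []          c = refl
unsnoc-∷ʳ (x ∷ [])    c = refl
unsnoc-∷ʳ (x ∷ y ∷ w) c = cong (map (λ { (u , m) → (x ∷ u , m) })) (unsnoc-∷ʳ (y ∷ w) c)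

-- The part of the multiple zeta sum with largest variable m, that is, the coefficient of t^m in the
-- multiple polylogarithm of (v, c).
coeff : Index → ℕ → Seq
coeff v c m = pw m c * ζtrunc 0 (ℕ.pred m) v

-- With the common largest variable m fixed, `ζtrunc-⋆` multiplies the two sums below m; the sum
-- belonging to v ++ [ c ] becomes the weight at m.
ζN-⊛ : ∀ N v c bs → 1 ℕ.≤ c → sumL ((v ++ [ c ]) ⊛ bs) (ζN N) ≡ ζtruncᵂ (coeff v c) 0 N bs
ζN-⊛ N v c bs p with initLast bs
-- For the empty index `⊛` gives no term, and the right side is the weight at `lo` = 0, which
-- vanishes because `recip 0` is `0ℚ` and the exponent is positive.
ζN-⊛ N v (suc c) .[] p | [] rewrite unsnoc-∷ʳ v (suc c) = sym (trans (cong (_* ζtrunc 0 0 v) (*-zeroˡ (powℚ 0ℚ c))) (*-zeroˡ (ζtrunc 0 0 v)))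
ζN-⊛ N v c .(w ∷ʳ d) p | w ∷ʳ′ d rewrite unsnoc-∷ʳ v c | unsnoc-∷ʳ w d = begin
  sumL ((map (λ u → u ++ [ c ℕ.+ d ]) (v ⋆ w) ++ []) ++ []) (ζN N)
    ≡⟨ cong (λ us → sumL us (ζN N)) (trans (Lₚ.++-identityʳ (us ++ [])) (Lₚ.++-identityʳ us)) ⟩
  sumL (map (λ u → u ++ [ c ℕ.+ d ]) (v ⋆ w)) (ζN N)
    ≡⟨ sumL-map (λ u → u ++ [ c ℕ.+ d ]) (v ⋆ w) (ζN N) ⟩
  sumL (v ⋆ w) (λ u → ζN N (u ++ [ c ℕ.+ d ]))
    ≡⟨ sumL-cong (v ⋆ w) (λ u → ζtrunc-∷ʳ 0 N u (c ℕ.+ d)) ⟩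
  sumL (v ⋆ w) (λ u → sumRange 0 N (λ m → pw m (c ℕ.+ d) * ζtrunc 0 (ℕ.pred m) u))
    ≡⟨ sumRange-sumL 0 N (v ⋆ w) (λ m u → pw m (c ℕ.+ d) * ζtrunc 0 (ℕ.pred m) u) ⟩
  sumRange 0 N (λ m → sumL (v ⋆ w) (λ u → pw m (c ℕ.+ d) * ζtrunc 0 (ℕ.pred m) u))
    ≡⟨ sumRange-cong N (λ m _ → trans (sumL-* (pw (suc m) (c ℕ.+ d)) (v ⋆ w) (ζtrunc 0 m))
         (trans (cong₂ _*_ (powℚ-+ (recip (suc m)) c d) (ζtrunc-⋆ 0 m v w))
           (solve 4 (λ a b x y → a :* b :* (x :* y) := b :* (a :* x) :* y) refl (pw (suc m) c) (pw (suc m) d) (ζtrunc 0 m v) (ζtrunc 0 m w)))) ⟩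
  sumRange 0 N (λ m → pw m d * coeff v c m * ζtrunc 0 (ℕ.pred m) w)
    ≡⟨ sym (ζtruncᵂ-∷ʳ (coeff v c) 0 N w d) ⟩
  ζtruncᵂ (coeff v c) 0 N (w ++ [ d ]) ∎
  where
  open ≡-Reasoning
  us = map (λ u → u ++ [ c ℕ.+ d ]) (v ⋆ w)

-- The sums of both sequences up to N are ζ_N(v, c) for every N, so the terms agree as successive
-- differences.
Li-index : ∀ v c → All (1 ℕ.≤_) (v ++ [ c ]) → ∀ n → Li (indexWord (v ++ [ c ])) n ≡ coeff v c n
Li-index v c p n = diff v p n
  where
  cons-form : ∀ v → All (1 ℕ.≤_) (v ++ [ c ]) → ∀ N → ∑ (suc N) (Li (indexWord (v ++ [ c ]))) ≡ ζN N (v ++ [ c ])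
  cons-form []      p N = ζN-index N c [] p
  cons-form (x ∷ v) p N = ζN-index N x (v ++ [ c ]) p
  diff : ∀ v → All (1 ℕ.≤_) (v ++ [ c ]) → ∀ n → Li (indexWord (v ++ [ c ])) n ≡ coeff v c n
  diff v p zero = trans (trans (sym (+-identityˡ _)) (trans (cons-form v p 0) (ζtrunc-∷ʳ 0 0 v c))) (sym (zero-coeff c (Allₚ.++⁻ʳ v p)))
    where
    zero-coeff : ∀ c → All (1 ℕ.≤_) [ c ] → coeff v c 0 ≡ 0ℚ
    zero-coeff zero    (() ∷ [])
    zero-coeff (suc c) _ = trans (cong (_* ζtrunc 0 0 v) (*-zeroˡ (powℚ 0ℚ c))) (*-zeroˡ (ζtrunc 0 0 v))
  diff v p (suc n) = +-cancelˡ′ (∑ (suc n) L) (begin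
    ∑ (suc (suc n)) L                       ≡⟨ trans (cons-form v p (suc n)) (ζtrunc-∷ʳ 0 (suc n) v c) ⟩
    sumRange 0 n (coeff v c) + coeff v c (suc n) ≡⟨ cong (_+ coeff v c (suc n)) (sym (trans (cons-form v p n) (ζtrunc-∷ʳ 0 n v c))) ⟩
    ∑ (suc n) L + coeff v c (suc n)         ∎)
    where
    open ≡-Reasoning
    L : Seq
    L = Li (indexWord (v ++ [ c ]))
    +-cancelˡ′ : ∀ x {y z} → x + y ≡ x + z → y ≡ z
    +-cancelˡ′ x {y} {z} e = trans (shift x y) (trans (cong (- x +_) e) (sym (shift x z)))
      where
      shift : ∀ x y → y ≡ - x + (x + y)
      shift = solve 2 (λ x y → y := :- x :+ (x :+ y)) refl

-- Star sums as iterated tail sums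

Dᵖ : ℕ → Seq → Seq
Dᵖ a f n = pw n a * f n

-- t/(1-t) times the difference of f(1) and f(t), for f truncated at degree N:
-- its coefficients are the tail sums of f.
U : ℕ → Seq → Seq
U N f n = ∑ (suc N) f * σ δ n - σ f n

-- `σ` stops before its index, so the tail includes the index itself; this is the source of the weak
-- inequalities between the n_j.
U-tail : ∀ N f m → m ℕ.< N → U N f (suc m) ≡ sumRange (suc m) N f + f (suc m)
U-tail N f m m<N = trans (cong₂ (λ x y → x * y - ∑ (suc m) f) (∑-split f (suc m) N m<N) (∑-δ m))
  (solve 3 (λ a b c → (a :+ b :+ c) :* con 1ℚ :- a := c :+ b) refl (∑ (suc m) f) (f (suc m)) (sumRange (suc m) N f))

-- At n ≥ 1, the truncated star sum for a ∷ bs with smallest variable n and weight `h` at the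
-- largest variable.
tails : ℕ → Seq → ℕ → Index → Seq
tails N h a []       = Dᵖ a h
tails N h a (b ∷ bs) = Dᵖ a (U N (tails N h b bs))

-- A comma stands for a strict inequality between neighbouring variables and a plus sign for
-- equality; together they give the weak inequality built into `U`.
ζtruncᵂ-star : ∀ h lo N a as → sumL (star (a ∷ as)) (ζtruncᵂ h lo N) ≡ sumRange lo N (tails N h a as)
ζtruncᵂ-star h lo N a []       = +-identityʳ (ζtruncᵂ h lo N [ a ])
ζtruncᵂ-star h lo N a (b ∷ bs) = begin
  sumL (map (a ∷_) (star (b ∷ bs)) ++ star (a ℕ.+ b ∷ bs)) (ζtruncᵂ h lo N)
    ≡⟨ sumL-++ (map (a ∷_) (star (b ∷ bs))) (star (a ℕ.+ b ∷ bs)) (ζtruncᵂ h lo N) ⟩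
  sumL (map (a ∷_) (star (b ∷ bs))) (ζtruncᵂ h lo N) + sumL (star (a ℕ.+ b ∷ bs)) (ζtruncᵂ h lo N)
    ≡⟨ cong₂ _+_ left (trans (ζtruncᵂ-star h lo N (a ℕ.+ b) bs) (sumRange-cong N (λ m _ → right bs (suc m)))) ⟩
  sumRange lo N (λ m → pw m a * sumRange m N t) + sumRange lo N (λ m → pw m a * t m)
    ≡⟨ sym (sumRange-+ lo N (λ m → pw m a * sumRange m N t) (λ m → pw m a * t m)) ⟩
  sumRange lo N (λ m → pw m a * sumRange m N t + pw m a * t m)
    ≡⟨ sumRange-cong N (λ m m<N → trans (sym (*-distribˡ-+ (pw (suc m) a) (sumRange (suc m) N t) (t (suc m)))) (cong (pw (suc m) a *_) (sym (U-tail N t m m<N)))) ⟩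
  sumRange lo N (Dᵖ a (U N t)) ∎
  where
  open ≡-Reasoning
  t : Seq
  t = tails N h b bs
  left : sumL (map (a ∷_) (star (b ∷ bs))) (ζtruncᵂ h lo N) ≡ sumRange lo N (λ m → pw m a * sumRange m N t)
  left = trans (sumL-map (a ∷_) (star (b ∷ bs)) (ζtruncᵂ h lo N)) (trans
    (sumRange-sumL lo N (star (b ∷ bs)) (λ m u → pw m a * ζtruncᵂ h m N u))
    (sumRange-cong N (λ m _ → trans (sumL-* (pw (suc m) a) (star (b ∷ bs)) (ζtruncᵂ h (suc m) N)) (cong (pw (suc m) a *_) (ζtruncᵂ-star h (suc m) N b bs)))))
  right : ∀ bs m → tails N h (a ℕ.+ b) bs m ≡ pw m a * tails N h b bs m
  right []       m = trans (cong (_* h m) (powℚ-+ (recip m) a b)) (*-assoc (pw m a) (pw m b) (h m))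
  right (c ∷ cs) m = trans (cong (_* u) (powℚ-+ (recip m) a b)) (*-assoc (pw m a) (pw m b) u)
    where u = U N (tails N h c cs) m

ζNΣ-sumL : ∀ N ks → ζNΣ N ks ≡ sumL ks (ζN N)
ζNΣ-sumL N []       = refl
ζNΣ-sumL N (k ∷ ks) = cong (ζN N k +_) (ζNΣ-sumL N ks)

ζN-⊛-star : ∀ N v c l ls → 1 ℕ.≤ c → 1 ℕ.≤ l → ζNΣ N ((v ++ [ c ]) ⊛Σ star (l ∷ ls)) ≡ ∑ (suc N) (tails N (coeff v c) l ls)
ζN-⊛-star N v c l ls 1≤c 1≤l = begin
  ζNΣ N ((v ++ [ c ]) ⊛Σ star (l ∷ ls))                       ≡⟨ ζNΣ-sumL N ((v ++ [ c ]) ⊛Σ star (l ∷ ls)) ⟩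
  sumL ((v ++ [ c ]) ⊛Σ star (l ∷ ls)) (ζN N)                 ≡⟨ sumL-concatMap ((v ++ [ c ]) ⊛_) (star (l ∷ ls)) (ζN N) ⟩
  sumL (star (l ∷ ls)) (λ bs → sumL ((v ++ [ c ]) ⊛ bs) (ζN N)) ≡⟨ sumL-cong (star (l ∷ ls)) (λ bs → ζN-⊛ N v c bs 1≤c) ⟩
  sumL (star (l ∷ ls)) (ζtruncᵂ (coeff v c) 0 N)              ≡⟨ ζtruncᵂ-star (coeff v c) 0 N l ls ⟩
  sumRange 0 N (tails N (coeff v c) l ls)                     ≡⟨ sym (∑-sumRange (tails N (coeff v c) l ls) (tails-0 1≤l ls) N) ⟩
  ∑ (suc N) (tails N (coeff v c) l ls)                        ∎
  where
  open ≡-Reasoning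
  Dᵖ-0 : ∀ {l} → 1 ℕ.≤ l → ∀ f → Dᵖ l f 0 ≡ 0ℚ
  Dᵖ-0 {suc l} _ f = trans (cong (_* f 0) (*-zeroˡ (powℚ 0ℚ l))) (*-zeroˡ (f 0))
  tails-0 : ∀ {l} → 1 ℕ.≤ l → ∀ ls → tails N (coeff v c) l ls 0 ≡ 0ℚ
  tails-0 p []       = Dᵖ-0 p (coeff v c)
  tails-0 p (m ∷ ls) = Dᵖ-0 p (U N (tails N (coeff v c) m ls))

-- Estimates

*-monoˡ : ∀ {p q} r → 0ℚ ≤ r → p ≤ q → r * p ≤ r * q
*-monoˡ r 0≤r p≤q = *-monoˡ-≤-nonNeg r {{nonNegative 0≤r}} p≤q

*-monoʳ : ∀ {p q} r → 0ℚ ≤ r → p ≤ q → p * r ≤ q * r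
*-monoʳ r 0≤r p≤q = *-monoʳ-≤-nonNeg r {{nonNegative 0≤r}} p≤q

*-mono : ∀ {p q r s} → 0ℚ ≤ r → 0ℚ ≤ q → p ≤ q → r ≤ s → p * r ≤ q * s
*-mono {p} {q} {r} {s} 0≤r 0≤q p≤q r≤s = ≤-trans (*-monoʳ r 0≤r p≤q) (*-monoˡ q 0≤q r≤s)

0≤* : ∀ {p q} → 0ℚ ≤ p → 0ℚ ≤ q → 0ℚ ≤ p * q
0≤* {p} {q} 0≤p 0≤q = subst (_≤ p * q) (*-zeroʳ p) (*-monoˡ p 0≤p 0≤q)

0≤+ : ∀ {p q} → 0ℚ ≤ p → 0ℚ ≤ q → 0ℚ ≤ p + q
0≤+ {p} {q} 0≤p 0≤q = +-mono-≤ 0≤p 0≤q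

≤-+ʳ : ∀ p {q} → 0ℚ ≤ q → p ≤ p + q
≤-+ʳ p {q} 0≤q = subst (_≤ p + q) (+-identityʳ p) (+-monoʳ-≤ p 0≤q)

p≤q⇒0≤q-p : ∀ {p q} → p ≤ q → 0ℚ ≤ q - p
p≤q⇒0≤q-p {p} {q} p≤q = subst (_≤ q - p) (+-inverseʳ p) (+-monoˡ-≤ (- p) p≤q)

0≤1 : 0ℚ ≤ 1ℚ
0≤1 = nonNegative⁻¹ 1ℚ

0≤ι : ∀ n → 0ℚ ≤ ι n
0≤ι zero    = ≤-refl
0≤ι (suc n) = 0≤+ 0≤1 (0≤ι n)

ι-+ : ∀ m n → ι (m ℕ.+ n) ≡ ι m + ι n
ι-+ zero    n = sym (+-identityˡ (ι n))
ι-+ (suc m) n = trans (cong (1ℚ +_) (ι-+ m n)) (sym (+-assoc 1ℚ (ι m) (ι n)))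

0≤recip : ∀ n → 0ℚ ≤ recip n
0≤recip zero    = ≤-refl
0≤recip (suc n) = nonNegative⁻¹ (recip (suc n)) {{normalize-nonNeg 1 (suc n)}}

ι*recip≤1 : ∀ {m n} → m ℕ.≤ n → ι m * recip n ≤ 1ℚ
ι*recip≤1 {m} {zero}  z≤n = 0≤1
ι*recip≤1 {m} {suc n} m≤n = subst (ι m * recip (suc n) ≤_) (ι*recip n)
  (*-monoʳ (recip (suc n)) (0≤recip (suc n)) (subst (λ k → ι m ≤ ι k) (ℕₚ.m+[n∸m]≡n m≤n)
    (subst (ι m ≤_) (sym (ι-+ m (suc n ℕ.∸ m))) (≤-+ʳ (ι m) (0≤ι (suc n ℕ.∸ m))))))

recip≤1 : ∀ n → recip n ≤ 1ℚ
recip≤1 zero    = 0≤1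
recip≤1 (suc n) = subst (_≤ 1ℚ) (trans (cong (_* recip (suc n)) (+-identityʳ 1ℚ)) (*-identityˡ (recip (suc n)))) (ι*recip≤1 {1} {suc n} (s≤s z≤n))

recip-* : ∀ i j → recip (suc i) * recip (suc j) ≡ (recip (suc i) + recip (suc j)) * recip (suc i ℕ.+ suc j)
recip-* i j = begin
  x * y                                   ≡⟨ sym (*-identityʳ (x * y)) ⟩
  x * y * 1ℚ                              ≡⟨ cong (x * y *_) (sym (trans (cong (_* z) (sym (ι-+ (suc i) (suc j)))) (ι*recip (i ℕ.+ suc j)))) ⟩
  x * y * ((ι (suc i) + ι (suc j)) * z)   ≡⟨ solve 5 (λ x y z I J → x :* y :* ((I :+ J) :* z) := ((J :* y) :* x :+ (I :* x) :* y) :* z) refl x y z (ι (suc i)) (ι (suc j)) ⟩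
  (ι (suc j) * y * x + ι (suc i) * x * y) * z ≡⟨ cong₂ (λ s t → (s * x + t * y) * z) (ι*recip j) (ι*recip i) ⟩
  (1ℚ * x + 1ℚ * y) * z                   ≡⟨ cong₂ (λ s t → (s + t) * z) (*-identityˡ x) (*-identityˡ y) ⟩
  (x + y) * z                             ∎
  where
  open ≡-Reasoning
  x = recip (suc i)
  y = recip (suc j)
  z = recip (suc i ℕ.+ suc j)

-- Partial fractions. Only ≤ survives at index 0, where the value `recip 0` = `0ℚ` kills the left
-- side.
recip-*-≤ : ∀ i j → recip i * recip j ≤ (recip i + recip j) * recip (i ℕ.+ j)
recip-*-≤ zero    j       = subst (_≤ (0ℚ + recip j) * recip j) (sym (*-zeroˡ (recip j))) (0≤* (0≤+ ≤-refl (0≤recip j)) (0≤recip j))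
recip-*-≤ (suc i) zero    = subst (_≤ (recip (suc i) + 0ℚ) * recip (suc i ℕ.+ 0)) (sym (*-zeroʳ (recip (suc i))))
  (0≤* (0≤+ (0≤recip (suc i)) ≤-refl) (0≤recip (suc i ℕ.+ 0)))
recip-*-≤ (suc i) (suc j) = ≤-reflexive (recip-* i j)

-- Partial fractions again: the numerator j of 1/i - 1/(i + j) cancels the denominator j. This
-- cancellation produces the factor 1/(N + 1) of the error.
recip-diff : ∀ i j → recip j * (recip (suc i) - recip (suc i ℕ.+ j)) ≤ recip (suc i) * recip (suc i ℕ.+ j)
recip-diff i zero    = subst (_≤ recip (suc i) * recip (suc i ℕ.+ 0)) (sym (*-zeroˡ (recip (suc i) - recip (suc i ℕ.+ 0)))) (0≤* (0≤recip (suc i)) (0≤recip (suc i ℕ.+ 0)))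
recip-diff i (suc j) = ≤-reflexive (begin
  y * (x - z)             ≡⟨ solve 3 (λ x y z → y :* (x :- z) := x :* y :- y :* z) refl x y z ⟩
  x * y - y * z           ≡⟨ cong (_- y * z) (recip-* i j) ⟩
  (x + y) * z - y * z     ≡⟨ solve 3 (λ x y z → (x :+ y) :* z :- y :* z := x :* z) refl x y z ⟩
  x * z                   ∎)
  where
  open ≡-Reasoning
  x = recip (suc i)
  y = recip (suc j)
  z = recip (suc i ℕ.+ suc j)

-- From 1/n ≤ 2/(n + 1) and 1/n · 1/(n + 1) = 1/n - 1/(n + 1).
recip-square : ∀ n → recip (suc n) * recip (suc n) ≤ (recip (suc n) - recip (suc (suc n))) + (recip (suc n) - recip (suc (suc n)))
recip-square n = begin
  x * x                  ≤⟨ *-monoˡ x (0≤recip (suc n)) (begin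
      x              ≡⟨ step ⟩
      x * y + y      ≤⟨ +-monoˡ-≤ y (subst (x * y ≤_) (*-identityˡ y) (*-monoʳ y (0≤recip (suc (suc n))) (recip≤1 (suc n)))) ⟩
      y + y          ∎) ⟩
  x * (y + y)            ≡⟨ *-distribˡ-+ x y y ⟩
  x * y + x * y          ≡⟨ cong₂ _+_ diff diff ⟩
  (x - y) + (x - y)      ∎
  where
  open ≤-Reasoning
  x = recip (suc n)
  y = recip (suc (suc n))
  step : x ≡ x * y + y
  step = trans (sym (*-identityʳ x)) (trans (recip-* n 0) (trans (cong ((x + 1ℚ) *_) (cong recip (cong suc (ℕₚ.+-comm n 1))))
    (solve 2 (λ x y → (x :+ con 1ℚ) :* y := x :* y :+ y) refl x y)))
  diff : x * y ≡ x - y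
  diff = trans (solve 2 (λ a y → a := (a :+ y) :- y) refl (x * y) y) (cong (_- y) (sym step))

powℚ-nonNeg : ∀ {q} → 0ℚ ≤ q → ∀ n → 0ℚ ≤ powℚ q n
powℚ-nonNeg 0≤q zero    = 0≤1
powℚ-nonNeg 0≤q (suc n) = 0≤* 0≤q (powℚ-nonNeg 0≤q n)

powℚ-≤1 : ∀ {q} → 0ℚ ≤ q → q ≤ 1ℚ → ∀ n → powℚ q n ≤ 1ℚ
powℚ-≤1 0≤q q≤1 zero    = ≤-refl
powℚ-≤1 {q} 0≤q q≤1 (suc n) = *-mono {s = 1ℚ} (powℚ-nonNeg 0≤q n) 0≤1 q≤1 (powℚ-≤1 0≤q q≤1 n)

powℚ-* : ∀ p q n → powℚ (p * q) n ≡ powℚ p n * powℚ q n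
powℚ-* p q zero    = refl
powℚ-* p q (suc n) = trans (cong (p * q *_) (powℚ-* p q n))
  (solve 4 (λ p q x y → p :* q :* (x :* y) := p :* x :* (q :* y)) refl p q (powℚ p n) (powℚ q n))

Dᵖ-bound : ∀ {l} → 1 ℕ.≤ l → ∀ f n → ∣ Dᵖ l f n ∣ ≤ recip n * ∣ f n ∣
Dᵖ-bound {suc l} _ f n = begin
  ∣ pw n (suc l) * f n ∣         ≡⟨ ∣p*q∣≡∣p∣*∣q∣ (pw n (suc l)) (f n) ⟩
  ∣ pw n (suc l) ∣ * ∣ f n ∣     ≡⟨ cong (_* ∣ f n ∣) (0≤p⇒∣p∣≡p (powℚ-nonNeg (0≤recip n) (suc l))) ⟩
  recip n * pw n l * ∣ f n ∣     ≤⟨ *-monoʳ ∣ f n ∣ (0≤∣p∣ (f n)) (subst (recip n * pw n l ≤_) (*-identityʳ (recip n))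
                                      (*-monoˡ (recip n) (0≤recip n) (powℚ-≤1 (0≤recip n) (recip≤1 n) l))) ⟩
  recip n * ∣ f n ∣              ∎
  where open ≤-Reasoning

∑-mono : ∀ {f g : Seq} n → (∀ i → i ℕ.< n → f i ≤ g i) → ∑ n f ≤ ∑ n g
∑-mono zero    e = ≤-refl
∑-mono (suc n) e = +-mono-≤ (∑-mono n (λ i p → e i (ℕₚ.m<n⇒m<1+n p))) (e n ℕₚ.≤-refl)

∣∑∣≤ : ∀ f n → ∣ ∑ n f ∣ ≤ ∑ n (λ i → ∣ f i ∣)
∣∑∣≤ f zero    = ≤-refl
∣∑∣≤ f (suc n) = ≤-trans (∣p+q∣≤∣p∣+∣q∣ (∑ n f) (f n)) (+-monoˡ-≤ ∣ f n ∣ (∣∑∣≤ f n))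

∑-recip-mono : ∀ {m n} → m ℕ.≤ n → ∑ m recip ≤ ∑ n recip
∑-recip-mono {m} {zero}  z≤n = ≤-refl
∑-recip-mono {m} {suc n} m≤ with m ℕₚ.≟ suc n
... | yes refl = ≤-refl
... | no  m≢   = ≤-trans (∑-recip-mono (ℕₚ.≤-pred (ℕₚ.≤∧≢⇒< m≤ m≢))) (≤-+ʳ (∑ n recip) (0≤recip n))

-- Partial fractions bound each term of a convolution by a function of i plus a function of j, which
-- leaves two ordinary sums.
⊗-bound : ∀ f g h h′ n → (∀ i j → i ℕ.+ j ≡ n → ∣ f i * g j ∣ ≤ h i + h′ j) → ∣ (f ⊗ g) n ∣ ≤ ∑ (suc n) h + ∑ (suc n) h′
⊗-bound f g h h′ zero    e = subst₂ (λ x y → ∣ f 0 * g 0 ∣ ≤ x + y) (sym (+-identityˡ (h 0))) (sym (+-identityˡ (h′ 0))) (e 0 0 refl)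
⊗-bound f g h h′ (suc n) e = begin
  ∣ f 0 * g (suc n) + ((f ∘ suc) ⊗ g) n ∣                              ≤⟨ ∣p+q∣≤∣p∣+∣q∣ (f 0 * g (suc n)) (((f ∘ suc) ⊗ g) n) ⟩
  ∣ f 0 * g (suc n) ∣ + ∣ ((f ∘ suc) ⊗ g) n ∣                          ≤⟨ +-mono-≤ (e 0 (suc n) refl) (⊗-bound (f ∘ suc) g (h ∘ suc) h′ n (λ i j p → e (suc i) j (cong suc p))) ⟩
  (h 0 + h′ (suc n)) + (∑ (suc n) (h ∘ suc) + ∑ (suc n) h′)            ≡⟨ solve 4 (λ a b c d → (a :+ b) :+ (c :+ d) := (a :+ c) :+ (d :+ b)) refl (h 0) (h′ (suc n)) (∑ (suc n) (h ∘ suc)) (∑ (suc n) h′) ⟩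
  (h 0 + ∑ (suc n) (h ∘ suc)) + (∑ (suc n) h′ + h′ (suc n))            ≡⟨ cong (_+ ∑ (suc (suc n)) h′) (sym (∑-head h (suc n))) ⟩
  ∑ (suc (suc n)) h + ∑ (suc (suc n)) h′                               ∎
  where open ≤-Reasoning

-- Linearity of the zigzag series in the top chain

run-replicate : ∀ j f n → run (replicate j false) f n ≡ Dᵖ j f n
run-replicate zero    f n = sym (*-identityˡ (f n))
run-replicate (suc j) f n = trans (run-replicate j (D f) n)
  (solve 3 (λ a b c → a :* (b :* c) := b :* a :* c) refl (pw n j) (recip n) (f n))

run-eWord : ∀ {l} → 1 ℕ.≤ l → ∀ f n → run (eWord l) f n ≡ Dᵖ l (σ f) n
run-eWord {suc l} _ f n = trans (run-replicate l (D (σ f)) n)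
  (solve 3 (λ a b c → a :* (b :* c) := b :* a :* c) refl (pw n l) (recip n) (σ f n))

O-lin : ∀ d c {f g h : Seq} → (∀ n → h n ≡ c * g n - f n) → ∀ n → O d h n ≡ c * O d g n - O d f n
O-lin d c {f} {g} {h} e n = trans (cong (recip n *_) (τ-lin d)) 
  (solve 4 (λ r c a b → r :* (c :* a :- b) := c :* (r :* a) :- r :* b) refl (recip n) c (τ d g n) (τ d f n))
  where
  τ-lin : ∀ d → τ d h n ≡ c * τ d g n - τ d f n
  τ-lin true  = trans (∑-cong′ n e) (∑-lin c g f n)
  τ-lin false = e n

run-lin : ∀ w c {f g h : Seq} → (∀ n → h n ≡ c * g n - f n) → ∀ n → run w h n ≡ c * run w g n - run w f n
run-lin []      c e = e
run-lin (d ∷ w) c e = run-lin w c (O-lin d c e)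

-- The combination c * g - f is the one that arises from `U N f`, with c the truncated sum of the
-- coefficients.
Z-lin : ∀ ws c {f g h : Seq} → (∀ n → h n ≡ c * g n - f n) → ∀ n → Z h ws n ≡ c * Z g ws n - Z f ws n
Z-lin []       c e n = e n
Z-lin (w ∷ ws) c {f} {g} {h} e n = trans
  (cong₂ _-_ (trans (⊗-cong {g = Q} n (λ i _ → e i) (λ _ _ → refl)) (⊗-linˡ c g f Q n)) (Z-lin ws c (run-lin w c e) n))
  (solve 5 (λ c a b x y → (c :* a :- b) :- (c :* x :- y) := c :* (a :- x) :- (b :- y)) refl c ((g ⊗ Q) n) ((f ⊗ Q) n) (Z (run w g) ws n) (Z (run w f) ws n))
  where
  Q : Seq
  Q = Z (Li w) ws

Z-cong : ∀ ws {f g : Seq} → (∀ n → f n ≡ g n) → ∀ n → Z f ws n ≡ Z g ws n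
-- Both series are written as 0 * g - (- g), so pointwise equality is a case of linearity.
Z-cong ws {f} {g} e n = trans (Z-lin ws 0ℚ {g = g} (λ n → trans (e n) (flip (g n))) n)
  (sym (Z-lin ws 0ℚ {g = g} (λ n → flip (g n)) n))
  where
  flip : ∀ x → x ≡ 0ℚ * x - - x
  flip = solve 1 (λ x → x := con 0ℚ :* x :- (:- x)) refl

harmonic : ℕ → ℚ
harmonic n = ∑ (suc n) recip

0≤harmonic : ∀ n → 0ℚ ≤ harmonic n
0≤harmonic n = ∑-recip-mono {0} {suc n} z≤n

1≤harmonic : ∀ n → 1ℚ ≤ harmonic (suc n)
1≤harmonic n = ∑-recip-mono {2} {suc (suc n)} (s≤s (s≤s z≤n))

-- Error estimates at a fixed truncation

module Bounds (N : ℕ) where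

  -- Both are taken at N + 1, the degree of the error coefficient; this also ensures H ≥ 1 when N =
  -- 0.
  H q : ℚ
  H = harmonic (suc N)
  q = recip (suc N)

  0≤H : 0ℚ ≤ H
  0≤H = 0≤harmonic (suc N)

  -- The bounds are only asked up to N, since the constants M contain powers of the H of this N.
  Order1 Order2 : ℚ → Seq → Set
  Order1 M f = ∀ n → n ℕ.≤ N → ∣ f n ∣ ≤ M * recip n
  Order2 M f = ∀ n → n ℕ.≤ N → ∣ f n ∣ ≤ M * (recip n * recip n)

  σ-bound : ∀ {M f} → 0ℚ ≤ M → Order1 M f → ∀ n → n ℕ.≤ N → ∣ σ f n ∣ ≤ M * H
  σ-bound {M} {f} 0≤M o n n≤N = begin
    ∣ ∑ n f ∣                   ≤⟨ ∣∑∣≤ f n ⟩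
    ∑ n (λ i → ∣ f i ∣)         ≤⟨ ∑-mono n (λ i i<n → o i (ℕₚ.≤-trans (ℕₚ.<⇒≤ i<n) n≤N)) ⟩
    ∑ n (λ i → M * recip i)     ≡⟨ ∑-* M recip n ⟩
    M * ∑ n recip               ≤⟨ *-monoˡ M 0≤M (∑-recip-mono (ℕₚ.≤-trans n≤N (ℕₚ.≤-trans (ℕₚ.n≤1+n N) (ℕₚ.n≤1+n (suc N))))) ⟩
    M * H                       ∎
    where open ≤-Reasoning

  run-eWord-bound : ∀ {M f l} → 1 ℕ.≤ l → (∀ n → n ℕ.≤ N → ∣ σ f n ∣ ≤ M) → Order1 M (run (eWord l) f)
  run-eWord-bound {M} {f} {l} 1≤l o n n≤N = begin
    ∣ run (eWord l) f n ∣      ≡⟨ cong ∣_∣ (run-eWord 1≤l f n) ⟩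
    ∣ Dᵖ l (σ f) n ∣           ≤⟨ Dᵖ-bound 1≤l (σ f) n ⟩
    recip n * ∣ σ f n ∣        ≤⟨ *-monoˡ (recip n) (0≤recip n) (o n n≤N) ⟩
    recip n * M                ≡⟨ *-comm (recip n) M ⟩
    M * recip n                ∎
    where open ≤-Reasoning

  ∣σδ∣≤1 : ∀ n → ∣ σ δ n ∣ ≤ 1ℚ
  ∣σδ∣≤1 zero    = 0≤1
  ∣σδ∣≤1 (suc n) = ≤-reflexive (cong ∣_∣ (∑-δ n))

  -- Partial fractions take out 1/n and leave two harmonic sums, whence `H + H`.
  ⊗-Order1 : ∀ {M P f g} → 0ℚ ≤ M → 0ℚ ≤ P → Order1 M f → Order1 P g → Order1 (M * P * (H + H)) (f ⊗ g)
  ⊗-Order1 {M} {P} {f} {g} 0≤M 0≤P of og n n≤N = begin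
    ∣ (f ⊗ g) n ∣                      ≤⟨ ⊗-bound f g h h n term ⟩
    ∑ (suc n) h + ∑ (suc n) h          ≤⟨ +-mono-≤ bound bound ⟩
    C * H + C * H                      ≡⟨ solve 4 (λ m p r h → m :* p :* r :* h :+ m :* p :* r :* h := m :* p :* (h :+ h) :* r) refl M P (recip n) H ⟩
    M * P * (H + H) * recip n          ∎
    where
    open ≤-Reasoning
    C = M * P * recip n
    0≤C : 0ℚ ≤ C
    0≤C = 0≤* (0≤* 0≤M 0≤P) (0≤recip n)
    h : Seq
    h i = C * recip i
    bound : ∑ (suc n) h ≤ C * H
    bound = subst (_≤ C * H) (sym (∑-* C recip (suc n))) (*-monoˡ C 0≤C (∑-recip-mono (s≤s (ℕₚ.m≤n⇒m≤1+n n≤N))))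
    term : ∀ i j → i ℕ.+ j ≡ n → ∣ f i * g j ∣ ≤ h i + h j
    term i j refl = begin
      ∣ f i * g j ∣                                         ≡⟨ ∣p*q∣≡∣p∣*∣q∣ (f i) (g j) ⟩
      ∣ f i ∣ * ∣ g j ∣                                     ≤⟨ *-mono (0≤∣p∣ (g j)) (0≤* 0≤M (0≤recip i)) (of i (ℕₚ.≤-trans (ℕₚ.m≤m+n i j) n≤N)) (og j (ℕₚ.≤-trans (ℕₚ.m≤n+m j i) n≤N)) ⟩
      M * recip i * (P * recip j)                           ≡⟨ solve 4 (λ m p x y → m :* x :* (p :* y) := m :* p :* (x :* y)) refl M P (recip i) (recip j) ⟩
      M * P * (recip i * recip j)                           ≤⟨ *-monoˡ (M * P) (0≤* 0≤M 0≤P) (recip-*-≤ i j) ⟩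
      M * P * ((recip i + recip j) * recip (i ℕ.+ j))       ≡⟨ solve 5 (λ m p x y z → m :* p :* ((x :+ y) :* z) := m :* p :* z :* x :+ m :* p :* z :* y) refl M P (recip i) (recip j) (recip (i ℕ.+ j)) ⟩
      h i + h j                                             ∎

  -- Each chain costs a factor 3 H: 2 H for the product and H for the merged chain, where `σ` is
  -- applied once more.
  P : List ℕ → ℚ
  P ls = powℚ (H + H + H) (length ls)

  0≤P : ∀ ls → 0ℚ ≤ P ls
  0≤P ls = powℚ-nonNeg (0≤+ (0≤+ 0≤H 0≤H) 0≤H) (length ls)

  Z-bound : ∀ {M f} ls → 0ℚ ≤ M → All (1 ℕ.≤_) ls → Order1 M f → Order1 (M * P ls) (Z f (map eWord ls))
  Z-bound {M} {f} []       0≤M []          o n n≤N = subst (λ m → ∣ f n ∣ ≤ m * recip n) (sym (*-identityʳ M)) (o n n≤N)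
  Z-bound {M} {f} (l ∷ ls) 0≤M (1≤l ∷ 1≤ls) o n n≤N = begin
    ∣ (f ⊗ Q) n - R n ∣                                          ≤⟨ ∣p-q∣≤∣p∣+∣q∣ ((f ⊗ Q) n) (R n) ⟩
    ∣ (f ⊗ Q) n ∣ + ∣ R n ∣                                      ≤⟨ +-mono-≤ (⊗-Order1 0≤M (0≤* 0≤1 (0≤P ls)) o oQ n n≤N) (oR n n≤N) ⟩
    M * (1ℚ * P ls) * (H + H) * recip n + M * H * P ls * recip n ≡⟨ solve 4 (λ m p h r → m :* (con 1ℚ :* p) :* (h :+ h) :* r :+ m :* h :* p :* r := m :* ((h :+ h :+ h) :* p) :* r) refl M (P ls) H (recip n) ⟩
    M * P (l ∷ ls) * recip n                                     ∎
    where
    open ≤-Reasoning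
    Q R : Seq
    Q = Z (Li (eWord l)) (map eWord ls)
    R = Z (run (eWord l) f) (map eWord ls)
    oQ : Order1 (1ℚ * P ls) Q
    oQ = Z-bound ls 0≤1 1≤ls (run-eWord-bound 1≤l (λ n _ → ∣σδ∣≤1 n))
    oR : Order1 (M * H * P ls) R
    oR = Z-bound ls (0≤* 0≤M 0≤H) 1≤ls (run-eWord-bound 1≤l (σ-bound 0≤M o))

  -- The bound r(n)² ≤ 2 (r(n) - r(n+1)) telescopes.
  tail-bound : ∀ {M} f m d → 0ℚ ≤ M → (∀ n → n ℕ.< d ℕ.+ suc m → ∣ f n ∣ ≤ M * (recip n * recip n)) →
    ∣ ∑ (d ℕ.+ suc m) f - ∑ (suc m) f ∣ ≤ (M + M) * (recip (suc m) - recip (d ℕ.+ suc m))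
  tail-bound {M} f m zero    0≤M o = ≤-reflexive (trans (cong ∣_∣ (+-inverseʳ (∑ (suc m) f)))
    (sym (trans (cong ((M + M) *_) (+-inverseʳ (recip (suc m)))) (*-zeroʳ (M + M)))))
  tail-bound {M} f m (suc d) 0≤M o = begin
    ∣ ∑ e f + f e - ∑ (suc m) f ∣                    ≡⟨ cong ∣_∣ (solve 3 (λ a b c → a :+ b :- c := (a :- c) :+ b) refl (∑ e f) (f e) (∑ (suc m) f)) ⟩
    ∣ (∑ e f - ∑ (suc m) f) + f e ∣                  ≤⟨ ∣p+q∣≤∣p∣+∣q∣ (∑ e f - ∑ (suc m) f) (f e) ⟩
    ∣ ∑ e f - ∑ (suc m) f ∣ + ∣ f e ∣                ≤⟨ +-mono-≤ (tail-bound f m d 0≤M (λ n p → o n (ℕₚ.m<n⇒m<1+n p))) (o e ℕₚ.≤-refl) ⟩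
    (M + M) * (recip (suc m) - recip e) + M * (recip e * recip e)
      ≤⟨ +-monoʳ-≤ ((M + M) * (recip (suc m) - recip e)) (*-monoˡ M 0≤M (square e (ℕₚ.m≤n+m (suc m) d))) ⟩
    (M + M) * (recip (suc m) - recip e) + M * ((recip e - recip (suc e)) + (recip e - recip (suc e)))
      ≡⟨ solve 4 (λ m x y z → (m :+ m) :* (x :- y) :+ m :* ((y :- z) :+ (y :- z)) := (m :+ m) :* (x :- z)) refl M (recip (suc m)) (recip e) (recip (suc e)) ⟩
    (M + M) * (recip (suc m) - recip (suc e))        ∎
    where
    open ≤-Reasoning
    e = d ℕ.+ suc m
    square : ∀ e → suc m ℕ.≤ e → recip e * recip e ≤ (recip e - recip (suc e)) + (recip e - recip (suc e))
    square (suc e) _ = recip-square e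

  -- The end term `q` of the telescope is kept, because `error-bound` lives on the difference
  -- between the two reciprocals.
  U-bound : ∀ {M f} → 0ℚ ≤ M → Order2 M f → ∀ m → m ℕ.≤ N → ∣ U N f (suc m) ∣ ≤ (M + M) * (recip (suc m) - q)
  U-bound {M} {f} 0≤M o m m≤N = subst₂ (λ x y → ∣ x ∣ ≤ (M + M) * (recip (suc m) - recip y))
    (trans (cong (λ k → ∑ k f - ∑ (suc m) f) eq) (cong (_- ∑ (suc m) f) (sym (trans (cong (∑ (suc N) f *_) (∑-δ m)) (*-identityʳ (∑ (suc N) f))))))
    eq (tail-bound f m (N ℕ.∸ m) 0≤M (λ n p → o n (ℕₚ.≤-pred (subst (n ℕ.<_) eq p))))
    where
    eq : N ℕ.∸ m ℕ.+ suc m ≡ suc N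
    eq = trans (ℕₚ.+-suc (N ℕ.∸ m) m) (cong suc (ℕₚ.m∸n+n≡m m≤N))

  -- A tail of a series of order 1/n² is of order 1/n, and l ≥ 1 divisions by n restore 1/n². Hence
  -- the next chain can be removed under the same kind of hypothesis, with M doubled.
  Dᵖ-U-Order2 : ∀ {M f l} → 0ℚ ≤ M → 1 ℕ.≤ l → Order2 M f → Order2 (M + M) (Dᵖ l (U N f))
  Dᵖ-U-Order2 {M} {f} {l} 0≤M 1≤l o zero    _   = ≤-trans (Dᵖ-bound 1≤l (U N f) 0) (≤-reflexive (trans (*-zeroˡ ∣ U N f 0 ∣) (sym (*-zeroʳ (M + M)))))
  Dᵖ-U-Order2 {M} {f} {l} 0≤M 1≤l o (suc m) m<N = begin
    ∣ Dᵖ l (U N f) (suc m) ∣                  ≤⟨ Dᵖ-bound 1≤l (U N f) (suc m) ⟩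
    r * ∣ U N f (suc m) ∣                     ≤⟨ *-monoˡ r (0≤recip (suc m)) (begin
        ∣ U N f (suc m) ∣      ≤⟨ U-bound 0≤M o m (ℕₚ.<⇒≤ m<N) ⟩
        (M + M) * (r - q)      ≤⟨ *-monoˡ (M + M) (0≤+ 0≤M 0≤M) (subst (r - q ≤_) (+-identityʳ r) (+-monoʳ-≤ r (neg-antimono-≤ (0≤recip (suc N))))) ⟩
        (M + M) * r            ∎) ⟩
    r * ((M + M) * r)                         ≡⟨ solve 2 (λ m r → r :* (m :* r) := m :* (r :* r)) refl (M + M) r ⟩
    (M + M) * (r * r)                         ∎
    where
    open ≤-Reasoning
    r = recip (suc m)

  -- For i + j = N + 1 the bound 1/j of g meets the difference 1/i - 1/(N + 1) in the bound of
  -- `U N f`; by `recip-diff` the product is at most 1/i · 1/(N + 1), and the sum over i gives H.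
  error-bound : ∀ {M B f g} → 0ℚ ≤ M → 0ℚ ≤ B → Order2 M f → Order1 B g → ∣ (U N f ⊗ g) (suc N) ∣ ≤ (M + M) * B * q * H
  error-bound {M} {B} {f} {g} 0≤M 0≤B of og = begin
    ∣ (U N f ⊗ g) (suc N) ∣                                     ≤⟨ ⊗-bound (U N f) g h (λ _ → 0ℚ) (suc N) term ⟩
    ∑ (suc (suc N)) h + ∑ (suc (suc N)) (λ _ → 0ℚ)              ≡⟨ cong₂ _+_ (∑-* C recip (suc (suc N))) (zeros (suc (suc N))) ⟩
    C * H + 0ℚ                                                  ≡⟨ +-identityʳ (C * H) ⟩
    C * H                                                       ∎
    where
    open ≤-Reasoning
    C = (M + M) * B * q
    0≤C : 0ℚ ≤ C
    0≤C = 0≤* (0≤* (0≤+ 0≤M 0≤M) 0≤B) (0≤recip (suc N))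
    h : Seq
    h i = C * recip i
    zeros : ∀ n → ∑ n (λ _ → 0ℚ) ≡ 0ℚ
    zeros zero    = refl
    zeros (suc n) = cong (_+ 0ℚ) (zeros n)
    term : ∀ i j → i ℕ.+ j ≡ suc N → ∣ U N f i * g j ∣ ≤ h i + 0ℚ
    term zero    j e = ≤-reflexive (trans (cong ∣_∣ (trans (cong (_* g j) U0) (*-zeroˡ (g j)))) (sym (trans (+-identityʳ (h 0)) (*-zeroʳ C))))
      where
      U0 : U N f 0 ≡ 0ℚ
      U0 = solve 1 (λ a → a :* con 0ℚ :- con 0ℚ := con 0ℚ) refl (∑ (suc N) f)
    term (suc i) j e = begin
      ∣ U N f (suc i) * g j ∣                               ≡⟨ ∣p*q∣≡∣p∣*∣q∣ (U N f (suc i)) (g j) ⟩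
      ∣ U N f (suc i) ∣ * ∣ g j ∣                           ≤⟨ *-mono (0≤∣p∣ (g j)) (≤-trans (0≤∣p∣ (U N f (suc i))) ub) ub (og j (subst (j ℕ.≤_) i+j≡N (ℕₚ.m≤n+m j i))) ⟩
      (M + M) * (recip (suc i) - q) * (B * recip j)         ≡⟨ solve 4 (λ m x b y → m :* x :* (b :* y) := m :* b :* (y :* x)) refl (M + M) (recip (suc i) - q) B (recip j) ⟩
      (M + M) * B * (recip j * (recip (suc i) - q))         ≤⟨ *-monoˡ ((M + M) * B) (0≤* (0≤+ 0≤M 0≤M) 0≤B)
                                                                 (subst (λ k → recip j * (recip (suc i) - recip k) ≤ recip (suc i) * recip k) e (recip-diff i j)) ⟩
      (M + M) * B * (recip (suc i) * q)                     ≡⟨ solve 4 (λ m b x y → m :* b :* (x :* y) := m :* b :* y :* x :+ con 0ℚ) refl (M + M) B (recip (suc i)) q ⟩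
      h (suc i) + 0ℚ                                        ∎
      where
      i+j≡N : i ℕ.+ j ≡ N
      i+j≡N = ℕₚ.suc-injective e
      ub : ∣ U N f (suc i) ∣ ≤ (M + M) * (recip (suc i) - q)
      ub = U-bound 0≤M of i (subst (i ℕ.≤_) i+j≡N (ℕₚ.m≤m+n i j))

  V : List ℕ → Seq → Seq
  V []       f = f
  V (l ∷ ls) f = V ls (Dᵖ l (U N f))

  -- The factor of M/(N + 1) in the accumulated error. The first summand is `error-bound` for the
  -- chain being removed; the 2 in the second is the doubling of M in `Dᵖ-U-Order2`.
  err : List ℕ → ℚ
  err []       = 0ℚ
  err (l ∷ ls) = (1ℚ + 1ℚ) * P ls * H + (1ℚ + 1ℚ) * err ls

  -- The series `Dᵖ l (U N f)` is A times that of e_l minus f integrated along e_l, so by linearity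
  -- the merged term occurs twice and cancels. Summing coefficients up to N is the same as taking
  -- the coefficient of degree N + 1 after multiplication by t/(1 - t), and this turns the remainder
  -- into a single coefficient.
  Z-step : ∀ {l} ls f → 1 ℕ.≤ l →
    ∑ (suc N) (Z f (map eWord (l ∷ ls))) - ∑ (suc N) (Z (Dᵖ l (U N f)) (map eWord ls))
      ≡ - (U N f ⊗ Z (Li (eWord l)) (map eWord ls)) (suc N)
  Z-step {l} ls f 1≤l = begin
    ∑ (suc N) (λ n → (f ⊗ Q) n - R n) - ∑ (suc N) (Z (Dᵖ l (U N f)) (map eWord ls))
      ≡⟨ cong₂ _-_ (∑-minus (f ⊗ Q) R) (trans (∑-cong′ (suc N) (Z-lin (map eWord ls) A lin)) (∑-lin A Q R (suc N))) ⟩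
    (∑ (suc N) (f ⊗ Q) - ∑ (suc N) R) - (A * ∑ (suc N) Q - ∑ (suc N) R)
      ≡⟨ solve 3 (λ x y z → (x :- y) :- (z :- y) := :- (z :- x)) refl (∑ (suc N) (f ⊗ Q)) (∑ (suc N) R) (A * ∑ (suc N) Q) ⟩
    - (A * ∑ (suc N) Q - ∑ (suc N) (f ⊗ Q))
      ≡⟨ cong (λ x → - (A * x - ∑ (suc N) (f ⊗ Q))) (sym (trans (⊗-σˡ δ Q (suc N)) (∑-cong′ (suc N) (δ-⊗ Q)))) ⟩
    - (A * (σ δ ⊗ Q) (suc N) - ∑ (suc N) (f ⊗ Q))
      ≡⟨ cong (λ x → - (A * (σ δ ⊗ Q) (suc N) - x)) (sym (⊗-σˡ f Q (suc N))) ⟩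
    - (A * (σ δ ⊗ Q) (suc N) - (σ f ⊗ Q) (suc N))
      ≡⟨ cong -_ (sym (⊗-linˡ A (σ δ) (σ f) Q (suc N))) ⟩
    - (U N f ⊗ Q) (suc N) ∎
    where
    open ≡-Reasoning
    A = ∑ (suc N) f
    Q R : Seq
    Q = Z (Li (eWord l)) (map eWord ls)
    R = Z (run (eWord l) f) (map eWord ls)
    lin : ∀ n → Dᵖ l (U N f) n ≡ A * Li (eWord l) n - run (eWord l) f n
    lin n = trans (solve 4 (λ p a x y → p :* (a :* x :- y) := a :* (p :* x) :- p :* y) refl (pw n l) A (σ δ n) (σ f n))
      (sym (cong₂ (λ x y → A * x - y) (run-eWord 1≤l δ n) (run-eWord 1≤l f n)))
    ∑-minus : ∀ f g → ∑ (suc N) (λ n → f n - g n) ≡ ∑ (suc N) f - ∑ (suc N) g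
    ∑-minus f g = trans (∑-cong′ (suc N) (λ n → cong (_- g n) (sym (*-identityˡ (f n))))) (trans (∑-lin 1ℚ f g (suc N)) (cong (_- ∑ (suc N) g) (*-identityˡ (∑ (suc N) f))))

  Z≈V : ∀ {M f} ls → 0ℚ ≤ M → All (1 ℕ.≤_) ls → Order2 M f →
    ∣ ∑ (suc N) (Z f (map eWord ls)) - ∑ (suc N) (V ls f) ∣ ≤ M * q * err ls
  Z≈V {M} {f} []       0≤M []           o = ≤-reflexive (trans (cong ∣_∣ (+-inverseʳ (∑ (suc N) f))) (sym (*-zeroʳ (M * q))))
  Z≈V {M} {f} (l ∷ ls) 0≤M (1≤l ∷ 1≤ls) o = begin
    ∣ x - z ∣                                              ≡⟨ cong ∣_∣ (solve 3 (λ x y z → x :- z := (x :- y) :+ (y :- z)) refl x y z) ⟩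
    ∣ (x - y) + (y - z) ∣                                  ≤⟨ ∣p+q∣≤∣p∣+∣q∣ (x - y) (y - z) ⟩
    ∣ x - y ∣ + ∣ y - z ∣                                  ≤⟨ +-mono-≤ bound (Z≈V ls (0≤+ 0≤M 0≤M) 1≤ls (Dᵖ-U-Order2 0≤M 1≤l o)) ⟩
    (M + M) * (1ℚ * P ls) * q * H + (M + M) * q * err ls   ≡⟨ solve 5 (λ m p q h e → (m :+ m) :* (con 1ℚ :* p) :* q :* h :+ (m :+ m) :* q :* e
                                                                := m :* q :* ((con 1ℚ :+ con 1ℚ) :* p :* h :+ (con 1ℚ :+ con 1ℚ) :* e)) refl M (P ls) q H (err ls) ⟩
    M * q * err (l ∷ ls)                                   ∎
    where
    open ≤-Reasoning
    x = ∑ (suc N) (Z f (map eWord (l ∷ ls)))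
    y = ∑ (suc N) (Z (Dᵖ l (U N f)) (map eWord ls))
    z = ∑ (suc N) (V (l ∷ ls) f)
    Q : Seq
    Q = Z (Li (eWord l)) (map eWord ls)
    bound : ∣ x - y ∣ ≤ (M + M) * (1ℚ * P ls) * q * H
    bound = subst (_≤ (M + M) * (1ℚ * P ls) * q * H) (sym (trans (cong ∣_∣ (Z-step ls f 1≤l)) (∣-p∣≡∣p∣ ((U N f ⊗ Q) (suc N)))))
      (error-bound 0≤M (0≤* 0≤1 (0≤P ls)) o (Z-bound ls 0≤1 1≤ls (run-eWord-bound 1≤l (λ n _ → ∣σδ∣≤1 n))))

  -- A letter `true` costs a factor H through `σ`; a letter `false` is charged the same, as H ≥ 1,
  -- so that the exponent is just the length.
  run-bound : ∀ {M f} w → 0ℚ ≤ M → Order1 M f → Order1 (M * powℚ H (length w)) (run w f)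
  run-bound {M} {f} []      0≤M o n n≤N = subst (λ m → ∣ f n ∣ ≤ m * recip n) (sym (*-identityʳ M)) (o n n≤N)
  run-bound {M} {f} (d ∷ w) 0≤M o n n≤N = subst (λ m → ∣ run w (O d f) n ∣ ≤ m * recip n) (*-assoc M H (powℚ H (length w)))
    (run-bound w (0≤* 0≤M 0≤H) (step d) n n≤N)
    where
    open ≤-Reasoning
    ∣τ∣≤ : ∀ d n → n ℕ.≤ N → ∣ τ d f n ∣ ≤ M * H
    ∣τ∣≤ true  n n≤N = σ-bound 0≤M o n n≤N
    ∣τ∣≤ false n n≤N = ≤-trans (o n n≤N) (*-monoˡ M 0≤M (≤-trans (recip≤1 n) (1≤harmonic N)))
    step : ∀ d → Order1 (M * H) (O d f)
    step d n n≤N = begin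
      ∣ recip n * τ d f n ∣        ≡⟨ ∣p*q∣≡∣p∣*∣q∣ (recip n) (τ d f n) ⟩
      ∣ recip n ∣ * ∣ τ d f n ∣    ≡⟨ cong (_* ∣ τ d f n ∣) (0≤p⇒∣p∣≡p (0≤recip n)) ⟩
      recip n * ∣ τ d f n ∣        ≤⟨ *-monoˡ (recip n) (0≤recip n) (∣τ∣≤ d n n≤N) ⟩
      recip n * (M * H)            ≡⟨ *-comm (recip n) (M * H) ⟩
      M * H * recip n              ∎

  Li-Order1 : ∀ w → Order1 (1ℚ * powℚ H (length w)) (Li (true ∷ w))
  Li-Order1 w = run-bound w 0≤1 (λ n _ → ≤-reflexive (trans (cong ∣_∣ (Dσδ n)) (trans (0≤p⇒∣p∣≡p (0≤recip n)) (sym (*-identityˡ (recip n))))))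

  Dᵖ-Order2 : ∀ {M f l} → 1 ℕ.≤ l → Order1 M f → Order2 M (Dᵖ l f)
  Dᵖ-Order2 {M} {f} {l} 1≤l o n n≤N = ≤-trans (Dᵖ-bound 1≤l f n) (≤-trans (*-monoˡ (recip n) (0≤recip n) (o n n≤N))
    (≤-reflexive (solve 2 (λ r m → r :* (m :* r) := m :* (r :* r)) refl (recip n) M)))

-- What remains of `err` after all powers of H are raised to the exponent `length ls`: a number
-- independent of N.
errConst : List ℕ → ℚ
errConst []       = 0ℚ
errConst (l ∷ ls) = (1ℚ + 1ℚ) * powℚ (1ℚ + 1ℚ + 1ℚ) (length ls) + (1ℚ + 1ℚ) * errConst ls

0≤errConst : ∀ ls → 0ℚ ≤ errConst ls
0≤errConst []       = ≤-refl
0≤errConst (l ∷ ls) = 0≤+ (0≤* (0≤+ 0≤1 0≤1) (powℚ-nonNeg (0≤+ (0≤+ 0≤1 0≤1) 0≤1) (length ls))) (0≤* (0≤+ 0≤1 0≤1) (0≤errConst ls))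

err≤ : ∀ N ls → Bounds.err N ls ≤ errConst ls * powℚ (harmonic (suc N)) (length ls)
err≤ N []       = ≤-refl
err≤ N (l ∷ ls) = begin
  two * P ls * H + two * err ls                     ≡⟨ cong (λ p → two * p * H + two * err ls) (trans (cong (λ h → powℚ h n) (solve 1 (λ h → h :+ h :+ h := (con 1ℚ :+ con 1ℚ :+ con 1ℚ) :* h) refl H)) (powℚ-* three H n)) ⟩
  two * (t * h) * H + two * err ls                  ≤⟨ +-monoʳ-≤ (two * (t * h) * H) (*-monoˡ two 0≤two (≤-trans (err≤ N ls) (*-monoˡ (errConst ls) (0≤errConst ls) h≤H*h))) ⟩
  two * (t * h) * H + two * (errConst ls * (H * h)) ≡⟨ solve 4 (λ t h H e → (con 1ℚ :+ con 1ℚ) :* (t :* h) :* H :+ (con 1ℚ :+ con 1ℚ) :* (e :* (H :* h))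
                                                         := ((con 1ℚ :+ con 1ℚ) :* t :+ (con 1ℚ :+ con 1ℚ) :* e) :* (H :* h)) refl t h H (errConst ls) ⟩
  errConst (l ∷ ls) * (H * h)                       ∎
  where
  open ≤-Reasoning
  open Bounds N using (P; H; err; 0≤H)
  n = length ls
  two = 1ℚ + 1ℚ
  three = 1ℚ + 1ℚ + 1ℚ
  0≤two : 0ℚ ≤ two
  0≤two = 0≤+ 0≤1 0≤1
  t = powℚ three n
  h = powℚ H n
  h≤H*h : h ≤ H * h
  h≤H*h = subst (_≤ H * h) (*-identityˡ h) (*-monoʳ h (powℚ-nonNeg 0≤H n) (1≤harmonic N))

-- Powers of the harmonic numbers

-- The mean value inequality for powers; the induction writes one factor x as y + (x - y).
bernoulli : ∀ {x y} → 0ℚ ≤ y → y ≤ x → ∀ p → powℚ x (suc p) ≤ powℚ y (suc p) + ι (suc p) * (powℚ x p * (x - y))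
bernoulli {x} {y} 0≤y y≤x zero    = ≤-reflexive (solve 2 (λ x y → x :* con 1ℚ := y :* con 1ℚ :+ (con 1ℚ :+ con 0ℚ) :* (con 1ℚ :* (x :- y))) refl x y)
bernoulli {x} {y} 0≤y y≤x (suc p) = begin
  x * powℚ x (suc p)                                          ≤⟨ *-monoˡ x 0≤x (bernoulli 0≤y y≤x p) ⟩
  x * (Y + i * (powℚ x p * (x - y)))                          ≡⟨ solve 5 (λ x y Y i X → x :* (Y :+ i :* (X :* (x :- y))) := y :* Y :+ (x :- y) :* Y :+ i :* (x :* X :* (x :- y))) refl x y Y i (powℚ x p) ⟩
  y * Y + (x - y) * Y + i * (powℚ x (suc p) * (x - y))        ≤⟨ +-monoˡ-≤ (i * (powℚ x (suc p) * (x - y))) (+-monoʳ-≤ (y * Y) (*-monoˡ (x - y) (p≤q⇒0≤q-p y≤x) (powℚ-mono (suc p)))) ⟩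
  y * Y + (x - y) * powℚ x (suc p) + i * (powℚ x (suc p) * (x - y)) ≡⟨ solve 4 (λ a d X i → a :+ d :* X :+ i :* (X :* d) := a :+ (con 1ℚ :+ i) :* (X :* d)) refl (y * Y) (x - y) (powℚ x (suc p)) i ⟩
  powℚ y (suc (suc p)) + ι (suc (suc p)) * (powℚ x (suc p) * (x - y)) ∎
  where
  open ≤-Reasoning
  0≤x = ≤-trans 0≤y y≤x
  Y = powℚ y (suc p)
  i = ι (suc p)
  powℚ-mono : ∀ n → powℚ y n ≤ powℚ x n
  powℚ-mono zero    = ≤-refl
  powℚ-mono (suc n) = *-mono (powℚ-nonNeg 0≤y n) 0≤x y≤x (powℚ-mono n)

ι*recip≤2 : ∀ n → ι (suc (suc n)) * recip (suc n) ≤ 1ℚ + 1ℚ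
ι*recip≤2 n = subst (_≤ 1ℚ + 1ℚ) (sym (trans (*-distribʳ-+ (recip (suc n)) 1ℚ (ι (suc n))) (cong₂ _+_ (*-identityˡ (recip (suc n))) (ι*recip n))))
  (+-monoˡ-≤ 1ℚ (recip≤1 (suc n)))

-- This takes the place of a comparison with the logarithm: by `bernoulli` the increment of the
-- power p + 1 at n is at most (p + 1) H^p / n, which the bound for p makes bounded.
harmonic-growth : ∀ p → ∃[ K ] 0ℚ ≤ K × (∀ n → powℚ (harmonic n) p ≤ K * ι (suc n))
harmonic-growth zero    = 1ℚ , 0≤1 , λ n → subst (1ℚ ≤_) (sym (*-identityˡ (ι (suc n)))) (≤-+ʳ 1ℚ (0≤ι n))
harmonic-growth (suc p) with harmonic-growth p
... | K , 0≤K , bound = K′ , 0≤K′ , go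
  where
  open ≤-Reasoning
  -- The 2 bounds the quotient (n + 2)/(n + 1), see `ι*recip≤2`.
  K′ = ι (suc p) * (K * (1ℚ + 1ℚ))
  0≤K′ : 0ℚ ≤ K′
  0≤K′ = 0≤* (0≤ι (suc p)) (0≤* 0≤K (0≤+ 0≤1 0≤1))
  go : ∀ n → powℚ (harmonic n) (suc p) ≤ K′ * ι (suc n)
  go zero    = subst (_≤ K′ * ι 1) (sym (*-zeroˡ (powℚ 0ℚ p))) (0≤* 0≤K′ (0≤ι 1))
  go (suc n) = begin
    powℚ x (suc p)                                          ≤⟨ bernoulli (0≤harmonic n) (≤-+ʳ (harmonic n) (0≤recip (suc n))) p ⟩
    powℚ y (suc p) + ι (suc p) * (powℚ x p * (x - y))       ≡⟨ cong (λ d → powℚ y (suc p) + ι (suc p) * (powℚ x p * d)) (solve 2 (λ y r → y :+ r :- y := r) refl y r) ⟩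
    powℚ y (suc p) + ι (suc p) * (powℚ x p * r)             ≤⟨ +-mono-≤ (go n) (*-monoˡ (ι (suc p)) (0≤ι (suc p)) (begin
        powℚ x p * r                   ≤⟨ *-monoʳ r (0≤recip (suc n)) (bound (suc n)) ⟩
        K * ι (suc (suc n)) * r        ≡⟨ *-assoc K (ι (suc (suc n))) r ⟩
        K * (ι (suc (suc n)) * r)      ≤⟨ *-monoˡ K 0≤K (ι*recip≤2 n) ⟩
        K * (1ℚ + 1ℚ)                  ∎)) ⟩
    K′ * ι (suc n) + K′                                     ≡⟨ solve 2 (λ k i → k :* i :+ k := k :* (con 1ℚ :+ i)) refl K′ (ι (suc n)) ⟩
    K′ * ι (suc (suc n))                                    ∎
    where
    x = harmonic (suc n)
    y = harmonic n
    r = recip (suc n)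

-- The denominator is at least 1, so the absolute value of the numerator is large enough.
archimedes : ∀ p → ∃[ m ] p ≤ ι m
archimedes p@(mkℚ n d c) = ℤ.∣ n ∣ , toℚᵘ-cancel-≤ (ℚᵘₚ.≤-respʳ-≃ (ℚᵘₚ.≃-sym (ι≃ ℤ.∣ n ∣)) (ℚᵘ.*≤* (begin
  n ℤ.* ℤ.+ 1                       ≡⟨ ℤₚ.*-identityʳ n ⟩
  n                                 ≤⟨ n≤∣n∣ n ⟩
  ℤ.+ ℤ.∣ n ∣                       ≤⟨ ℤ.+≤+ (ℕₚ.m≤m*n ℤ.∣ n ∣ (suc d)) ⟩
  ℤ.+ (ℤ.∣ n ∣ ℕ.* suc d)           ≡⟨ ℤₚ.pos-* ℤ.∣ n ∣ (suc d) ⟩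
  ℤ.+ ℤ.∣ n ∣ ℤ.* ℤ.+ suc d         ∎)))
  where
  open ℤₚ.≤-Reasoning
  n≤∣n∣ : ∀ n → n ℤ.≤ ℤ.+ ℤ.∣ n ∣
  n≤∣n∣ (ℤ.+ n)      = ℤₚ.≤-refl
  n≤∣n∣ (ℤ.-[1+ n ]) = ℤ.-≤+

recip-small : ∀ X η → 0ℚ < η → ∃[ N₀ ] (∀ N → N₀ ℕ.≤ N → X * recip (suc N) ≤ η)
recip-small X η 0<η with archimedes (X * (1/ η) {{pos⇒nonZero η {{positive 0<η}}}})
... | m , Y≤m = m , λ N m≤N → begin
  X * recip (suc N)              ≡⟨ cong (_* recip (suc N)) X≡ ⟩
  Y * η * recip (suc N)          ≤⟨ *-monoʳ (recip (suc N)) (0≤recip (suc N)) (*-monoʳ η (<⇒≤ 0<η) Y≤m) ⟩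
  ι m * η * recip (suc N)        ≡⟨ solve 3 (λ a b c → a :* b :* c := a :* c :* b) refl (ι m) η (recip (suc N)) ⟩
  ι m * recip (suc N) * η        ≤⟨ *-monoʳ η (<⇒≤ 0<η) (ι*recip≤1 (ℕₚ.m≤n⇒m≤1+n m≤N)) ⟩
  1ℚ * η                         ≡⟨ *-identityˡ η ⟩
  η                              ∎
  where
  open ≤-Reasoning
  instance
    η≢0 = pos⇒nonZero η {{positive 0<η}}
  Y = X * 1/ η
  X≡ : X ≡ Y * η
  X≡ = sym (trans (*-assoc X (1/ η) η) (trans (cong (X *_) (*-inverseˡ η)) (*-identityʳ X)))

square-cancel-≤ : ∀ {t ε} → 0ℚ < ε → t * t ≤ ε * ε → t ≤ ε
square-cancel-≤ {t} {ε} 0<ε t²≤ε² with t ≤? ε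
... | yes t≤ε = t≤ε
... | no  t≰ε = ⊥-elim (<-irrefl refl (<-≤-trans (<-trans
  (*-monoʳ-<-pos ε {{positive 0<ε}} ε<t) (*-monoˡ-<-pos t {{positive (<-trans 0<ε ε<t)}} ε<t)) t²≤ε²))
  where
  ε<t = ≰⇒> t≰ε

square-nonNeg : ∀ c → 0ℚ ≤ c * c
square-nonNeg c with ≤-total 0ℚ c
... | inj₁ 0≤c = 0≤* 0≤c 0≤c
... | inj₂ c≤0 = subst (0ℚ ≤_) (solve 1 (λ c → :- c :* :- c := c :* c) refl c) (0≤* (neg-antimono-≤ c≤0) (neg-antimono-≤ c≤0))

harmonic-square : ∀ C p K → 0ℚ ≤ K → (∀ n → powℚ (harmonic n) (p ℕ.+ p) ≤ K * ι (suc n)) → ∀ N →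
  C * powℚ (harmonic (suc N)) p * recip (suc N) * (C * powℚ (harmonic (suc N)) p * recip (suc N)) ≤ C * C * (K * (1ℚ + 1ℚ)) * recip (suc N)
harmonic-square C p K 0≤K growth N = begin
  C * h * r * (C * h * r)          ≡⟨ solve 3 (λ c h r → c :* h :* r :* (c :* h :* r) := c :* c :* (h :* h :* r :* r)) refl C h r ⟩
  C * C * (h * h * r * r)          ≤⟨ *-monoˡ (C * C) (square-nonNeg C) (*-monoʳ r (0≤recip (suc N)) bound) ⟩
  C * C * (K * (1ℚ + 1ℚ) * r)      ≡⟨ sym (*-assoc (C * C) (K * (1ℚ + 1ℚ)) r) ⟩
  C * C * (K * (1ℚ + 1ℚ)) * r      ∎
  where
  open ≤-Reasoning
  h r : ℚ
  h = powℚ (harmonic (suc N)) p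
  r = recip (suc N)
  bound : h * h * r ≤ K * (1ℚ + 1ℚ)
  bound = begin
    h * h * r                                ≡⟨ cong (_* r) (sym (powℚ-+ (harmonic (suc N)) p p)) ⟩
    powℚ (harmonic (suc N)) (p ℕ.+ p) * r    ≤⟨ *-monoʳ r (0≤recip (suc N)) (growth (suc N)) ⟩
    K * ι (suc (suc N)) * r                  ≡⟨ *-assoc K (ι (suc (suc N))) r ⟩
    K * (ι (suc (suc N)) * r)                ≤⟨ *-monoˡ K 0≤K (ι*recip≤2 N) ⟩
    K * (1ℚ + 1ℚ)                            ∎

-- Squaring turns the bound H^{2p} = O(n) into H^p / n = O(n^{-1/2}).
harmonic-limit : ∀ C p ε → 0ℚ < ε →
  ∃[ N₀ ] (∀ N → N₀ ℕ.≤ N → C * powℚ (harmonic (suc N)) p * recip (suc N) ≤ ε)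
harmonic-limit C p ε 0<ε =
  let K , 0≤K , growth = harmonic-growth (p ℕ.+ p)
      N₀ , small = recip-small (C * C * (K * (1ℚ + 1ℚ))) (ε * ε) (positive⁻¹ (ε * ε) {{pos*pos⇒pos ε {{positive 0<ε}} ε {{positive 0<ε}}}})
  in N₀ , λ N N₀≤N → square-cancel-≤ 0<ε (≤-trans (harmonic-square C p K 0≤K growth N) (small N N₀≤N))

-- The truncated zeta value of the word of a zigzag

sumL-filter : ∀ {A : Set} (p : A → Bool) xs φ → sumL (filter (λ x → T? (p x)) xs) φ ≡ sumL xs (λ x → ind (p x) * φ x)
sumL-filter p []       φ = refl
sumL-filter p (x ∷ xs) φ with p x
... | true  = cong₂ _+_ (sym (*-identityˡ (φ x))) (sumL-filter p xs φ)
... | false = trans (sumL-filter p xs φ) (trans (sym (+-identityˡ _)) (cong (_+ sumL xs (λ x → ind (p x) * φ x)) (sym (*-zeroˡ (φ x)))))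

sumL-∑ : ∀ {A : Set} (xs : List A) (F : A → Seq) n → sumL xs (λ x → ∑ n (F x)) ≡ ∑ n (λ i → sumL xs (λ x → F x i))
sumL-∑ xs F zero    = sumL-0 xs
sumL-∑ xs F (suc n) = trans (sumL-+ xs (λ x → ∑ n (F x)) (λ x → F x n)) (cong (_+ sumL xs (λ x → F x n)) (sumL-∑ xs F n))

module WordSum {E : Set} (X : TwoPoset E)
  (eq-sound : ∀ x y → TwoPoset.eqᵇ X x y ≡ true → x ≡ y) (eq-refl : ∀ x → TwoPoset.eqᵇ X x x ≡ true) where

  open TwoPoset X
  open LinearExtensions X eq-sound eq-refl

  ok-↭ : ∀ {g h} → g ↭ h → ∀ zs → ok g zs ≡ ok h zs
  ok-↭ _↭_.refl          zs = refl
  ok-↭ (prep (x , y) p)  zs = cong (before X x y zs ∧_) (ok-↭ p zs)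
  ok-↭ (swap (x , y) (u , v) p) zs = trans (sym (∧-assoc b c _)) (trans (cong₂ _∧_ (∧-comm b c) (ok-↭ p zs)) (∧-assoc c b _))
    where
    b = before X x y zs
    c = before X u v zs
  ok-↭ (_↭_.trans p q)   zs = trans (ok-↭ p zs) (ok-↭ q zs)

  IsLinExt-ok : ∀ zs → IsLinExt X zs ≡ ok gens zs
  IsLinExt-ok zs = foldr-ok gens (λ _ _ → refl)
    where
    foldr-ok : ∀ {f : E × E → Bool → Bool} g → (∀ p b → f p b ≡ before X (proj₁ p) (proj₂ p) zs ∧ b) → foldr f true g ≡ ok g zs
    foldr-ok []      e = refl
    foldr-ok (p ∷ g) e = trans (e p _) (cong (before X (proj₁ p) (proj₂ p) zs ∧_) (foldr-ok g e))

  -- Lists of elements and relations matter only up to permutation: a poset may list its blocks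
  -- upwards while the zigzag descends.
  W-sum : ∀ x xs Bs → label x ≡ true → All HeadOne Bs → Unique (elements x xs Bs) →
    elems ↭ elements x xs Bs → gens ↭ zigzag x xs Bs → ∀ N →
    ζNW N (W X) ≡ ∑ (suc N) (Z (Li (map label (x ∷ xs))) (map labels Bs))
  W-sum x xs Bs hx hBs u elems↭ gens↭ N = begin
    ζNΣ N (map toIndex (map (map label) (linExts X)))
      ≡⟨ ζNΣ-sumL N (map toIndex (map (map label) (linExts X))) ⟩
    sumL (map toIndex (map (map label) (linExts X))) (ζN N)
      ≡⟨ trans (sumL-map toIndex (map (map label) (linExts X)) (ζN N)) (sumL-map (map label) (linExts X) (ζN N ∘ toIndex)) ⟩
    sumL (linExts X) ζE
      ≡⟨ sumL-filter (IsLinExt X) (perms elems) ζE ⟩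
    permSum (λ zs → ind (IsLinExt X zs) * ζE zs) elems
      ≡⟨ permSum-↭ elems↭ _ ⟩
    permSum (λ zs → ind (IsLinExt X zs) * ζE zs) F
      ≡⟨ permSum-cong F step ⟩
    permSum (λ zs → ∑ (suc N) (λ n → ind (ok g zs) * Li (map label zs) n)) F
      ≡⟨ sumL-∑ (perms F) (λ zs n → ind (ok g zs) * Li (map label zs) n) (suc N) ⟩
    ∑ (suc N) (λ n → permSum (λ zs → ind (ok g zs) * Li (map label zs) n) F)
      ≡⟨ ∑-cong′ (suc N) (zigzag-sum x xs Bs hx hBs u) ⟩
    ∑ (suc N) (Z (Li (map label (x ∷ xs))) (map labels Bs)) ∎
    where
    open ≡-Reasoning
    F : List E
    F = elements x xs Bs
    g : List (E × E)
    g = zigzag x xs Bs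
    ζE : List E → ℚ
    ζE zs = ζN N (toIndex (map label zs))
    start : ∀ zs → zs ↭ F → ind (ok g zs) * ζE zs ≡ ind (ok g zs) * ∑ (suc N) (Li (map label zs))
    start []      p with ∈-resp-↭ (↭-sym p) (head∈ x xs Bs)
    ... | ()
    start (z ∷ q) p with first-label x xs Bs hx hBs z q p
    ... | inj₁ h = cong (ind (ok g (z ∷ q)) *_) (subst (λ d → ζN N (toIndex (d ∷ map label q)) ≡ ∑ (suc N) (Li (d ∷ map label q))) (sym h) (ζN-toIndex N (map label q)))
    ... | inj₂ f rewrite f = trans (*-zeroˡ (ζE (z ∷ q))) (sym (*-zeroˡ (∑ (suc N) (Li (map label (z ∷ q))))))
    step : ∀ zs → zs ↭ F → ind (IsLinExt X zs) * ζE zs ≡ ∑ (suc N) (λ n → ind (ok g zs) * Li (map label zs) n)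
    step zs p = trans (cong (λ b → ind b * ζE zs) (trans (IsLinExt-ok zs) (ok-↭ gens↭ zs)))
      (trans (start zs p) (sym (∑-* (ind (ok g zs)) (Li (map label zs)) (suc N))))

-- The 2-poset of μ(𝐤, 𝐥)

from : ℕ → ℕ → List ℕ
from m zero    = []
from m (suc n) = m ∷ from (suc m) n

from-++ : ∀ m n p → from m (n ℕ.+ p) ≡ from m n ++ from (m ℕ.+ n) p
from-++ m zero    p = cong (λ k → from k p) (sym (ℕₚ.+-identityʳ m))
from-++ m (suc n) p = cong (m ∷_) (trans (from-++ (suc m) n p) (cong (λ k → from (suc m) n ++ from k p) (sym (ℕₚ.+-suc m n))))

range1-from : ∀ n → range1 n ≡ from 1 n
range1-from zero    = refl
range1-from (suc n) = trans (cong (_++ [ suc n ]) (range1-from n)) (trans (sym (from-++ 1 n 1)) (cong (from 1) (ℕₚ.+-comm n 1)))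

from-≥ : ∀ m n → All (m ℕ.≤_) (from m n)
from-≥ m zero    = []
from-≥ m (suc n) = ℕₚ.≤-refl ∷ All.map ℕₚ.<⇒≤ (from-≥ (suc m) n)

from-unique : ∀ m n → Unique (from m n)
from-unique m zero    = []
from-unique m (suc n) = All.map (λ m<k m≡k → ℕₚ.<-irrefl m≡k m<k) (from-≥ (suc m) n) ∷ from-unique (suc m) n

map-from-cong : ∀ {A : Set} {f g : ℕ → A} m n → (∀ t → m ℕ.≤ t → t ℕ.< m ℕ.+ n → f t ≡ g t) → map f (from m n) ≡ map g (from m n)
map-from-cong m zero    e = refl
map-from-cong m (suc n) e = cong₂ _∷_ (e m ℕₚ.≤-refl (ℕₚ.m<m+n m (s≤s z≤n)))
  (map-from-cong (suc m) n (λ t p q → e t (ℕₚ.<⇒≤ p) (subst (t ℕ.<_) (sym (ℕₚ.+-suc m n)) q)))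

map-from-const : ∀ {A : Set} (x : A) m n → map (λ _ → x) (from m n) ≡ replicate n x
map-from-const x m zero    = refl
map-from-const x m (suc n) = cong (x ∷_) (map-from-const x (suc m) n)

enumFrom : ℕ → Index → List (ℕ × ℕ)
enumFrom j []       = []
enumFrom j (x ∷ xs) = (j , x) ∷ enumFrom (suc j) xs

enumerate1-from : ∀ xs → enumerate1 xs ≡ enumFrom 1 xs
enumerate-from : ∀ j xs → _ ≡ enumFrom j xs
enumerate1-from xs with 1
... | j = enumerate-from j xs
enumerate-from j []       = refl
enumerate-from j (x ∷ xs) = cong ((j , x) ∷_) (enumerate-from (suc j) xs)

startsFrom : ℕ → Index → List ℕ
startsFrom c []       = []
startsFrom c (k ∷ ks) = c ∷ startsFrom (c ℕ.+ k) ks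

starts-from1 : ∀ ks → starts ks ≡ startsFrom 1 ks
starts-from : ∀ c ks → _ ≡ startsFrom c ks
starts-from1 ks with 1
... | c = starts-from c ks
starts-from c []       = refl
starts-from c (k ∷ ks) = cong (c ∷_) (starts-from (c ℕ.+ k) ks)

≡ᵇ-refl : ∀ n → (n ℕ.≡ᵇ n) ≡ true
≡ᵇ-refl n = T⇒≡ (ℕₚ.≡⇒≡ᵇ n n refl)

≢⇒≡ᵇ : ∀ {m n} → m ≢ n → (m ℕ.≡ᵇ n) ≡ false
≢⇒≡ᵇ {m} {n} m≢n with m ℕ.≡ᵇ n in e
... | false = refl
... | true  = ⊥-elim (m≢n (ℕₚ.≡ᵇ⇒≡ m n (subst T (sym e) _)))

memᵇ-< : ∀ {t} c ks → t ℕ.< c → memᵇ t (startsFrom c ks) ≡ false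
memᵇ-< c []       t<c = refl
memᵇ-< c (k ∷ ks) t<c rewrite ≢⇒≡ᵇ (ℕₚ.<⇒≢ t<c) = memᵇ-< (c ℕ.+ k) ks (ℕₚ.<-≤-trans t<c (ℕₚ.m≤m+n c k))

memᵇ-word : ∀ c ks → All (1 ℕ.≤_) ks → map (λ t → memᵇ t (startsFrom c ks)) (from c (sum ks)) ≡ indexWord ks
memᵇ-word c []           []      = refl
memᵇ-word c (suc k ∷ ks) (_ ∷ p) = begin
  map m (from c (suc k ℕ.+ sum ks))                              ≡⟨ cong (map m) (from-++ c (suc k) (sum ks)) ⟩
  map m (from c (suc k) ++ from c′ (sum ks))                     ≡⟨ Lₚ.map-++ m (from c (suc k)) (from c′ (sum ks)) ⟩
  m c ∷ (map m (from (suc c) k) ++ map m (from c′ (sum ks)))     ≡⟨ cong₂ _∷_ head (cong₂ _++_ zeros rest) ⟩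
  true ∷ (replicate k false ++ indexWord ks)                     ∎
  where
  open ≡-Reasoning
  c′ = c ℕ.+ suc k
  m : ℕ → Bool
  m t = memᵇ t (startsFrom c (suc k ∷ ks))
  head : m c ≡ true
  head rewrite ≡ᵇ-refl c = refl
  zeros : map m (from (suc c) k) ≡ replicate k false
  zeros = trans (map-from-cong (suc c) k zero-label) (map-from-const false (suc c) k)
    where
    zero-label : ∀ t → suc c ℕ.≤ t → t ℕ.< suc c ℕ.+ k → m t ≡ false
    zero-label t c<t t<c′ rewrite ≢⇒≡ᵇ (λ e → ℕₚ.<⇒≢ c<t (sym e)) = memᵇ-< c′ ks (subst (t ℕ.<_) (sym (ℕₚ.+-suc c k)) t<c′)
  rest : map m (from c′ (sum ks)) ≡ indexWord ks
  rest = trans (map-from-cong c′ (sum ks) later) (memᵇ-word c′ ks p)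
    where
    later : ∀ t → c′ ℕ.≤ t → t ℕ.< c′ ℕ.+ sum ks → m t ≡ memᵇ t (startsFrom c′ ks)
    later t c′≤t _ rewrite ≢⇒≡ᵇ (λ e → ℕₚ.<⇒≢ (ℕₚ.<-≤-trans (ℕₚ.m<m+n c (s≤s z≤n)) c′≤t) (sym e)) = refl

eltEq-refl : ∀ x → eltEq x x ≡ true
eltEq-refl (𝕒 t)   = ≡ᵇ-refl t
eltEq-refl (𝕓 j i) rewrite ≡ᵇ-refl j = ≡ᵇ-refl i

≡ᵇ-sound : ∀ m n → (m ℕ.≡ᵇ n) ≡ true → m ≡ n
≡ᵇ-sound m n e = ℕₚ.≡ᵇ⇒≡ m n (subst T (sym e) _)

eltEq-sound : ∀ x y → eltEq x y ≡ true → x ≡ y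
eltEq-sound (𝕒 t)   (𝕒 u)     e = cong 𝕒 (≡ᵇ-sound t u e)
eltEq-sound (𝕒 t)   (𝕓 _ _)   ()
eltEq-sound (𝕓 _ _) (𝕒 u)     ()
eltEq-sound (𝕓 j i) (𝕓 j′ i′) e with j ℕ.≡ᵇ j′ in ej
... | true = cong₂ 𝕓 (≡ᵇ-sound j j′ ej) (≡ᵇ-sound i i′ e)

lastPart : ℕ → Index → ℕ
lastPart l []       = l
lastPart l (m ∷ ls) = lastPart m ls

-- lowerParts l₁ (l₂ ∷ … ∷ l_s) acc = l_{s-1} ∷ … ∷ l₁ ∷ acc
lowerParts : ℕ → Index → Index → Index
lowerParts l []       acc = acc
lowerParts l (m ∷ ls) acc = lowerParts m ls (l ∷ acc)

module MuPoset (k : ℕ) (ks : Index) (l : ℕ) (ls : Index)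
  (1≤ks : All (1 ℕ.≤_) (k ∷ ks)) (1≤ls : All (1 ℕ.≤_) (l ∷ ls)) where

  X : TwoPoset Elt
  X = μPoset (k ∷ ks) (l ∷ ls)

  open TwoPoset X
  open LinearExtensions X eltEq-sound eltEq-refl
  open WordSum X eltEq-sound eltEq-refl

  K′ s : ℕ
  K′ = ℕ.pred (sum (k ∷ ks))
  s  = suc (length ls)

  sum≡ : sum (k ∷ ks) ≡ suc K′
  sum≡ = positive-sum ks 1≤ks
    where
    positive-sum : ∀ {k} ks → All (1 ℕ.≤_) (k ∷ ks) → sum (k ∷ ks) ≡ suc (ℕ.pred (sum (k ∷ ks)))
    positive-sum {zero}  ks (() ∷ _)
    positive-sum {suc k} ks _ = refl

  as : List Elt
  as = map 𝕒 (from 2 K′)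

  blockTail : ℕ → ℕ → List Elt
  blockTail j l = map (𝕓 j) (from 2 (ℕ.pred l))

  block : ℕ → ℕ → Block
  block j l = 𝕓 j 1 , blockTail j l

  -- The zigzag descends from block s - 1 to block 1, against the order of the index; the
  -- accumulator does the reversal.
  lower : ℕ → ℕ → Index → List Block → List Block
  lower j l []       acc = acc
  lower j l (m ∷ ls) acc = lower (suc j) m ls (block j l ∷ acc)

  chain-from : ∀ (f : ℕ → Elt) m n → chain (f m) (map f (from (suc m) n)) ≡ map (λ i → f i , f (suc i)) (from m n)
  chain-from f m zero    = refl
  chain-from f m (suc n) = cong ((f m , f (suc m)) ∷_) (chain-from f (suc m) n)

  top-from : ∀ (f : ℕ → Elt) m n → top (f m) (map f (from (suc m) n)) ≡ f (m ℕ.+ n)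
  top-from f m zero    = cong f (sym (ℕₚ.+-identityʳ m))
  top-from f m (suc n) = trans (top-from f (suc m) n) (cong f (sym (ℕₚ.+-suc m n)))

  chain-range : ∀ (f : ℕ → Elt) n → map (λ i → f i , f (suc i)) (range1 (n ℕ.∸ 1)) ≡ chain (f 1) (map f (from 2 (ℕ.pred n)))
  chain-range f n = trans (cong (map (λ i → f i , f (suc i))) (range1-from (n ℕ.∸ 1))) (sym (chain-from f 1 (n ℕ.∸ 1)))

  range-from : ∀ (f : ℕ → Elt) {n} → 1 ℕ.≤ n → map f (range1 n) ≡ f 1 ∷ map f (from 2 (ℕ.pred n))
  range-from f {suc n} _ = cong (map f) (range1-from (suc n))

  links : ℕ → Index → List (Elt × Elt)
  links j []       = []
  links j (m ∷ ls) = (𝕓 j 1 , 𝕓 (suc j) m) ∷ links (suc j) ls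

  relations : ℕ × ℕ → List (Elt × Elt)
  relations (j , l) = map (λ i → 𝕓 j i , 𝕓 j (suc i)) (range1 (l ℕ.∸ 1))

  members : ℕ × ℕ → List Elt
  members (j , l) = map (𝕓 j) (range1 l)

  -- The induction climbs through the blocks; `acc` holds those already passed, and each step adds
  -- one chain and the link between it and its predecessor.
  lower-zigzag : ∀ j l ls acc → All (1 ℕ.≤_) ls →
    zigzag (𝕓 (j ℕ.+ length ls) 1) (blockTail (j ℕ.+ length ls) (lastPart l ls)) (lower j l ls acc)
      ↭ (concatMap relations (enumFrom (suc j) ls) ++ links j ls) ++ zigzag (𝕓 j 1) (blockTail j l) acc
  lower-zigzag j l []       acc []        rewrite ℕₚ.+-identityʳ j = ↭-refl
  lower-zigzag j l (m ∷ ls) acc (1≤m ∷ p) rewrite ℕₚ.+-suc j (length ls) = begin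
    zigzag (𝕓 (suc j ℕ.+ length ls) 1) (blockTail (suc j ℕ.+ length ls) (lastPart m ls)) (lower (suc j) m ls (block j l ∷ acc))
      ↭⟨ lower-zigzag (suc j) m ls (block j l ∷ acc) p ⟩
    (C ++ L) ++ c ++ (𝕓 j 1 , top (𝕓 (suc j) 1) (blockTail (suc j) m)) ∷ R
      ≡⟨ cong (λ t → (C ++ L) ++ c ++ (𝕓 j 1 , t) ∷ R) (trans (top-from (𝕓 (suc j)) 1 (ℕ.pred m)) (cong (𝕓 (suc j)) (suc-pred 1≤m))) ⟩
    (C ++ L) ++ c ++ x ∷ R
      ↭⟨ shifts (C ++ L) c ⟩
    c ++ (C ++ L) ++ x ∷ R
      ↭⟨ ++⁺ˡ c (↭-trans (↭-reflexive (Lₚ.++-assoc C L (x ∷ R))) (++⁺ˡ C (shifts L [ x ]))) ⟩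
    c ++ C ++ x ∷ L ++ R
      ≡⟨ trans (sym (Lₚ.++-assoc c C (x ∷ L ++ R))) (sym (Lₚ.++-assoc (c ++ C) (x ∷ L) R)) ⟩
    ((c ++ C) ++ x ∷ L) ++ R
      ≡⟨ cong (λ d → ((d ++ C) ++ x ∷ L) ++ R) (sym (chain-range (𝕓 (suc j)) m)) ⟩
    ((relations (suc j , m) ++ C) ++ x ∷ L) ++ R ∎
    where
    open PermutationReasoning
    C = concatMap relations (enumFrom (suc (suc j)) ls)
    L = links (suc j) ls
    c = chain (𝕓 (suc j) 1) (blockTail (suc j) m)
    x = (𝕓 j 1 , 𝕓 (suc j) m)
    R = zigzag (𝕓 j 1) (blockTail j l) acc
    suc-pred : ∀ {m} → 1 ℕ.≤ m → suc (ℕ.pred m) ≡ m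
    suc-pred {suc m} _ = refl

  lower-elements : ∀ j l ls acc → All (1 ℕ.≤_) ls →
    elements (𝕓 (j ℕ.+ length ls) 1) (blockTail (j ℕ.+ length ls) (lastPart l ls)) (lower j l ls acc)
      ↭ concatMap members (enumFrom (suc j) ls) ++ elements (𝕓 j 1) (blockTail j l) acc
  lower-elements j l []       acc []        rewrite ℕₚ.+-identityʳ j = ↭-refl
  lower-elements j l (m ∷ ls) acc (1≤m ∷ p) rewrite ℕₚ.+-suc j (length ls) = begin
    elements (𝕓 (suc j ℕ.+ length ls) 1) (blockTail (suc j ℕ.+ length ls) (lastPart m ls)) (lower (suc j) m ls (block j l ∷ acc))
      ↭⟨ lower-elements (suc j) m ls (block j l ∷ acc) p ⟩
    C ++ B ++ R
      ↭⟨ shifts C B ⟩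
    B ++ C ++ R
      ≡⟨ sym (Lₚ.++-assoc B C R) ⟩
    (B ++ C) ++ R
      ≡⟨ cong (λ d → (d ++ C) ++ R) (sym (range-from (𝕓 (suc j)) 1≤m)) ⟩
    (members (suc j , m) ++ C) ++ R ∎
    where
    open PermutationReasoning
    C = concatMap members (enumFrom (suc (suc j)) ls)
    B = 𝕓 (suc j) 1 ∷ blockTail (suc j) m
    R = elements (𝕓 j 1) (blockTail j l) acc

  links-nth : ∀ (L : Index) j ms → (∀ i → nth1 L (suc (j ℕ.+ i)) ≡ nth1 ms (suc i)) →
    map (λ j → 𝕓 j 1 , 𝕓 (suc j) (nth1 L (suc j))) (from j (length ms)) ≡ links j ms
  links-nth L j []       e = refl
  links-nth L j (m ∷ ms) e = cong₂ _∷_ (cong (λ t → 𝕓 j 1 , 𝕓 (suc j) t) (trans (cong (nth1 L ∘ suc) (sym (ℕₚ.+-identityʳ j))) (e 0)))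
    (links-nth L (suc j) ms (λ i → trans (cong (nth1 L ∘ suc) (sym (ℕₚ.+-suc j i))) (e (suc i))))

  t : ℕ
  t = lastPart l ls

  -- By a_K < b_{s,1} the a's and the last block form a single chain, the top chain of the zigzag.
  xs : List Elt
  xs = as ++ 𝕓 s 1 ∷ blockTail s t

  Bs : List Block
  Bs = lower 1 l ls []

  elems≡ : elems ≡ map 𝕒 (range1 (sum (k ∷ ks))) ++ concatMap members (enumFrom 1 (l ∷ ls))
  elems≡ = cong (λ js → map 𝕒 (range1 (sum (k ∷ ks))) ++ concatMap members js) (enumerate1-from (l ∷ ls))

  elems↭ : elems ↭ elements (𝕒 1) xs Bs
  elems↭ = begin
    elems
      ≡⟨ elems≡ ⟩
    map 𝕒 (range1 (sum (k ∷ ks))) ++ members (1 , l) ++ C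
      ≡⟨ cong₂ (λ u v → u ++ v ++ C) (range-from 𝕒 (subst (1 ℕ.≤_) (sym sum≡) (s≤s z≤n))) (range-from (𝕓 1) (All.head 1≤ls)) ⟩
    (𝕒 1 ∷ as) ++ (𝕓 1 1 ∷ blockTail 1 l) ++ C
      ↭⟨ ++⁺ˡ (𝕒 1 ∷ as) (↭-trans (++-comm (𝕓 1 1 ∷ blockTail 1 l) C) (↭-sym (lower-elements 1 l ls [] (All.tail 1≤ls)))) ⟩
    (𝕒 1 ∷ as) ++ elements (𝕓 s 1) (blockTail s t) Bs
      ≡⟨ sym (elements-++ (𝕒 1) as (𝕓 s 1) (blockTail s t) Bs) ⟩
    elements (𝕒 1) xs Bs ∎
    where
    open PermutationReasoning
    C = concatMap members (enumFrom 2 ls)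

  gens↭ : gens ↭ zigzag (𝕒 1) xs Bs
  gens↭ = begin
    gens
      ≡⟨ cong₂ (λ u v → u ++ (𝕒 (sum (k ∷ ks)) , 𝕓 s 1) ∷ v) (chain-range 𝕒 (sum (k ∷ ks)))
           (cong₂ _++_ (cong (concatMap relations) (enumerate1-from (l ∷ ls)))
             (trans (cong (map (λ j → 𝕓 j 1 , 𝕓 (suc j) (nth1 (l ∷ ls) (suc j)))) (range1-from (length ls))) (links-nth (l ∷ ls) 1 ls (λ _ → refl)))) ⟩
    A ++ (𝕒 (sum (k ∷ ks)) , 𝕓 s 1) ∷ (relations (1 , l) ++ C) ++ links 1 ls
      ≡⟨ cong₂ (λ u v → A ++ (u , 𝕓 s 1) ∷ (v ++ C) ++ links 1 ls) (trans (cong 𝕒 sum≡) (sym (top-from 𝕒 1 K′))) (chain-range (𝕓 1) l) ⟩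
    A ++ x ∷ (c ++ C) ++ links 1 ls
      ↭⟨ ++⁺ˡ A (↭-prep x (↭-trans (↭-reflexive (Lₚ.++-assoc c C (links 1 ls))) (↭-trans (++-comm c (C ++ links 1 ls))
           (↭-sym (lower-zigzag 1 l ls [] (All.tail 1≤ls)))))) ⟩
    A ++ x ∷ zigzag (𝕓 s 1) (blockTail s t) Bs
      ≡⟨ sym (zigzag-++ (𝕒 1) as (𝕓 s 1) (blockTail s t) Bs) ⟩
    zigzag (𝕒 1) xs Bs ∎
    where
    open PermutationReasoning
    A = chain (𝕒 1) as
    c = chain (𝕓 1 1) (blockTail 1 l)
    C = concatMap relations (enumFrom 2 ls)
    x = (top (𝕒 1) as , 𝕓 s 1)

  BlockFrom : ℕ → Elt → Set
  BlockFrom j (𝕒 _)   = ⊥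
  BlockFrom j (𝕓 i _) = j ℕ.≤ i

  blocks-from : ∀ j ls → All (BlockFrom j) (concatMap members (enumFrom j ls))
  blocks-from j []       = []
  blocks-from j (l ∷ ls) = Allₚ.++⁺ (Allₚ.map⁺ (All.universal (λ _ → ℕₚ.≤-refl) (range1 l)))
    (All.map (λ {x} → weaken x) (blocks-from (suc j) ls))
    where
    weaken : ∀ x → BlockFrom (suc j) x → BlockFrom j x
    weaken (𝕓 i _) = ℕₚ.<⇒≤

  range1-unique : ∀ n → Unique (range1 n)
  range1-unique n = subst Unique (sym (range1-from n)) (from-unique 1 n)

  blocks-unique : ∀ j ls → Unique (concatMap members (enumFrom j ls))
  blocks-unique j []       = []
  blocks-unique j (l ∷ ls) = Uniqueₚ.++⁺ (Uniqueₚ.map⁺ (λ { refl → refl }) (range1-unique l)) (blocks-unique (suc j) ls)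
    (λ { {v} (v∈ , v∈′) → apart v (All.lookup (Allₚ.map⁺ {P = λ v → index v ≡ j} (All.universal (λ _ → refl) (range1 l))) v∈) (All.lookup (blocks-from (suc j) ls) v∈′) })
    where
    index : Elt → ℕ
    index (𝕒 _)   = 0
    index (𝕓 i _) = i
    apart : ∀ v → index v ≡ j → BlockFrom (suc j) v → ⊥
    apart (𝕓 i _) refl p = ℕₚ.<-irrefl refl p

  elems-unique : Unique elems
  elems-unique = subst Unique (sym elems≡) (Uniqueₚ.++⁺ (Uniqueₚ.map⁺ (λ { refl → refl }) (range1-unique (sum (k ∷ ks)))) (blocks-unique 1 (l ∷ ls))
    (λ { {v} (v∈ , v∈′) → apart v (All.lookup (Allₚ.map⁺ {P = IsA} (All.universal (λ _ → _) (range1 (sum (k ∷ ks))))) v∈) (All.lookup (blocks-from 1 (l ∷ ls)) v∈′) }))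
    where
    IsA : Elt → Set
    IsA (𝕒 _)   = ⊤
    IsA (𝕓 _ _) = ⊥
    apart : ∀ v → IsA v → BlockFrom 1 v → ⊥
    apart (𝕒 _)   _ ()
    apart (𝕓 _ _) ()

  elements-unique : Unique (elements (𝕒 1) xs Bs)
  elements-unique = Permₛ.Unique-resp-↭ (setoid Elt) (↭⇒↭ₛ elems↭) elems-unique

  label-a : map label (𝕒 1 ∷ as) ≡ indexWord (k ∷ ks)
  label-a = begin
    map label (map 𝕒 (from 1 (suc K′)))                                    ≡⟨ sym (Lₚ.map-∘ (from 1 (suc K′))) ⟩
    map (λ t → memᵇ t (starts (k ∷ ks))) (from 1 (suc K′))                 ≡⟨ cong₂ (λ n S → map (λ t → memᵇ t S) (from 1 n)) (sym sum≡) (starts-from1 (k ∷ ks)) ⟩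
    map (λ t → memᵇ t (startsFrom 1 (k ∷ ks))) (from 1 (sum (k ∷ ks)))     ≡⟨ memᵇ-word 1 (k ∷ ks) 1≤ks ⟩
    indexWord (k ∷ ks)                                                     ∎
    where open ≡-Reasoning

  label-a1 : label (𝕒 1) ≡ true
  label-a1 = Lₚ.∷-injectiveˡ label-a

  label-tail : ∀ j l → map label (blockTail j l) ≡ replicate (ℕ.pred l) false
  label-tail j l = zeros 0 (ℕ.pred l)
    where
    zeros : ∀ i n → map label (map (𝕓 j) (from (suc (suc i)) n)) ≡ replicate n false
    zeros i zero    = refl
    zeros i (suc n) = cong (false ∷_) (zeros (suc i) n)

  label-lower : ∀ {j} → j ℕ.< s → label (𝕓 j 1) ≡ true
  label-lower j<s = cong not (≢⇒≡ᵇ (ℕₚ.<⇒≢ j<s))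

  label-top : label (𝕓 s 1) ≡ false
  label-top = cong not (≡ᵇ-refl s)

  lower-HeadOne : ∀ j l ls acc → j ℕ.+ length ls ≡ s → All HeadOne acc → All HeadOne (lower j l ls acc)
  lower-HeadOne j l []       acc e h = h
  lower-HeadOne j l (m ∷ ls) acc e h = lower-HeadOne (suc j) m ls (block j l ∷ acc) (trans (sym (ℕₚ.+-suc j (length ls))) e)
    (label-lower (subst (j ℕ.<_) e (ℕₚ.m<m+n j (s≤s z≤n))) ∷ h)

  lower-labels : ∀ j l ls acc acc′ → j ℕ.+ length ls ≡ s → map labels acc ≡ map eWord acc′ →
    map labels (lower j l ls acc) ≡ map eWord (lowerParts l ls acc′)
  lower-labels j l []       acc acc′ e h = h
  lower-labels j l (m ∷ ls) acc acc′ e h = lower-labels (suc j) m ls (block j l ∷ acc) (l ∷ acc′) (trans (sym (ℕₚ.+-suc j (length ls))) e)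
    (cong₂ _∷_ (cong₂ _∷_ (label-lower (subst (j ℕ.<_) e (ℕₚ.m<m+n j (s≤s z≤n)))) (label-tail j l)) h)

  1≤lastPart : ∀ {l} ls → All (1 ℕ.≤_) (l ∷ ls) → 1 ℕ.≤ lastPart l ls
  1≤lastPart []       (p ∷ _) = p
  1≤lastPart (m ∷ ls) (_ ∷ p) = 1≤lastPart ls p

  -- As b_{s,1} is labelled 0, the last block is a string of l_s letters e₀. It multiplies the
  -- coefficient at n by n^(-l_s), the factor belonging to n_s = m_r.
  Li-top : ∀ n → Li (map label (𝕒 1 ∷ xs)) n ≡ Dᵖ t (Li (indexWord (k ∷ ks))) n
  Li-top n = begin
    Li (map label (𝕒 1 ∷ xs)) n                                                        ≡⟨ cong (λ w → Li w n) (Lₚ.map-++ label (𝕒 1 ∷ as) (𝕓 s 1 ∷ blockTail s t)) ⟩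
    Li (map label (𝕒 1 ∷ as) ++ map label (𝕓 s 1 ∷ blockTail s t)) n                   ≡⟨ cong₂ (λ u v → Li (u ++ v) n) label-a zeros ⟩
    Li (indexWord (k ∷ ks) ++ replicate t false) n                                     ≡⟨ cong (λ f → f n) (run-++ (indexWord (k ∷ ks)) (replicate t false) δ) ⟩
    run (replicate t false) (Li (indexWord (k ∷ ks))) n                                ≡⟨ run-replicate t (Li (indexWord (k ∷ ks))) n ⟩
    Dᵖ t (Li (indexWord (k ∷ ks))) n                                                   ∎
    where
    open ≡-Reasoning
    replicate-pred : ∀ {t} → 1 ℕ.≤ t → false ∷ replicate (ℕ.pred t) false ≡ replicate t false
    replicate-pred {suc t} _ = refl
    zeros : map label (𝕓 s 1 ∷ blockTail s t) ≡ replicate t false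
    zeros = trans (cong₂ _∷_ label-top (label-tail s t)) (replicate-pred (1≤lastPart ls 1≤ls))

  ζNW-μ : ∀ N → ζNW N (μ (k ∷ ks) (l ∷ ls)) ≡ ∑ (suc N) (Z (Dᵖ t (Li (indexWord (k ∷ ks)))) (map eWord (lowerParts l ls [])))
  ζNW-μ N = begin
    ζNW N (W X)
      ≡⟨ W-sum (𝕒 1) xs Bs label-a1 (lower-HeadOne 1 l ls [] refl []) elements-unique elems↭ gens↭ N ⟩
    ∑ (suc N) (Z (Li (map label (𝕒 1 ∷ xs))) (map labels Bs))
      ≡⟨ ∑-cong′ (suc N) (λ n → trans (cong (λ ws → Z (Li (map label (𝕒 1 ∷ xs))) ws n) (lower-labels 1 l ls [] [] refl refl)) (Z-cong (map eWord (lowerParts l ls [])) Li-top n)) ⟩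
    ∑ (suc N) (Z (Dᵖ t (Li (indexWord (k ∷ ks)))) (map eWord (lowerParts l ls []))) ∎
    where open ≡-Reasoning

-- `V` removes the chains l_{s-1}, ..., l₁ in this order, and `tails` nests the same operators with
-- l_s innermost.
V-tails : ∀ N h l ls acc → Bounds.V N (lowerParts l ls acc) (Dᵖ (lastPart l ls) h) ≡ Bounds.V N acc (tails N h l ls)
V-tails N h l []       acc = refl
V-tails N h l (m ∷ ls) acc = V-tails N h m ls (l ∷ acc)

1≤lowerParts : ∀ {l} ls acc → All (1 ℕ.≤_) (l ∷ ls) → All (1 ℕ.≤_) acc → All (1 ℕ.≤_) (lowerParts l ls acc)
1≤lowerParts []       acc _       q = q
1≤lowerParts (m ∷ ls) acc (p ∷ r) q = 1≤lowerParts ls (_ ∷ acc) r (p ∷ q)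

module _ (k : ℕ) (ks : Index) (l : ℕ) (ls : Index)
  (1≤ks : All (1 ℕ.≤_) (k ∷ ks)) (1≤ls : All (1 ℕ.≤_) (l ∷ ls)) where

  open MuPoset k ks l ls 1≤ks 1≤ls using (ζNW-μ; 1≤lastPart)

  private
    t : ℕ
    t = lastPart l ls
    lows : Index
    lows = lowerParts l ls []
    w : Word
    w = replicate (ℕ.pred k) false ++ indexWord ks

  -- The index is needed in two shapes: k ∷ ks for its word and v ++ [ c ] for its largest variable.
  -- The exponent counts one H for each letter of the word after the first and one for each chain
  -- removed.
  μ-⊛-bound : ∀ v c → k ∷ ks ≡ v ++ [ c ] → ∀ N →
    ∣ ζNW N (μ (k ∷ ks) (l ∷ ls)) - ζNΣ N ((k ∷ ks) ⊛Σ star (l ∷ ls)) ∣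
      ≤ errConst lows * powℚ (harmonic (suc N)) (length w ℕ.+ length lows) * recip (suc N)
  μ-⊛-bound v c eq N = begin
    ∣ ζNW N (μ (k ∷ ks) (l ∷ ls)) - ζNΣ N ((k ∷ ks) ⊛Σ star (l ∷ ls)) ∣
      ≡⟨ cong₂ (λ x y → ∣ x - y ∣)
           (trans (ζNW-μ N) (∑-cong′ (suc N) (Z-cong (map eWord lows) (λ n → cong (pw n t *_) (Li≡coeff n)))))
           (trans (cong (λ k → ζNΣ N (k ⊛Σ star (l ∷ ls))) eq) (trans (ζN-⊛-star N v c l ls (All.head (Allₚ.++⁻ʳ v 1≤vc)) (All.head 1≤ls))
             (cong (∑ (suc N)) (sym (V-tails N (coeff v c) l ls []))))) ⟩
    ∣ ∑ (suc N) (Z f (map eWord lows)) - ∑ (suc N) (V lows f) ∣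
      -- The series of the index is of order 1/n; the l_s ≥ 1 divisions by n of the last block raise
      -- this to 1/n².
      ≤⟨ Z≈V lows 0≤M (1≤lowerParts ls [] 1≤ls []) (Dᵖ-Order2 {M} (1≤lastPart ls 1≤ls)
           (λ n n≤N → subst (λ x → ∣ x ∣ ≤ M * recip n) (Li≡coeff n) (Li-Order1 w n n≤N))) ⟩
    M * q * err lows
      ≤⟨ *-monoˡ (M * q) (0≤* 0≤M (0≤recip (suc N))) (err≤ N lows) ⟩
    M * q * (errConst lows * powℚ H (length lows))
      ≡⟨ solve 4 (λ x q e y → con 1ℚ :* x :* q :* (e :* y) := e :* (x :* y) :* q) refl (powℚ H (length w)) q (errConst lows) (powℚ H (length lows)) ⟩
    errConst lows * (powℚ H (length w) * powℚ H (length lows)) * q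
      ≡⟨ cong (λ x → errConst lows * x * q) (sym (powℚ-+ H (length w) (length lows))) ⟩
    errConst lows * powℚ H (length w ℕ.+ length lows) * q ∎
    where
    open ≤-Reasoning
    open Bounds N
    M : ℚ
    M = 1ℚ * powℚ H (length w)
    0≤M : 0ℚ ≤ M
    0≤M = 0≤* 0≤1 (powℚ-nonNeg 0≤H (length w))
    f : Seq
    f = Dᵖ t (coeff v c)
    1≤vc : All (1 ℕ.≤_) (v ++ [ c ])
    1≤vc = subst (All (1 ℕ.≤_)) eq 1≤ks
    Li≡coeff : ∀ n → Li (indexWord (k ∷ ks)) n ≡ coeff v c n
    Li≡coeff n = trans (cong (λ k → Li (indexWord k) n) eq) (Li-index v c 1≤vc n)

∷≡∷ʳ : ∀ {A : Set} (x : A) xs → ∃[ v ] ∃[ c ] x ∷ xs ≡ v ++ [ c ]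
∷≡∷ʳ x []       = [] , x , refl
∷≡∷ʳ x (y ∷ ys) = let v , c , eq = ∷≡∷ʳ y ys in x ∷ v , c , cong (x ∷_) eq

theorem4p1 : (k l : List ℕ) → k ≢ [] → l ≢ [] → All (1 ℕ.≤_) k → All (1 ℕ.≤_) l →
    (ε : ℚ) → 0ℚ < ε → Σ ℕ λ N₀ → (N : ℕ) → N₀ ℕ.≤ N →
    ∣ ζNW N (μ k l) - ζNΣ N (k ⊛Σ star l) ∣ ≤ ε
theorem4p1 []       l        k≢[] l≢[] 1≤k 1≤l ε 0<ε = ⊥-elim (k≢[] refl)
theorem4p1 (k ∷ ks) []       k≢[] l≢[] 1≤k 1≤l ε 0<ε = ⊥-elim (l≢[] refl)
theorem4p1 (k ∷ ks) (l ∷ ls) k≢[] l≢[] 1≤k 1≤l ε 0<ε =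
  let v , c , eq = ∷≡∷ʳ k ks
      N₀ , small = harmonic-limit (errConst (lowerParts l ls []))
        (length (replicate (ℕ.pred k) false ++ indexWord ks) ℕ.+ length (lowerParts l ls [])) ε 0<ε
  in N₀ , λ N N₀≤N → ≤-trans (μ-⊛-bound k ks l ls 1≤k 1≤l v c eq N) (small N N₀≤N)
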